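{- Let $\varepsilon=\varepsilon(n)$ be a real sequence satisfying $\varepsilon\to 0$ and $\varepsilon^3 n\to\infty$ as $n\to\infty$, and let $p=p(n)=(1+\varepsilon)/n$. Then $$L_1(G_{n,p}) = (2+o_{\mathrm p}(1))\,\varepsilon n .$$ That is, for every fixed $\delta>0$, the probability that $(2-\delta)\varepsilon n\le L_1(G_{n,p})\le (2+\delta)\varepsilon n$ tends to $1$ as $n\to\infty$.
   Context: $G_{n,p}$ denotes the random graph with vertex set $[n]=\{1,2,\ldots,n\}$ in which each of the $\binom n2$ possible edges is present independently with probability $p$. (Under the assumptions, $\varepsilon>0$ and $p\in[0,1]$ for all sufficiently large $n$, and only such $n$ matter.) For a graph $G$, $L_1(G)$ is the maximal number of vertices in a (connected) component of $G$. The symbol $o_{\mathrm p}(1)$ denotes a quantity that tends to $0$ in probability as $n\to\infty$. -}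

module Defs where

open import Algebra.Bundles using (CommutativeRing)
import Algebra.Properties.Semiring.Exp as SemiringExp
import Algebra.Properties.Semiring.Mult as SemiringMult
open import Data.Bool.Base using (if_then_else_)
open import Data.Fin.Base using (Fin)
open import Data.Fin.Properties using (any?; _<?_) renaming (_≟_ to _≟ᶠ_)
open import Data.Fin.Subset using (Subset; _∈_; _∉_; _⊃_; ⁅_⁆; _∪_; ∣_∣; inside; outside)
open import Data.Fin.Subset.Induction using (⊃-wellFounded)
open import Data.Fin.Subset.Properties
  using (_∈?_; x∈⁅x⁆; x∈⁅y⁆⇒x≡y; p⊆p∪q; q⊆p∪q; x∈p∪q⁻)
open import Data.List.Base as List using (List; []; _∷_; _++_; length; filter; foldr; allFin; cartesianProduct)
open import Data.List.Extrema.Nat using (max)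
open import Data.Nat.Base as ℕ using (ℕ; zero; suc)
open import Data.Product.Base using (∃-syntax; _×_; _,_)
open import Data.Product.Properties using (≡-dec)
open import Data.Sum.Base using (_⊎_; inj₁; inj₂)
open import Data.Vec.Base as Vec using ([]; _∷_)
open import Function.Base using (_∘_)
open import Induction.WellFounded using (Acc; acc)
open import Level using (0ℓ)
open import Relation.Binary.Construct.Closure.ReflexiveTransitive using (Star; ε; _◅_; _◅◅_)
import Relation.Binary.Construct.StrictToNonStrict as StrictToNonStrict
open import Relation.Binary.Core using (Rel)
open import Relation.Binary.Definitions as Binary using ()
open import Relation.Binary.PropositionalEquality using (_≡_; subst; sym)
open import Relation.Binary.Structures using (IsStrictTotalOrder)
open import Relation.Nullary.Decidable using (yes; no; does; ¬?; _×-dec_; _⊎-dec_)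
open import Relation.Nullary.Negation using (¬_; contradiction)
open import Relation.Unary using (Pred; Decidable; Satisfiable)

-- The real numbers are given axiomatically, as a complete ordered field;
-- classically these axioms determine ℝ up to unique isomorphism.
-- `archimedean` then follows from `supremum`, but only by a proof by
-- contradiction that yields no witness, so it is listed separately.
-- The inverse is total, and 0# ⁻¹ is unspecified.
record CompleteOrderedField : Set₁ where
  infix 4 _<_ _≤?_
  infix 9 _⁻¹

  field
    commutativeRing : CommutativeRing 0ℓ 0ℓ

  open CommutativeRing commutativeRing public
    using (Carrier; _≈_; _+_; _*_; -_; _-_; 0#; 1#; semiring; isCommutativeRing)

  field
    1≉0                : ¬ (1# ≈ 0#)
    _⁻¹                : Carrier → Carrier
    ⁻¹-inverseʳ        : ∀ {x} → ¬ (x ≈ 0#) → x * x ⁻¹ ≈ 1#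
    _<_                : Rel Carrier 0ℓ
    isStrictTotalOrder : IsStrictTotalOrder _≈_ _<_
    +-monoˡ-<          : ∀ z {x y} → x < y → x + z < y + z
    *-pos              : ∀ {x y} → 0# < x → 0# < y → 0# < x * y

  open StrictToNonStrict _≈_ _<_ public using () renaming (_≤_ to infix 4 _≤_)

  open SemiringExp semiring public using (_^_)

  fromℕ : ℕ → Carrier
  fromℕ n = SemiringMult._×_ semiring n 1#

  UpperBound : Pred Carrier 0ℓ → Pred Carrier 0ℓ
  UpperBound S b = ∀ x → S x → x ≤ b

  field
    archimedean : ∀ x → ∃[ n ] x < fromℕ n
    supremum    : (S : Pred Carrier 0ℓ) → Satisfiable S → Satisfiable (UpperBound S) →
                  ∃[ s ] UpperBound S s × (∀ b → UpperBound S b → s ≤ b)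

  _≤?_ : Binary.Decidable _≤_
  _≤?_ = StrictToNonStrict.decidable′ _≈_ _<_ (IsStrictTotalOrder.compare isStrictTotalOrder)

  abs : Carrier → Carrier
  abs x = if does (0# ≤? x) then x else - x

potentialEdges : ∀ n → List (Fin n × Fin n)
potentialEdges n = filter (λ (i , j) → i <? j) (cartesianProduct (allFin n) (allFin n))

record Graph (n : ℕ) : Set where
  constructor graph
  field
    edgeSet : Subset (length (potentialEdges n))

open Graph public

Adjacent : ∀ {n} → Graph n → Rel (Fin n) 0ℓ
Adjacent {n} G i j = ∃[ e ] e ∈ edgeSet G × (endpoints e ≡ (i , j) ⊎ endpoints e ≡ (j , i))
  where endpoints = List.lookup (potentialEdges n)

adjacent? : ∀ {n} (G : Graph n) → Binary.Decidable (Adjacent G)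
adjacent? G i j = any? λ e → (e ∈? edgeSet G) ×-dec ((_ ≟² _) ⊎-dec (_ ≟² _))
  where _≟²_ = ≡-dec _≟ᶠ_ _≟ᶠ_

Connected : ∀ {n} → Graph n → Rel (Fin n) 0ℓ
Connected G = Star (Adjacent G)

private
  -- Graph search from v: S is the set of vertices found so far.
  search : ∀ {n} (G : Graph n) v S → v ∈ S → (∀ {w} → w ∈ S → Connected G v w) →
           Acc _⊃_ S → Decidable (Connected G v)
  search G v S v∈S reach (acc rec)
    with any? (λ x → any? (λ y → (x ∈? S) ×-dec (¬? (y ∈? S) ×-dec adjacent? G x y)))
  ... | yes (x , y , x∈S , y∉S , xy) =
    search G v (S ∪ ⁅ y ⁆) (p⊆p∪q ⁅ y ⁆ v∈S) reach′
      (rec (p⊆p∪q ⁅ y ⁆ , y , q⊆p∪q S ⁅ y ⁆ (x∈⁅x⁆ y) , y∉S))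
    where
    reach′ : ∀ {w} → w ∈ S ∪ ⁅ y ⁆ → Connected G v w
    reach′ {w} w∈ with x∈p∪q⁻ S ⁅ y ⁆ w∈
    ... | inj₁ w∈S = reach w∈S
    ... | inj₂ w∈y = subst (Connected G v) (sym (x∈⁅y⁆⇒x≡y y w∈y)) (reach x∈S ◅◅ (xy ◅ ε))
  ... | no closed = decide
    where
    stays : ∀ {x w} → x ∈ S → Connected G x w → w ∈ S
    stays x∈S ε = x∈S
    stays {x} x∈S (_◅_ {j = y} xy path) with y ∈? S
    ... | yes y∈S = stays y∈S path
    ... | no  y∉S = contradiction (x , y , x∈S , y∉S , xy) closed

    decide : Decidable (Connected G v)
    decide w with w ∈? S
    ... | yes w∈S = yes (reach w∈S)
    ... | no  w∉S = no (λ path → w∉S (stays v∈S path))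

connected? : ∀ {n} (G : Graph n) → Binary.Decidable (Connected G)
connected? G v = search G v ⁅ v ⁆ (x∈⁅x⁆ v)
  (λ w∈ → subst (Connected G v) (sym (x∈⁅y⁆⇒x≡y v w∈)) ε) (⊃-wellFounded ⁅ v ⁆)

component : ∀ {n} → Graph n → Fin n → Subset n
component G v = Vec.tabulate (does ∘ connected? G v)

L₁ : ∀ {n} → Graph n → ℕ
L₁ {n} G = max 0 (List.map (λ v → ∣ component G v ∣) (allFin n))

allSubsets : ∀ m → List (Subset m)
allSubsets zero    = [] ∷ []
allSubsets (suc m) = List.map (outside ∷_) (allSubsets m) ++ List.map (inside ∷_) (allSubsets m)

allGraphs : ∀ n → List (Graph n)
allGraphs n = List.map graph (allSubsets (length (potentialEdges n)))

module Probability (R : CompleteOrderedField) where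
  open CompleteOrderedField R

  bernoulliWeight : Carrier → ∀ {m} → Subset m → Carrier
  bernoulliWeight p []       = 1#
  bernoulliWeight p (b ∷ bs) = (if b then p else 1# - p) * bernoulliWeight p bs

  -- The probability that G_{n,p} satisfies A.  The formula makes sense for
  -- every p, but is a probability only when 0 ≤ p ≤ 1.
  ℙ : ∀ n → Carrier → {A : Pred (Graph n) 0ℓ} → Decidable A → Carrier
  ℙ n p A? = foldr _+_ 0# (List.map (bernoulliWeight p ∘ edgeSet) (filter A? (allGraphs n)))

module Limits (R : CompleteOrderedField) where
  open CompleteOrderedField R

  infix 4 _⟶_ _⟶∞

  _⟶_ : (ℕ → Carrier) → Carrier → Set
  a ⟶ l = ∀ η → 0# < η → ∃[ N ] ∀ n → N ℕ.≤ n → abs (a n - l) < η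

  _⟶∞ : (ℕ → Carrier) → Set
  a ⟶∞ = ∀ M → ∃[ N ] ∀ n → N ℕ.≤ n → M < a n

module Submission where

-- Explore the components of a set W of seeds one after another, possibly
-- stopping early, and let D be the set of vertices reached.  A vertex v ∉ W
-- avoids D exactly when no edge joins v to the set D⁻ explored in G - v, and
-- then D = D⁻.  With b = 1 / (1 - p) this gives E[𝟙(v ∉ D) b^|D|] = 1, and in the
-- same way E[𝟙(u, v ∉ D) b^(2|D|)] = 1.  Hence Y = |V ∖ (W ∪ D)| b^|D| has mean
-- n - |W| and variance E[Y (b^|D| - 1)] = O(E|D|) = O(εn).
--
-- Up to O(|W|), Y is f(|D|) with f(k) = (n - k) b^k ≈ n + εk - k²/2n, which is
-- above n for 0 < k < 2εn and below n afterwards.  Let |W| be of order τε²n with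
-- τ small; since ε³n → ∞, Y is within o(ε²n) of n - |W| with high probability.
-- If one stops as soon as |D| ≥ δεn, then either D ⊇ W was never stopped, or
-- |D| ≥ δεn; in both cases |D| ≤ (2 - δ)εn would make Y too large.  So the last
-- component added has more than (2 - 2δ)εn vertices.  Without stopping,
-- |D| ≥ (2 + δ)εn would make Y too small; as a component of that size is hit
-- by at least half of all seed lists, averaging over them bounds L₁ from above.

open import Defs
open import Algebra.Bundles using (CommutativeRing)
import Algebra.Properties.Ring as RingProperties
import Algebra.Properties.Semiring.Exp as SemiringExp
import Algebra.Properties.Semiring.Mult as SemiringMult
import Algebra.Properties.Semiring.Sum as SemiringSum
import Algebra.Solver.Ring as RingSolver
open import Algebra.Solver.Ring.AlmostCommutativeRing
  using (fromCommutativeRing; _-Raw-AlmostCommutative⟶_)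
open import Data.Bool.Base using (Bool; true; false; if_then_else_; not; _∧_; _∨_)
open import Data.Fin.Base using (Fin; zero; suc)
import Data.Fin.Properties as Fin
open import Data.Fin.Subset
  using (Subset; _∈_; _∉_; _⊆_; ∣_∣; inside; outside; _∪_; _─_; ∁; ⊥; ⁅_⁆)
open import Data.Fin.Subset.Properties
  using ( _∈?_; ∉⊥; ∣⊥∣≡0; ∣⁅x⁆∣≡1; ∣∁p∣≡n∸∣p∣; ∣p∣≤n; ∣q∣≤∣p∪q∣; p⊆q⇒∣p∣≤∣q∣; drop-∷-⊆
        ; ⊆-refl; ⊆-trans; ⊆-antisym; p⊆p∪q; q⊆p∪q; x∈p∪q⁺; x∈p∪q⁻; x∈⁅x⁆; x∈⁅y⁆⇒x≡y
        ; x∈p∧x∉q⇒x∈p─q; p─q⊆p )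
open import Data.Integer.Base as ℤ using (ℤ; +_; -[1+_])
import Data.Integer.Properties as ℤ
open import Data.List.Base as List using (List; []; _∷_; _++_; filter; allFin; cartesianProduct)
import Data.List.Extrema.Nat as Extrema
open import Data.List.Membership.Propositional using () renaming (_∈_ to _∈ˡ_)
open import Data.List.Membership.Propositional.Properties
  using (∈-map⁺; ∈-map⁻; ∈-filter⁺; ∈-filter⁻; ∈-allFin)
open import Data.List.Properties using (map-++; map-∘)
import Data.List.Relation.Unary.All as All
open import Data.List.Relation.Unary.Any using (here; there)
open import Data.Maybe.Base as Maybe using (Maybe)
open import Data.Nat.Base as ℕ using (ℕ; zero; suc)
open import Data.Nat.ListAction using () renaming (sum to sumˡ)
open import Data.Nat.ListAction.Properties using (sum-++)
import Data.Nat.Properties as ℕ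
open import Data.Nat.Tactic.RingSolver using (solve-∀)
open import Data.Product.Base using (∃-syntax; _×_; _,_; proj₁; proj₂)
open import Data.Sum.Base using (_⊎_; inj₁; inj₂; [_,_]) renaming (swap to ⊎-swap)
open import Data.Vec.Base as Vec using ([]; _∷_; here; there)
open import Data.Vec.Properties
  using (lookup∘tabulate; lookup-zipWith; lookup-map; []=⇒lookup; lookup⇒[]=)
open import Function.Base using (_∘_; id)
open import Level using (0ℓ)
open import Relation.Binary.Construct.Closure.ReflexiveTransitive as Star
  using (_◅_; _◅◅_)
import Relation.Binary.Construct.StrictToNonStrict as StrictToNonStrict
open import Relation.Binary.Definitions using (tri<; tri≈; tri>)
open import Relation.Binary.PropositionalEquality as ≡ using (_≡_; _≢_)
import Relation.Binary.Reasoning.Setoid as SetoidReasoning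
open import Relation.Binary.Structures using (IsStrictTotalOrder)
open import Relation.Nullary.Decidable
  using (Dec; yes; no; does; dec⇒maybe; dec-true; dec-false; _×-dec_; _⊎-dec_)
open import Relation.Nullary.Negation using (¬_; contradiction)
open import Relation.Unary using (Pred; Decidable)

-- No branching process, random walk or martingale is used: all probability enters through
-- Chebyshev's inequality for `Y`. Its variance bound needs `E|D| = O(εn)` beforehand, and this
-- comes from the first moment alone: `2εk + f(k)` never exceeds `n` by more than `O(ε²n)`, while
-- `E Y = n - |W|` is known exactly. The threshold `τε²n` is the scale of the gap between `f` and
-- `n`; its square divided by a variance of order `εn` is of order `τ²ε³n`. The number of seeds is
-- squeezed from both sides. It must stay well below the gap, of order `δ²ε²n`; but when all of `W`
-- has been explored, the deviation of `Y` is produced by `|W|` itself, so `|W| ≥ τε²n` is wanted.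
-- That many seeds also suffice to hit a component of `2εn` vertices, because `τε²n · 2εn` is a
-- large multiple of `n`. Early stopping answers the objection that a large `D` might be a union of
-- many medium components. Averaging over all seed lists replaces an appeal to the symmetry of the
-- random graph, since a fixed `W` could miss the largest component.

module OrderedField (R : CompleteOrderedField) where

  open CompleteOrderedField R public
  open CommutativeRing commutativeRing public
    using ( refl; sym; trans; reflexive; setoid; ring; -‿cong
          ; +-cong; +-congˡ; +-congʳ; +-comm; +-assoc; +-identityˡ; +-identityʳ
          ; *-cong; *-congˡ; *-congʳ; *-comm; *-assoc; *-identityˡ; *-identityʳ
          ; distribˡ; distribʳ; zeroˡ; zeroʳ; -‿inverseʳ )
  open RingProperties ring
    using (-‿involutive; -‿distribˡ-*; -‿distribʳ-*; -0#≈0#; -‿+-comm)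
  open SemiringMult semiring using (×-homo-+; ×1-homo-*; ×-homo-1)
  open SemiringExp semiring public using (^-congˡ; ^-homo-*)
  open SetoidReasoning setoid

  -- Natural numbers and integers in the field, and the ring solver

  fromℕ-homo-+ : ∀ m n → fromℕ (m ℕ.+ n) ≈ fromℕ m + fromℕ n
  fromℕ-homo-+ = ×-homo-+ 1#

  fromℕ-homo-* : ∀ m n → fromℕ (m ℕ.* n) ≈ fromℕ m * fromℕ n
  fromℕ-homo-* = ×1-homo-*

  fromℕ-1 : fromℕ 1 ≈ 1#
  fromℕ-1 = ×-homo-1 1#

  private
    -- The clause for `+ 1` makes `con (+ 1)` evaluate to `1#` instead of `fromℕ 1`, which unfolds
    -- to `1# + 0#`; every other natural numeral evaluates to the very term `fromℕ n`. Solver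
    -- equations then match the goals without conversion.
    fromℤ : ℤ → Carrier
    fromℤ (+ 1)      = 1#
    fromℤ (+ n)      = fromℕ n
    fromℤ (-[1+ n ]) = - fromℕ (suc n)

    fromℤ-pos : ∀ n → fromℤ (+ n) ≈ fromℕ n
    fromℤ-pos zero          = refl
    fromℤ-pos (suc zero)    = sym fromℕ-1
    fromℤ-pos (suc (suc n)) = refl

    fromℤ-neg : ∀ i → fromℤ (ℤ.- i) ≈ - fromℤ i
    fromℤ-neg (+ zero)        = sym -0#≈0#
    fromℤ-neg (+ 1)           = -‿cong fromℕ-1
    fromℤ-neg (+ suc (suc n)) = refl
    fromℤ-neg (-[1+ n ])      = trans (fromℤ-pos (suc n)) (sym (-‿involutive _))

    fromℤ-⊖ : ∀ m n → fromℤ (m ℤ.⊖ n) ≈ fromℕ m - fromℕ n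
    fromℤ-⊖ zero n = begin
      fromℤ (0 ℤ.⊖ n)    ≡⟨ ≡.cong fromℤ (ℤ.⊖-≤ {0} {n} ℕ.z≤n) ⟩
      fromℤ (ℤ.- (+ n))  ≈⟨ fromℤ-neg (+ n) ⟩
      - fromℤ (+ n)      ≈⟨ -‿cong (fromℤ-pos n) ⟩
      - fromℕ n          ≈⟨ +-identityˡ _ ⟨
      0# - fromℕ n       ∎
    fromℤ-⊖ (suc m) zero = begin
      fromℤ (+ suc m)      ≈⟨ fromℤ-pos (suc m) ⟩
      fromℕ (suc m)        ≈⟨ +-identityʳ _ ⟨
      fromℕ (suc m) + 0#   ≈⟨ +-congˡ -0#≈0# ⟨
      fromℕ (suc m) - 0#   ∎
    fromℤ-⊖ (suc m) (suc n) = begin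
      fromℤ (suc m ℤ.⊖ suc n)                  ≡⟨ ≡.cong fromℤ (ℤ.[1+m]⊖[1+n]≡m⊖n m n) ⟩
      fromℤ (m ℤ.⊖ n)                          ≈⟨ fromℤ-⊖ m n ⟩
      fromℕ m - fromℕ n                        ≈⟨ +-congʳ (+-identityʳ _) ⟨
      (fromℕ m + 0#) - fromℕ n                 ≈⟨ +-congʳ (+-congˡ (-‿inverseʳ 1#)) ⟨
      (fromℕ m + (1# - 1#)) - fromℕ n          ≈⟨ +-congʳ (+-assoc _ _ _) ⟨
      ((fromℕ m + 1#) - 1#) - fromℕ n          ≈⟨ +-congʳ (+-congʳ (+-comm _ _)) ⟩
      (fromℕ (suc m) - 1#) - fromℕ n           ≈⟨ +-assoc _ _ _ ⟩
      fromℕ (suc m) + (- 1# - fromℕ n)         ≈⟨ +-congˡ (-‿+-comm _ _) ⟩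
      fromℕ (suc m) - fromℕ (suc n)            ∎

    fromℤ-homo-+ : ∀ i j → fromℤ (i ℤ.+ j) ≈ fromℤ i + fromℤ j
    fromℤ-homo-+ (+ m) (+ n) = begin
      fromℤ (+ (m ℕ.+ n))        ≈⟨ fromℤ-pos (m ℕ.+ n) ⟩
      fromℕ (m ℕ.+ n)            ≈⟨ fromℕ-homo-+ m n ⟩
      fromℕ m + fromℕ n          ≈⟨ +-cong (fromℤ-pos m) (fromℤ-pos n) ⟨
      fromℤ (+ m) + fromℤ (+ n)  ∎
    fromℤ-homo-+ (+ m) -[1+ n ] = trans (fromℤ-⊖ m (suc n)) (+-congʳ (sym (fromℤ-pos m)))
    fromℤ-homo-+ -[1+ m ] (+ n) =
      trans (fromℤ-⊖ n (suc m)) (trans (+-comm _ _) (+-congˡ (sym (fromℤ-pos n))))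
    fromℤ-homo-+ -[1+ m ] -[1+ n ] = begin
      - fromℕ (suc (suc (m ℕ.+ n)))          ≡⟨ ≡.cong (λ k → - fromℕ (suc k)) (ℕ.+-suc m n) ⟨
      - fromℕ (suc m ℕ.+ suc n)              ≈⟨ -‿cong (fromℕ-homo-+ (suc m) (suc n)) ⟩
      - (fromℕ (suc m) + fromℕ (suc n))      ≈⟨ -‿+-comm _ _ ⟨
      - fromℕ (suc m) - fromℕ (suc n)        ∎

    fromℤ-pos-* : ∀ m n → fromℤ (+ m ℤ.* + n) ≈ fromℕ m * fromℕ n
    fromℤ-pos-* m n = begin
      fromℤ (+ m ℤ.* + n)  ≡⟨ ≡.cong fromℤ (ℤ.pos-* m n) ⟨
      fromℤ (+ (m ℕ.* n))  ≈⟨ fromℤ-pos (m ℕ.* n) ⟩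
      fromℕ (m ℕ.* n)      ≈⟨ fromℕ-homo-* m n ⟩
      fromℕ m * fromℕ n    ∎

    fromℤ-homo-* : ∀ i j → fromℤ (i ℤ.* j) ≈ fromℤ i * fromℤ j
    fromℤ-homo-* (+ m) (+ n) =
      trans (fromℤ-pos-* m n) (sym (*-cong (fromℤ-pos m) (fromℤ-pos n)))
    fromℤ-homo-* (+ m) -[1+ n ] = begin
      fromℤ (+ m ℤ.* -[1+ n ])          ≡⟨ ≡.cong fromℤ (ℤ.neg-distribʳ-* (+ m) (+ suc n)) ⟨
      fromℤ (ℤ.- (+ m ℤ.* + suc n))     ≈⟨ fromℤ-neg (+ m ℤ.* + suc n) ⟩
      - fromℤ (+ m ℤ.* + suc n)         ≈⟨ -‿cong (fromℤ-pos-* m (suc n)) ⟩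
      - (fromℕ m * fromℕ (suc n))       ≈⟨ -‿distribʳ-* _ _ ⟩
      fromℕ m * - fromℕ (suc n)         ≈⟨ *-congʳ (fromℤ-pos m) ⟨
      fromℤ (+ m) * - fromℕ (suc n)     ∎
    fromℤ-homo-* -[1+ m ] (+ n) = begin
      fromℤ (-[1+ m ] ℤ.* + n)          ≡⟨ ≡.cong fromℤ (ℤ.neg-distribˡ-* (+ suc m) (+ n)) ⟨
      fromℤ (ℤ.- (+ suc m ℤ.* + n))     ≈⟨ fromℤ-neg (+ suc m ℤ.* + n) ⟩
      - fromℤ (+ suc m ℤ.* + n)         ≈⟨ -‿cong (fromℤ-pos-* (suc m) n) ⟩
      - (fromℕ (suc m) * fromℕ n)       ≈⟨ -‿distribˡ-* _ _ ⟩
      - fromℕ (suc m) * fromℕ n         ≈⟨ *-congˡ (fromℤ-pos n) ⟨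
      - fromℕ (suc m) * fromℤ (+ n)     ∎
    fromℤ-homo-* -[1+ m ] -[1+ n ] = begin
      fromℤ (+ suc m ℤ.* + suc n)           ≈⟨ fromℤ-pos-* (suc m) (suc n) ⟩
      fromℕ (suc m) * fromℕ (suc n)         ≈⟨ -‿involutive _ ⟨
      - - (fromℕ (suc m) * fromℕ (suc n))   ≈⟨ -‿cong (-‿distribˡ-* _ _) ⟩
      - (- fromℕ (suc m) * fromℕ (suc n))   ≈⟨ -‿distribʳ-* _ _ ⟩
      - fromℕ (suc m) * - fromℕ (suc n)     ∎

    fromℤ-morphism : ℤ.+-*-rawRing -Raw-AlmostCommutative⟶ fromCommutativeRing commutativeRing
    fromℤ-morphism = record
      { ⟦_⟧    = fromℤ
      ; +-homo = fromℤ-homo-+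
      ; *-homo = fromℤ-homo-*
      ; -‿homo = fromℤ-neg
      ; 0-homo = refl
      ; 1-homo = refl
      }

    _≟fromℤ_ : ∀ i j → Maybe (fromℤ i ≈ fromℤ j)
    i ≟fromℤ j = Maybe.map (reflexive ∘ ≡.cong fromℤ) (dec⇒maybe (i ℤ.≟ j))

  open RingSolver ℤ.+-*-rawRing (fromCommutativeRing commutativeRing) fromℤ-morphism _≟fromℤ_ public
    using (solve; _:=_; _:+_; _:-_; _:*_; _:^_; con; :-_)

  -- Inequalities in the ordered field

  open IsStrictTotalOrder isStrictTotalOrder public
    using (compare) renaming (trans to <-trans; irrefl to <-irrefl)
  private
    module ≤ = StrictToNonStrict _≈_ _<_
    module STO = IsStrictTotalOrder isStrictTotalOrder

  <⇒≤ : ∀ {x y} → x < y → x ≤ y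
  <⇒≤ = inj₁

  ≤-reflexive : ∀ {x y} → x ≈ y → x ≤ y
  ≤-reflexive = inj₂

  ≤-refl : ∀ {x} → x ≤ x
  ≤-refl = inj₂ refl

  ≤-trans : ∀ {x y z} → x ≤ y → y ≤ z → x ≤ z
  ≤-trans = ≤.trans STO.isEquivalence STO.<-resp-≈ STO.trans

  <-≤-trans : ∀ {x y z} → x < y → y ≤ z → x < z
  <-≤-trans = ≤.<-≤-trans STO.trans (proj₁ STO.<-resp-≈)

  ≤-<-trans : ∀ {x y z} → x ≤ y → y < z → x < z
  ≤-<-trans = ≤.≤-<-trans sym STO.trans (proj₂ STO.<-resp-≈)

  ≰⇒> : ∀ {x y} → ¬ (x ≤ y) → y < x
  ≰⇒> {x} {y} x≰y with compare x y
  ... | tri< x<y _ _ = contradiction (inj₁ x<y) x≰y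
  ... | tri≈ _ x≈y _ = contradiction (inj₂ x≈y) x≰y
  ... | tri> _ _ y<x = y<x

  <⇒≱ : ∀ {x y} → x < y → ¬ (y ≤ x)
  <⇒≱ x<y y≤x = <-irrefl refl (<-≤-trans x<y y≤x)

  ≤-total : ∀ x y → x ≤ y ⊎ y ≤ x
  ≤-total x y with x ≤? y
  ... | yes x≤y = inj₁ x≤y
  ... | no  x≰y = inj₂ (<⇒≤ (≰⇒> x≰y))

  x<y⇒0<y-x : ∀ {x y} → x < y → 0# < y - x
  x<y⇒0<y-x {x} {y} x<y =
    <-≤-trans (≤-<-trans (≤-reflexive (sym (-‿inverseʳ x))) (+-monoˡ-< (- x) x<y)) ≤-refl

  x≤y⇒0≤y-x : ∀ {x y} → x ≤ y → 0# ≤ y - x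
  x≤y⇒0≤y-x     (inj₁ x<y) = inj₁ (x<y⇒0<y-x x<y)
  x≤y⇒0≤y-x {x} (inj₂ x≈y) = inj₂ (trans (sym (-‿inverseʳ x)) (+-congʳ x≈y))

  -- Inequalities are proved from certificates: y - x is exhibited as a
  -- combination of quantities already known to be nonnegative.
  y-x≈c⇒x≤y : ∀ {x y c} → 0# ≤ c → y - x ≈ c → x ≤ y
  y-x≈c⇒x≤y {x} {y} 0≤c y-x≈c = go (≤-trans 0≤c (≤-reflexive (sym y-x≈c)))
    where
    back : ∀ a b → a - b + b ≈ a
    back a b = (solve 2 (λ a b → a :- b :+ b := a) refl a b)
    go : 0# ≤ y - x → x ≤ y
    go (inj₁ 0<) = inj₁ (<-≤-trans (≤-<-trans (≤-reflexive (sym (+-identityˡ x))) (+-monoˡ-< x 0<))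
                                   (≤-reflexive (back y x)))
    go (inj₂ 0≈) = inj₂ (trans (sym (+-identityˡ x)) (trans (+-congʳ 0≈) (back y x)))

  y-x≈c⇒x<y : ∀ {x y c} → 0# < c → y - x ≈ c → x < y
  y-x≈c⇒x<y {x} {y} 0<c y-x≈c =
    <-≤-trans (≤-<-trans (≤-reflexive (sym (+-identityˡ x)))
                         (+-monoˡ-< x (<-≤-trans 0<c (≤-reflexive (sym y-x≈c)))))
              (≤-reflexive (solve 2 (λ y x → y :- x :+ x := y) refl y x))

  +-mono-≤ : ∀ {x y u v} → x ≤ y → u ≤ v → x + u ≤ y + v
  +-mono-≤ {x} {y} {u} {v} x≤y u≤v =
    ≤-trans (+-monoˡ u x≤y) (≤-trans (≤-reflexive (+-comm _ _)) (≤-trans (+-monoˡ y u≤v) (≤-reflexive (+-comm _ _))))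
    where
    +-monoˡ : ∀ z {x y} → x ≤ y → x + z ≤ y + z
    +-monoˡ z (inj₁ x<y) = inj₁ (+-monoˡ-< z x<y)
    +-monoˡ z (inj₂ x≈y) = inj₂ (+-congʳ x≈y)

  infixl 6 _⊕_
  infixl 7 _⊗_

  _⊕_ : ∀ {x y} → 0# ≤ x → 0# ≤ y → 0# ≤ x + y
  0≤x ⊕ 0≤y = ≤-trans (≤-reflexive (sym (+-identityˡ 0#))) (+-mono-≤ 0≤x 0≤y)

  _⊗_ : ∀ {x y} → 0# ≤ x → 0# ≤ y → 0# ≤ x * y
  inj₁ 0<x ⊗ inj₁ 0<y = inj₁ (*-pos 0<x 0<y)
  inj₁ _   ⊗ inj₂ 0≈y = inj₂ (trans (sym (zeroʳ _)) (*-congˡ 0≈y))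
  inj₂ 0≈x ⊗ _        = inj₂ (trans (sym (zeroˡ _)) (*-congʳ 0≈x))

  +-pos-nonneg : ∀ {x y} → 0# < x → 0# ≤ y → 0# < x + y
  +-pos-nonneg {x} {y} 0<x 0≤y = <-≤-trans 0<x (y-x≈c⇒x≤y 0≤y
    (solve 2 (λ x y → x :+ y :- x := y) refl x y))

  square-nonneg : ∀ x → 0# ≤ x * x
  square-nonneg x with ≤-total 0# x
  ... | inj₁ 0≤x = 0≤x ⊗ 0≤x
  ... | inj₂ x≤0 = ≤-trans (0≤-x ⊗ 0≤-x) (≤-reflexive
    (solve 1 (λ x → (con (+ 0) :- x) :* (con (+ 0) :- x) := x :* x) refl x))
    where 0≤-x = x≤y⇒0≤y-x x≤0

  0<1 : 0# < 1#
  0<1 with compare 0# 1#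
  ... | tri< 0<1 _ _ = 0<1
  ... | tri≈ _ 0≈1 _ = contradiction (sym 0≈1) 1≉0
  ... | tri> _ _ 1<0 = contradiction (<-≤-trans (*-pos 0<-1 0<-1) (≤-reflexive e)) (λ 0<1 → <-irrefl refl (<-trans 1<0 0<1))
    where
    0<-1 = x<y⇒0<y-x 1<0
    e : (0# - 1#) * (0# - 1#) ≈ 1#
    e = (solve 0 ((con (+ 0) :- con (+ 1)) :* (con (+ 0) :- con (+ 1)) := con (+ 1)) refl)

  fromℕ-nonneg : ∀ n → 0# ≤ fromℕ n
  fromℕ-nonneg zero    = ≤-refl
  fromℕ-nonneg (suc n) = <⇒≤ 0<1 ⊕ fromℕ-nonneg n

  fromℕ-pos : ∀ n → 0# < fromℕ (suc n)
  fromℕ-pos n = +-pos-nonneg 0<1 (fromℕ-nonneg n)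

  fromℕ-mono-≤ : ∀ {m n} → m ℕ.≤ n → fromℕ m ≤ fromℕ n
  fromℕ-mono-≤ {m} {n} m≤n = ≤-trans (y-x≈c⇒x≤y (fromℕ-nonneg (n ℕ.∸ m))
    (solve 2 (λ v1 v2 → v1 :+ v2 :- v1 := v2) refl (fromℕ m) (fromℕ (n ℕ.∸ m))))
    (≤-reflexive (trans (sym (fromℕ-homo-+ m (n ℕ.∸ m))) (reflexive (≡.cong fromℕ (ℕ.m+[n∸m]≡n m≤n)))))

  fromℕ-cancel-< : ∀ {m n} → fromℕ m < fromℕ n → m ℕ.< n
  fromℕ-cancel-< m<n = ℕ.≰⇒> (λ n≤m → <⇒≱ m<n (fromℕ-mono-≤ n≤m))

  fromℕ-∸ : ∀ {m n} → m ℕ.≤ n → fromℕ (n ℕ.∸ m) ≈ fromℕ n - fromℕ m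
  fromℕ-∸ {m} {n} m≤n = begin
    fromℕ (n ℕ.∸ m)                           ≈⟨
      (solve 2 (λ v1 v2 → v1 := v2 :+ v1 :- v2) refl (fromℕ (n ℕ.∸ m)) (fromℕ m)) ⟩
    fromℕ m + fromℕ (n ℕ.∸ m) - fromℕ m       ≈⟨ +-congʳ (fromℕ-homo-+ m (n ℕ.∸ m)) ⟨
    fromℕ (m ℕ.+ (n ℕ.∸ m)) - fromℕ m         ≡⟨ ≡.cong (λ k → fromℕ k - fromℕ m) (ℕ.m+[n∸m]≡n m≤n) ⟩
    fromℕ n - fromℕ m                         ∎

  *-monoˡ-≤ : ∀ {c x y} → 0# ≤ c → x ≤ y → c * x ≤ c * y
  *-monoˡ-≤ {c} {x} {y} 0≤c x≤y = y-x≈c⇒x≤y (0≤c ⊗ x≤y⇒0≤y-x x≤y)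
    (solve 3 (λ c y x → c :* y :- c :* x := c :* (y :- x)) refl c y x)

  *-mono-≤ : ∀ {x y u v} → 0# ≤ y → 0# ≤ u → x ≤ y → u ≤ v → x * u ≤ y * v
  *-mono-≤ {x} {y} {u} {v} 0≤y 0≤u x≤y u≤v =
    y-x≈c⇒x≤y (x≤y⇒0≤y-x x≤y ⊗ 0≤u ⊕ 0≤y ⊗ x≤y⇒0≤y-x u≤v)
      (solve 4 (λ y v x u → y :* v :- x :* u := (y :- x) :* u :+ y :* (v :- u)) refl y v x u)

  *-cancelˡ-≤ : ∀ {c x y} → 0# < c → c * x ≤ c * y → x ≤ y
  *-cancelˡ-≤ {c} {x} {y} 0<c cx≤cy with x ≤? y
  ... | yes x≤y = x≤y
  ... | no  x≰y = contradiction cx≤cy (<⇒≱ (y-x≈c⇒x<y (*-pos 0<c (x<y⇒0<y-x (≰⇒> x≰y)))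
    (solve 3 (λ c x y → c :* x :- c :* y := c :* (x :- y)) refl c x y)))

  *-cancelˡ-pos : ∀ {c x} → 0# ≤ c → 0# < c * x → 0# < x
  *-cancelˡ-pos {c} {x} 0≤c 0<cx = ≰⇒> λ x≤0 → <⇒≱ 0<cx (≤-trans (*-monoˡ-≤ 0≤c x≤0) (≤-reflexive (zeroʳ c)))

  pos⇒≉0 : ∀ {x} → 0# < x → ¬ (x ≈ 0#)
  pos⇒≉0 0<x x≈0 = <-irrefl (sym x≈0) 0<x

  ⁻¹-pos : ∀ {x} → 0# < x → 0# < x ⁻¹
  ⁻¹-pos 0<x = *-cancelˡ-pos (<⇒≤ 0<x) (<-≤-trans 0<1 (≤-reflexive (sym (⁻¹-inverseʳ (pos⇒≉0 0<x)))))

  ^-nonneg : ∀ {x} n → 0# ≤ x → 0# ≤ x ^ n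
  ^-nonneg zero    0≤x = <⇒≤ 0<1
  ^-nonneg (suc n) 0≤x = 0≤x ⊗ ^-nonneg n 0≤x

  ^-pos : ∀ {x} n → 0# < x → 0# < x ^ n
  ^-pos zero    0<x = 0<1
  ^-pos (suc n) 0<x = *-pos 0<x (^-pos n 0<x)

  1≤^ : ∀ {x} n → 1# ≤ x → 1# ≤ x ^ n
  1≤^ zero    1≤x = ≤-refl
  1≤^ {x} (suc n) 1≤x =
    ≤-trans (≤-reflexive (sym (*-identityˡ 1#))) (*-mono-≤ (≤-trans (<⇒≤ 0<1) 1≤x) (<⇒≤ 0<1) 1≤x (1≤^ n 1≤x))

  floor : ∀ x → 0# ≤ x → ∃[ n ] fromℕ n ≤ x × x < fromℕ (suc n)
  floor x 0≤x = go (proj₁ (archimedean x)) (proj₂ (archimedean x))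
    where
    go : ∀ k → x < fromℕ k → ∃[ n ] fromℕ n ≤ x × x < fromℕ (suc n)
    go zero    x<0 = contradiction 0≤x (<⇒≱ x<0)
    go (suc k) x<k with fromℕ k ≤? x
    ... | yes k≤x = k , k≤x , x<k
    ... | no  k≰x = go k (≰⇒> k≰x)

  x≤abs : ∀ x → x ≤ abs x
  x≤abs x with 0# ≤? x
  ... | yes _   = ≤-refl
  ... | no  0≰x = ≤-trans (<⇒≤ (≰⇒> 0≰x)) (y-x≈c⇒x≤y (x≤y⇒0≤y-x (<⇒≤ (≰⇒> 0≰x)))
    (solve 1 (λ x → (:- x) :- con (+ 0) := con (+ 0) :- x) refl x))

  abs<⁺ : ∀ {x y} → x < y → - x < y → abs x < y
  abs<⁺ {x} x<y -x<y with 0# ≤? x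
  ... | yes _ = x<y
  ... | no  _ = -x<y

-- Disjoint subsets, and the exploration of components

disjoint : ∀ {m} → Subset m → Subset m → Bool
disjoint []      []      = true
disjoint (x ∷ S) (y ∷ T) = not (x ∧ y) ∧ disjoint S T

disjoint⁻ : ∀ {m} (S T : Subset m) → disjoint S T ≡ true → ∀ {e} → e ∈ S → e ∉ T
disjoint⁻ (inside  ∷ S) (inside  ∷ T) () here here
disjoint⁻ (inside  ∷ S) (outside ∷ T) d (there e∈S) (there e∈T) = disjoint⁻ S T d e∈S e∈T
disjoint⁻ (outside ∷ S) (y       ∷ T) d (there e∈S) (there e∈T) = disjoint⁻ S T d e∈S e∈T

disjoint⁺ : ∀ {m} (S T : Subset m) → (∀ {e} → e ∈ S → e ∉ T) → disjoint S T ≡ true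
disjoint⁺ []            []            _   = ≡.refl
disjoint⁺ (inside  ∷ S) (inside  ∷ T) S∌T = contradiction here (S∌T here)
disjoint⁺ (inside  ∷ S) (outside ∷ T) S∌T = disjoint⁺ S T λ e∈S e∈T → S∌T (there e∈S) (there e∈T)
disjoint⁺ (outside ∷ S) (y       ∷ T) S∌T = disjoint⁺ S T λ e∈S e∈T → S∌T (there e∈S) (there e∈T)

module Exploration where

  open Star using (ε)
  open import Data.Nat.Base using (_+_; _≤_; z≤n)
  open ≡ using (refl; sym; trans; cong; subst)

  private
    variable
      n : ℕ

  subsetOf : {P : Pred (Fin n) 0ℓ} → Decidable P → Subset n
  subsetOf P? = Vec.tabulate (does ∘ P?)

  ∈-subsetOf⁺ : {P : Pred (Fin n) 0ℓ} (P? : Decidable P) → ∀ {x} → P x → x ∈ subsetOf P?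
  ∈-subsetOf⁺ P? {x} px = lookup⇒[]= x _ (trans (lookup∘tabulate (does ∘ P?) x) (dec-true (P? x) px))

  ∈-subsetOf⁻ : {P : Pred (Fin n) 0ℓ} (P? : Decidable P) → ∀ {x} → x ∈ subsetOf P? → P x
  ∈-subsetOf⁻ P? {x} x∈ with P? x | trans (sym (lookup∘tabulate (does ∘ P?) x)) ([]=⇒lookup x∈)
  ... | yes px | _ = px

  ∣p∪q∣≤∣p∣+∣q∣ : (p q : Subset n) → ∣ p ∪ q ∣ ≤ ∣ p ∣ + ∣ q ∣
  ∣p∪q∣≤∣p∣+∣q∣ []            []            = z≤n
  ∣p∪q∣≤∣p∣+∣q∣ (inside  ∷ p) (inside  ∷ q) =
    ℕ.s≤s (ℕ.≤-trans (∣p∪q∣≤∣p∣+∣q∣ p q) (ℕ.+-monoʳ-≤ ∣ p ∣ (ℕ.n≤1+n _)))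
  ∣p∪q∣≤∣p∣+∣q∣ (inside  ∷ p) (outside ∷ q) = ℕ.s≤s (∣p∪q∣≤∣p∣+∣q∣ p q)
  ∣p∪q∣≤∣p∣+∣q∣ (outside ∷ p) (inside  ∷ q) =
    ℕ.≤-trans (ℕ.s≤s (∣p∪q∣≤∣p∣+∣q∣ p q)) (ℕ.≤-reflexive (sym (ℕ.+-suc ∣ p ∣ ∣ q ∣)))
  ∣p∪q∣≤∣p∣+∣q∣ (outside ∷ p) (outside ∷ q) = ∣p∪q∣≤∣p∣+∣q∣ p q

  disjoint⇒∣p∪q∣ : (p q : Subset n) → disjoint p q ≡ true → ∣ p ∪ q ∣ ≡ ∣ p ∣ + ∣ q ∣
  disjoint⇒∣p∪q∣ []            []            _  = refl
  disjoint⇒∣p∪q∣ (inside  ∷ p) (inside  ∷ q) ()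
  disjoint⇒∣p∪q∣ (inside  ∷ p) (outside ∷ q) d  = cong suc (disjoint⇒∣p∪q∣ p q d)
  disjoint⇒∣p∪q∣ (outside ∷ p) (inside  ∷ q) d  =
    trans (cong suc (disjoint⇒∣p∪q∣ p q d)) (sym (ℕ.+-suc ∣ p ∣ ∣ q ∣))
  disjoint⇒∣p∪q∣ (outside ∷ p) (outside ∷ q) d  = disjoint⇒∣p∪q∣ p q d

  true-iff : ∀ {c d} → (c ≡ true → d ≡ true) → (d ≡ true → c ≡ true) → c ≡ d
  true-iff {true}  {true}  _  _ = refl
  true-iff {true}  {false} to _ = sym (to refl)
  true-iff {false} {true}  _ from = from refl
  true-iff {false} {false} _  _ = refl

  ∈-component⁺ : (G : Graph n) → ∀ {v x} → Connected G v x → x ∈ component G v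
  ∈-component⁺ G {v} = ∈-subsetOf⁺ (connected? G v)

  ∈-component⁻ : (G : Graph n) → ∀ {v x} → x ∈ component G v → Connected G v x
  ∈-component⁻ G {v} = ∈-subsetOf⁻ (connected? G v)

  ∣component∣≤L₁ : (G : Graph n) → ∀ v → ∣ component G v ∣ ≤ L₁ G
  ∣component∣≤L₁ G v = All.lookup (Extrema.xs≤max 0 _) (∈-map⁺ (λ v → ∣ component G v ∣) (∈-allFin v))

  largest : (G : Graph n) → L₁ G ≡ 0 ⊎ ∃[ v ] ∣ component G v ∣ ≡ L₁ G
  largest G with Extrema.argmax-sel (λ k → k) 0 (List.map (λ v → ∣ component G v ∣) (allFin _))
  ... | inj₁ L₁≡0 = inj₁ L₁≡0
  ... | inj₂ L₁∈ with ∈-map⁻ (λ v → ∣ component G v ∣) L₁∈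
  ... | v , _ , L₁≡ = inj₂ (v , sym L₁≡)

  -- The stopping rule consults only the size of the set reached so far, so explorations of two
  -- graphs that find the same components stop at the same seed. Early stopping serves the lower
  -- bound; the rule `λ _ → false` serves the upper bound.
  explore : (ℕ → Bool) → Graph n → List (Fin n) → Subset n → Subset n
  explore stop G []       D = D
  explore stop G (w ∷ ws) D = if stop ∣ D ∣ then D else explore stop G ws (D ∪ component G w)

  module _ (stop : ℕ → Bool) (G : Graph n) where

    explore-⊇ : ∀ ws D → D ⊆ explore stop G ws D
    explore-⊇ []       D = ⊆-refl
    explore-⊇ (w ∷ ws) D with stop ∣ D ∣
    ... | true  = ⊆-refl
    ... | false = ⊆-trans (p⊆p∪q (component G w)) (explore-⊇ ws (D ∪ component G w))

    explore-closed : ∀ ws D → (∀ {x y} → x ∈ D → Adjacent G x y → y ∈ D) →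
                     ∀ {x y} → x ∈ explore stop G ws D → Adjacent G x y → y ∈ explore stop G ws D
    explore-closed []       D closed = closed
    explore-closed (w ∷ ws) D closed with stop ∣ D ∣
    ... | true  = closed
    ... | false = explore-closed ws (D ∪ component G w) closed′
      where
      closed′ : ∀ {x y} → x ∈ D ∪ component G w → Adjacent G x y → y ∈ D ∪ component G w
      closed′ x∈ xy with x∈p∪q⁻ D (component G w) x∈
      ... | inj₁ x∈D = p⊆p∪q (component G w) (closed x∈D xy)
      ... | inj₂ x∈C = q⊆p∪q D _ (∈-component⁺ G (∈-component⁻ G x∈C ◅◅ (xy ◅ ε)))

    -- The list is exhausted only after every seed has contributed its component, and it is cut
    -- short only when the rule fires. The lower tail treats the two endings separately.
    explore-outcome : ∀ ws D → stop ∣ explore stop G ws D ∣ ≡ true ⊎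
                      (∀ {w} → w ∈ˡ ws → component G w ⊆ explore stop G ws D)
    explore-outcome []       D = inj₂ λ ()
    explore-outcome (w ∷ ws) D with stop ∣ D ∣ in eq
    ... | true  = inj₁ eq
    ... | false with explore-outcome ws (D ∪ component G w)
    ...   | inj₁ stopped = inj₁ stopped
    ...   | inj₂ covers  = inj₂ λ where
      (here refl) → ⊆-trans (q⊆p∪q D (component G w)) (explore-⊇ ws _)
      (there w∈)  → covers w∈

    -- k is the size just before the last component was added.
    explore-overshoot : ∀ ws D → (∃[ k ] stop k ≡ false × ∣ D ∣ ≤ k + L₁ G) →
                        ∃[ k ] stop k ≡ false × ∣ explore stop G ws D ∣ ≤ k + L₁ G
    explore-overshoot []       D before = before
    explore-overshoot (w ∷ ws) D before with stop ∣ D ∣ in eq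
    ... | true  = before
    ... | false = explore-overshoot ws (D ∪ component G w)
      (∣ D ∣ , eq , ℕ.≤-trans (∣p∪q∣≤∣p∣+∣q∣ D (component G w)) (ℕ.+-monoʳ-≤ ∣ D ∣ (∣component∣≤L₁ G w)))

  endpoint₁ endpoint₂ : Fin (List.length (potentialEdges n)) → Fin n
  endpoint₁ {n} e = proj₁ (List.lookup (potentialEdges n) e)
  endpoint₂ {n} e = proj₂ (List.lookup (potentialEdges n) e)

  touches? : (V : Subset n) → Decidable (λ e → endpoint₁ e ∈ V ⊎ endpoint₂ e ∈ V)
  touches? V e = (endpoint₁ e ∈? V) ⊎-dec (endpoint₂ e ∈? V)

  joins? : (V D : Subset n) →
           Decidable (λ e → endpoint₁ e ∈ V × endpoint₂ e ∈ D ⊎ endpoint₁ e ∈ D × endpoint₂ e ∈ V)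
  joins? V D e = ((endpoint₁ e ∈? V) ×-dec (endpoint₂ e ∈? D)) ⊎-dec ((endpoint₁ e ∈? D) ×-dec (endpoint₂ e ∈? V))

  touching : Subset n → Subset (List.length (potentialEdges n))
  touching V = subsetOf (touches? V)

  between : (V D : Subset n) → Subset (List.length (potentialEdges n))
  between V D = subsetOf (joins? V D)

  between⊆touching : (V D : Subset n) → between V D ⊆ touching V
  between⊆touching V D e∈ with ∈-subsetOf⁻ (joins? V D) e∈
  ... | inj₁ (i∈V , _) = ∈-subsetOf⁺ (touches? V) (inj₁ i∈V)
  ... | inj₂ (_ , j∈V) = ∈-subsetOf⁺ (touches? V) (inj₂ j∈V)

  -- Stands for `G - V` on an unchanged vertex type, so that explorations of both graphs are
  -- directly comparable. Its edge set is a function of the potential edges that do not touch `V`,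
  -- hence independent of those that do.
  isolate : Subset n → Graph n → Graph n
  isolate V G = graph (edgeSet G ─ touching V)

  x∈p─q⇒x∉q : (p q : Subset n) → ∀ {x} → x ∈ p ─ q → x ∉ q
  x∈p─q⇒x∉q (_ ∷ p) (inside  ∷ q) (Vec.there x∈) (Vec.there x∈q) = x∈p─q⇒x∉q p q x∈ x∈q
  x∈p─q⇒x∉q (_ ∷ p) (outside ∷ q) (Vec.there x∈) (Vec.there x∈q) = x∈p─q⇒x∉q p q x∈ x∈q

  module _ (V : Subset n) (G : Graph n) where

    private
      G⁻ : Graph n
      G⁻ = isolate V G

    isolate-adjacent⁺ : ∀ {x y} → x ∉ V → y ∉ V → Adjacent G x y → Adjacent G⁻ x y
    isolate-adjacent⁺ {x} {y} x∉V y∉V (e , e∈G , ends) = e , x∈p∧x∉q⇒x∈p─q e∈G (e∉ ends) , ends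
      where
      e∉ : List.lookup (potentialEdges n) e ≡ (x , y) ⊎ List.lookup (potentialEdges n) e ≡ (y , x) → e ∉ touching V
      e∉ ends e∈ with ∈-subsetOf⁻ (touches? V) e∈ | ends
      ... | inj₁ i∈V | inj₁ eq = x∉V (subst (_∈ V) (cong proj₁ eq) i∈V)
      ... | inj₁ i∈V | inj₂ eq = y∉V (subst (_∈ V) (cong proj₁ eq) i∈V)
      ... | inj₂ j∈V | inj₁ eq = y∉V (subst (_∈ V) (cong proj₂ eq) j∈V)
      ... | inj₂ j∈V | inj₂ eq = x∉V (subst (_∈ V) (cong proj₂ eq) j∈V)

    isolate-adjacent⁻ : ∀ {x y} → Adjacent G⁻ x y → Adjacent G x y
    isolate-adjacent⁻ (e , e∈ , ends) = e , p─q⊆p (edgeSet G) (touching V) e∈ , ends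

    isolate-adjacent-∉ : ∀ {x y} → Adjacent G⁻ x y → y ∉ V
    isolate-adjacent-∉ (e , e∈ , ends) y∈V =
      x∈p─q⇒x∉q (edgeSet G) (touching V) e∈ (∈-subsetOf⁺ (touches? V) (touch ends))
      where
      touch : _ → endpoint₁ e ∈ V ⊎ endpoint₂ e ∈ V
      touch (inj₁ eq) = inj₂ (subst (_∈ V) (sym (cong proj₂ eq)) y∈V)
      touch (inj₂ eq) = inj₁ (subst (_∈ V) (sym (cong proj₁ eq)) y∈V)

    isolate-connected⁻ : ∀ {x y} → Connected G⁻ x y → Connected G x y
    isolate-connected⁻ ε           = ε
    isolate-connected⁻ (xy ◅ path) = isolate-adjacent⁻ xy ◅ isolate-connected⁻ path

    isolate-connected-∉ : ∀ {x y} → x ∉ V → Connected G⁻ x y → y ∉ V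
    isolate-connected-∉ x∉V ε           = x∉V
    isolate-connected-∉ x∉V (xy ◅ path) = isolate-connected-∉ (isolate-adjacent-∉ xy) path

    -- A walk in `G` from `w` stays inside the component, which misses `V`, so none of its edges was
    -- deleted.
    isolate-component-avoiding : ∀ w → (∀ {x} → x ∈ component G w → x ∉ V) → component G w ≡ component G⁻ w
    isolate-component-avoiding w avoids = ⊆-antisym
      (λ x∈ → ∈-component⁺ G⁻ (lift ε (∈-component⁻ G x∈)))
      (λ x∈ → ∈-component⁺ G (isolate-connected⁻ (∈-component⁻ G⁻ x∈)))
      where
      lift : ∀ {a x} → Connected G w a → Connected G a x → Connected G⁻ a x
      lift wa ε = ε
      lift wa (ab ◅ path) =
        isolate-adjacent⁺ (avoids (∈-component⁺ G wa)) (avoids (∈-component⁺ G wb)) ab ◅ lift wb path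
        where wb = wa ◅◅ (ab ◅ ε)

    -- The induction carries a walk in the isolated graph, because `unjoined` speaks only about
    -- vertices reached there: a step in `G` from such a vertex cannot enter `V`, so its edge
    -- survives.
    isolate-component-unjoined : ∀ w → w ∉ V → (∀ {x y} → x ∈ component G⁻ w → Adjacent G x y → y ∉ V) →
                                 component G w ≡ component G⁻ w
    isolate-component-unjoined w w∉V unjoined = ⊆-antisym
      (λ x∈ → ∈-component⁺ G⁻ (lift ε (∈-component⁻ G x∈)))
      (λ x∈ → ∈-component⁺ G (isolate-connected⁻ (∈-component⁻ G⁻ x∈)))
      where
      lift : ∀ {a x} → Connected G⁻ w a → Connected G a x → Connected G⁻ w x
      lift wa ε = wa
      lift wa (ab ◅ path) = lift (wa ◅◅ (isolate-adjacent⁺ (isolate-connected-∉ w∉V wa)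
        (unjoined (∈-component⁺ G⁻ wa) ab) ab ◅ ε)) path

    module _ (stop : ℕ → Bool) where

      explore-isolate-avoiding : ∀ ws D → (∀ {x} → x ∈ explore stop G ws D → x ∉ V) →
                                 explore stop G ws D ≡ explore stop G⁻ ws D
      explore-isolate-avoiding []       D avoids = refl
      explore-isolate-avoiding (w ∷ ws) D avoids with stop ∣ D ∣
      ... | true  = refl
      ... | false = trans (explore-isolate-avoiding ws (D ∪ component G w) avoids)
        (cong (λ C → explore stop G⁻ ws (D ∪ C)) (isolate-component-avoiding w
          λ x∈ → avoids (explore-⊇ stop G ws _ (q⊆p∪q D _ x∈))))

      explore-isolate-unjoined : ∀ ws D → (∀ {w} → w ∈ˡ ws → w ∉ V) →
                                 (∀ {x y} → x ∈ explore stop G⁻ ws D → Adjacent G x y → y ∉ V) →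
                                 explore stop G ws D ≡ explore stop G⁻ ws D
      explore-isolate-unjoined []       D ws∉V unjoined = refl
      explore-isolate-unjoined (w ∷ ws) D ws∉V unjoined with stop ∣ D ∣
      ... | true  = refl
      ... | false = trans
        (cong (λ C → explore stop G ws (D ∪ C)) (isolate-component-unjoined w (ws∉V (here refl))
          λ x∈ → unjoined (explore-⊇ stop G⁻ ws _ (q⊆p∪q D _ x∈))))
        (explore-isolate-unjoined ws (D ∪ component G⁻ w) (ws∉V ∘ there) unjoined)

      explore-isolate-∉ : ∀ ws D → (∀ {w} → w ∈ˡ ws → w ∉ V) → (∀ {x} → x ∈ D → x ∉ V) →
                          ∀ {x} → x ∈ explore stop G⁻ ws D → x ∉ V
      explore-isolate-∉ []       D ws∉V D∉V = D∉V
      explore-isolate-∉ (w ∷ ws) D ws∉V D∉V with stop ∣ D ∣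
      ... | true  = D∉V
      ... | false = explore-isolate-∉ ws (D ∪ component G⁻ w) (ws∉V ∘ there) D∪C∉V
        where
        D∪C∉V : ∀ {x} → x ∈ D ∪ component G⁻ w → x ∉ V
        D∪C∉V x∈ with x∈p∪q⁻ D (component G⁻ w) x∈
        ... | inj₁ x∈D = D∉V x∈D
        ... | inj₂ x∈C = isolate-connected-∉ (ws∉V (here refl)) (∈-component⁻ G⁻ x∈C)

      module _ (ws : List (Fin n)) (ws∉V : ∀ {w} → w ∈ˡ ws → w ∉ V) where

        private
          D D⁻ : Subset n
          D  = explore stop G  ws ⊥
          D⁻ = explore stop G⁻ ws ⊥

          unjoined⁻ : disjoint (edgeSet G) (between V D⁻) ≡ true → ∀ {x y} → x ∈ D⁻ → Adjacent G x y → y ∉ V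
          unjoined⁻ d {x} {y} x∈ (e , e∈G , ends) y∈V =
            disjoint⁻ (edgeSet G) (between V D⁻) d e∈G (∈-subsetOf⁺ (joins? V D⁻) (join ends))
            where
            join : _ → endpoint₁ e ∈ V × endpoint₂ e ∈ D⁻ ⊎ endpoint₁ e ∈ D⁻ × endpoint₂ e ∈ V
            join (inj₁ eq) = inj₂ (subst (_∈ D⁻) (sym (cong proj₁ eq)) x∈ , subst (_∈ V) (sym (cong proj₂ eq)) y∈V)
            join (inj₂ eq) = inj₁ (subst (_∈ V) (sym (cong proj₁ eq)) y∈V , subst (_∈ D⁻) (sym (cong proj₂ eq)) x∈)

        explored≡isolated : disjoint V D ≡ true → D ≡ D⁻
        explored≡isolated d = explore-isolate-avoiding ws ⊥ λ x∈D x∈V → disjoint⁻ V D d x∈V x∈D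

        isolated-disjoint : disjoint V D⁻ ≡ true
        isolated-disjoint = disjoint⁺ V D⁻ λ x∈V x∈D⁻ → explore-isolate-∉ ws ⊥ ws∉V (λ x∈⊥ → contradiction x∈⊥ ∉⊥) x∈D⁻ x∈V

        -- The left side depends on all edges at once; on the right, `D⁻` is determined by the edges
        -- away from `V`, and only edges at `V` are then tested. Forwards, `D` equals `D⁻` and is
        -- closed under adjacency, so an edge from `V` to it would pull a vertex of `V` into `D`.
        -- Backwards, without such an edge the exploration of `G` copies that of the isolated graph
        -- and never enters `V`.
        disjoint-explored : disjoint V D ≡ disjoint (edgeSet G) (between V D⁻)
        disjoint-explored = true-iff to from
          where
          to : disjoint V D ≡ true → disjoint (edgeSet G) (between V D⁻) ≡ true
          to d = disjoint⁺ _ _ λ {e} e∈G e∈ → absurd e∈G (∈-subsetOf⁻ (joins? V D⁻) e∈)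
            where
            D∌ : ∀ {x y} → x ∈ D⁻ → y ∈ V → ¬ Adjacent G x y
            D∌ x∈ y∈V xy = disjoint⁻ V D d y∈V
              (explore-closed stop G ws ⊥ (λ x∈⊥ _ → contradiction x∈⊥ ∉⊥) (subst (_ ∈_) (sym (explored≡isolated d)) x∈) xy)
            absurd : ∀ {e} → e ∈ edgeSet G → ¬ (endpoint₁ e ∈ V × endpoint₂ e ∈ D⁻ ⊎ endpoint₁ e ∈ D⁻ × endpoint₂ e ∈ V)
            absurd {e} e∈G (inj₁ (i∈V , j∈D⁻)) = D∌ j∈D⁻ i∈V (e , e∈G , inj₂ refl)
            absurd {e} e∈G (inj₂ (i∈D⁻ , j∈V)) = D∌ i∈D⁻ j∈V (e , e∈G , inj₁ refl)

          from : disjoint (edgeSet G) (between V D⁻) ≡ true → disjoint V D ≡ true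
          from d = subst (λ D → disjoint V D ≡ true)
            (sym (explore-isolate-unjoined ws ⊥ ws∉V (unjoined⁻ d))) isolated-disjoint

open Exploration

-- The number of potential edges between two disjoint vertex sets

module EdgeCount where

  open import Data.Nat.Base using (_+_; _*_)
  open ≡ using (refl; sym; trans; cong; cong₂; module ≡-Reasoning)

  private
    variable
      n : ℕ

    open SemiringSum ℕ.+-*-semiring
      using (sum; sum-cong-≗; ∑-distrib-+; ∑-comm; *-distribˡ-sum; *-distribʳ-sum)
    open ≡-Reasoning

    ⟦_⟧ : Bool → ℕ
    ⟦ c ⟧ = if c then 1 else 0

    ∣tabulate∣ : (f : Fin n → Bool) → ∣ Vec.tabulate f ∣ ≡ sum (⟦_⟧ ∘ f)
    ∣tabulate∣ {zero}  f = refl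
    ∣tabulate∣ {suc n} f with f zero
    ... | true  = cong suc (∣tabulate∣ (f ∘ suc))
    ... | false = ∣tabulate∣ (f ∘ suc)

    ∣S∣≡sum : (S : Subset n) → ∣ S ∣ ≡ sum (λ i → ⟦ does (i ∈? S) ⟧)
    ∣S∣≡sum []            = refl
    ∣S∣≡sum (inside  ∷ S) = cong suc (∣S∣≡sum S)
    ∣S∣≡sum (outside ∷ S) = ∣S∣≡sum S

    sum-lookup : {A : Set} (h : A → ℕ) (xs : List A) → sum (h ∘ List.lookup xs) ≡ sumˡ (List.map h xs)
    sum-lookup h []       = refl
    sum-lookup h (x ∷ xs) = cong (λ s → h x + s) (sum-lookup h xs)

    sumˡ-filter : {A : Set} {P : Pred A 0ℓ} (P? : Decidable P) (h : A → ℕ) (xs : List A) →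
                  sumˡ (List.map h (filter P? xs)) ≡ sumˡ (List.map (λ x → ⟦ does (P? x) ⟧ * h x) xs)
    sumˡ-filter P? h []       = refl
    sumˡ-filter P? h (x ∷ xs) with P? x
    ... | yes _ = cong₂ _+_ (sym (ℕ.+-identityʳ (h x))) (sumˡ-filter P? h xs)
    ... | no  _ = sumˡ-filter P? h xs

    sumˡ-cartesianProduct : {A B : Set} (h : A × B → ℕ) (xs : List A) (ys : List B) →
      sumˡ (List.map h (cartesianProduct xs ys)) ≡ sumˡ (List.map (λ x → sumˡ (List.map (λ y → h (x , y)) ys)) xs)
    sumˡ-cartesianProduct h []       ys = refl
    sumˡ-cartesianProduct h (x ∷ xs) ys = begin
      sumˡ (List.map h (List.map (x ,_) ys ++ cartesianProduct xs ys))
        ≡⟨ cong sumˡ (map-++ h (List.map (x ,_) ys) _) ⟩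
      sumˡ (List.map h (List.map (x ,_) ys) ++ List.map h (cartesianProduct xs ys))
        ≡⟨ sum-++ (List.map h (List.map (x ,_) ys)) _ ⟩
      sumˡ (List.map h (List.map (x ,_) ys)) + sumˡ (List.map h (cartesianProduct xs ys))
        ≡⟨ cong₂ (λ l r → sumˡ l + r) (sym (map-∘ ys)) (sumˡ-cartesianProduct h xs ys) ⟩
      sumˡ (List.map (λ y → h (x , y)) ys) + sumˡ (List.map (λ x → sumˡ (List.map (λ y → h (x , y)) ys)) xs) ∎

    sumˡ-tabulate : {A : Set} (h : A → ℕ) (f : Fin n → A) → sumˡ (List.map h (List.tabulate f)) ≡ sum (h ∘ f)
    sumˡ-tabulate {zero}  h f = refl
    sumˡ-tabulate {suc n} h f = cong (λ s → h (f zero) + s) (sumˡ-tabulate h (f ∘ suc))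

    sum-potentialEdges : (h : Fin n × Fin n → ℕ) →
      sum (h ∘ List.lookup (potentialEdges n)) ≡ sum (λ i → sum (λ j → ⟦ does (i Fin.<? j) ⟧ * h (i , j)))
    sum-potentialEdges {n} h = begin
      sum (h ∘ List.lookup (potentialEdges n))
        ≡⟨ sum-lookup h (potentialEdges n) ⟩
      sumˡ (List.map h (potentialEdges n))
        ≡⟨ sumˡ-filter (λ (i , j) → i Fin.<? j) h (cartesianProduct (allFin n) (allFin n)) ⟩
      sumˡ (List.map g (cartesianProduct (allFin n) (allFin n)))
        ≡⟨ sumˡ-cartesianProduct g (allFin n) (allFin n) ⟩
      sumˡ (List.map (λ i → sumˡ (List.map (λ j → g (i , j)) (allFin n))) (allFin n))
        ≡⟨ sumˡ-tabulate (λ i → sumˡ (List.map (λ j → g (i , j)) (allFin n))) (λ i → i) ⟩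
      sum (λ i → sumˡ (List.map (λ j → g (i , j)) (allFin n)))
        ≡⟨ sum-cong-≗ (λ i → sumˡ-tabulate (λ j → g (i , j)) (λ j → j)) ⟩
      sum (λ i → sum (λ j → g (i , j))) ∎
      where
      g : Fin n × Fin n → ℕ
      g (i , j) = ⟦ does (i Fin.<? j) ⟧ * h (i , j)

    -- Exactly one of the two order indicators is 1, except on the diagonal, where disjointness
    -- makes the product vanish.
    ordered-once : (V D : Subset n) → disjoint V D ≡ true → ∀ i j → let v = ⟦ does (i ∈? V) ⟧ ; d = ⟦ does (j ∈? D) ⟧ in
      ⟦ does (i Fin.<? j) ⟧ * (v * d) + ⟦ does (j Fin.<? i) ⟧ * (v * d) ≡ v * d
    ordered-once V D V∩D i j with Fin.<-cmp i j
    ... | tri< i<j _ j≮i rewrite dec-true (i Fin.<? j) i<j | dec-false (j Fin.<? i) j≮i = simp _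
      where
      simp : ∀ x → 1 * x + 0 * x ≡ x
      simp = solve-∀
    ... | tri> i≮j _ j<i rewrite dec-false (i Fin.<? j) i≮j | dec-true (j Fin.<? i) j<i = simp _
      where
      simp : ∀ x → 0 * x + 1 * x ≡ x
      simp = solve-∀
    ... | tri≈ _ refl _ with i ∈? V | i ∈? D
    ...   | yes i∈V | yes i∈D = contradiction i∈D (disjoint⁻ V D V∩D i∈V)
    ...   | yes _   | no  _   = cong₂ _+_ (ℕ.*-zeroʳ ⟦ does (i Fin.<? i) ⟧) (ℕ.*-zeroʳ ⟦ does (i Fin.<? i) ⟧)
    ...   | no  _   | _       = cong₂ _+_ (ℕ.*-zeroʳ ⟦ does (i Fin.<? i) ⟧) (ℕ.*-zeroʳ ⟦ does (i Fin.<? i) ⟧)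

    joins-count : (V D : Subset n) → disjoint V D ≡ true → ∀ i j →
      ⟦ does (((i ∈? V) ×-dec (j ∈? D)) ⊎-dec ((i ∈? D) ×-dec (j ∈? V))) ⟧ ≡
      ⟦ does (i ∈? V) ⟧ * ⟦ does (j ∈? D) ⟧ + ⟦ does (j ∈? V) ⟧ * ⟦ does (i ∈? D) ⟧
    joins-count V D V∩D i j with i ∈? V | j ∈? D | i ∈? D | j ∈? V
    ... | yes i∈V | _       | yes i∈D | _       = contradiction i∈D (disjoint⁻ V D V∩D i∈V)
    ... | _       | yes j∈D | _       | yes j∈V = contradiction j∈D (disjoint⁻ V D V∩D j∈V)
    ... | yes _   | yes _   | no _    | no _    = refl
    ... | yes _   | no _    | no _    | yes _   = refl
    ... | yes _   | no _    | no _    | no _    = refl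
    ... | no _    | yes _   | yes _   | no _    = refl
    ... | no _    | yes _   | no _    | no _    = refl
    ... | no _    | no _    | yes _   | yes _   = refl
    ... | no _    | no _    | yes _   | no _    = refl
    ... | no _    | no _    | no _    | yes _   = refl
    ... | no _    | no _    | no _    | no _    = refl

  -- Each potential edge is listed once, with its smaller end first, so it can meet `V` at either
  -- end. Exchanging the summation indices in one of the two resulting sums merges them into a sum
  -- over all ordered pairs.
  ∣between∣ : (V D : Subset n) → disjoint V D ≡ true → ∣ between V D ∣ ≡ ∣ V ∣ * ∣ D ∣
  ∣between∣ {n} V D V∩D = begin
    ∣ between V D ∣
      ≡⟨ ∣tabulate∣ (does ∘ joins? V D) ⟩
    sum (λ e → ⟦ does (joins? V D e) ⟧)
      ≡⟨ sum-cong-≗ (λ e → joins-count V D V∩D (endpoint₁ e) (endpoint₂ e)) ⟩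
    sum (λ e → v (endpoint₁ e) * d (endpoint₂ e) + v (endpoint₂ e) * d (endpoint₁ e))
      ≡⟨ sum-potentialEdges (λ (i , j) → v i * d j + v j * d i) ⟩
    sum (λ i → sum (λ j → i <ᶠ j * (v i * d j + v j * d i)))
      ≡⟨ sum-cong-≗ (λ i → trans (sum-cong-≗ (λ j → ℕ.*-distribˡ-+ (i <ᶠ j) (v i * d j) _))
                                   (∑-distrib-+ (λ j → i <ᶠ j * (v i * d j)) _)) ⟩
    sum (λ i → sum (λ j → i <ᶠ j * (v i * d j)) + sum (λ j → i <ᶠ j * (v j * d i)))
      ≡⟨ ∑-distrib-+ (λ i → sum (λ j → i <ᶠ j * (v i * d j))) _ ⟩
    sum (λ i → sum (λ j → i <ᶠ j * (v i * d j))) + sum (λ i → sum (λ j → i <ᶠ j * (v j * d i)))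
      ≡⟨ cong (λ s → sum (λ i → sum (λ j → i <ᶠ j * (v i * d j))) + s) (∑-comm (λ i j → i <ᶠ j * (v j * d i))) ⟩
    sum (λ i → sum (λ j → i <ᶠ j * (v i * d j))) + sum (λ i → sum (λ j → j <ᶠ i * (v i * d j)))
      ≡⟨ ∑-distrib-+ (λ i → sum (λ j → i <ᶠ j * (v i * d j))) _ ⟨
    sum (λ i → sum (λ j → i <ᶠ j * (v i * d j)) + sum (λ j → j <ᶠ i * (v i * d j)))
      ≡⟨ sum-cong-≗ (λ i → trans (sym (∑-distrib-+ (λ j → i <ᶠ j * (v i * d j)) _))
                                   (sum-cong-≗ (ordered-once V D V∩D i))) ⟩
    sum (λ i → sum (λ j → v i * d j))
      ≡⟨ sum-cong-≗ (λ i → *-distribˡ-sum (v i) d) ⟨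
    sum (λ i → v i * sum d)
      ≡⟨ *-distribʳ-sum (sum d) v ⟨
    sum v * sum d
      ≡⟨ cong₂ _*_ (∣S∣≡sum V) (∣S∣≡sum D) ⟨
    ∣ V ∣ * ∣ D ∣ ∎
    where
    v d : Fin n → ℕ
    v i = ⟦ does (i ∈? V) ⟧
    d i = ⟦ does (i ∈? D) ⟧
    _<ᶠ_ : Fin n → Fin n → ℕ
    i <ᶠ j = ⟦ does (i Fin.<? j) ⟧
    infix 8 _<ᶠ_

open EdgeCount

-- Singletons, pairs, seed sets and seed lists

not-lookup⇒∉ : ∀ {n} (S : Subset n) v → Vec.lookup S v ≡ false → v ∉ S
not-lookup⇒∉ S v eq v∈S with () ← ≡.trans (≡.sym eq) ([]=⇒lookup v∈S)

∉⇒not-lookup : ∀ {n} (S : Subset n) v → v ∉ S → not (Vec.lookup S v) ≡ true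
∉⇒not-lookup S v v∉S with Vec.lookup S v in eq
... | true  = contradiction (lookup⇒[]= v S eq) v∉S
... | false = ≡.refl

not-true⇒false : ∀ {c} → not c ≡ true → c ≡ false
not-true⇒false {false} _ = ≡.refl

disjoint-singleton : ∀ {n} (v : Fin n) D → disjoint ⁅ v ⁆ D ≡ not (Vec.lookup D v)
disjoint-singleton v D = true-iff
  (λ d → ∉⇒not-lookup D v (disjoint⁻ ⁅ v ⁆ D d (x∈⁅x⁆ v)))
  (λ v∉ → disjoint⁺ ⁅ v ⁆ D λ x∈ x∈D → not-lookup⇒∉ D v (not-true⇒false v∉) (≡.subst (_∈ D) (x∈⁅y⁆⇒x≡y v x∈) x∈D))

disjoint-pair : ∀ {n} (u v : Fin n) D → disjoint (⁅ u ⁆ ∪ ⁅ v ⁆) D ≡ not (Vec.lookup D u) ∧ not (Vec.lookup D v)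
disjoint-pair u v D = ≡.trans (true-iff to from) (≡.cong₂ _∧_ (disjoint-singleton u D) (disjoint-singleton v D))
  where
  ∧-intro : ∀ {c d} → c ≡ true → d ≡ true → c ∧ d ≡ true
  ∧-intro ≡.refl ≡.refl = ≡.refl
  ∧-elimˡ : ∀ {c d} → c ∧ d ≡ true → c ≡ true
  ∧-elimˡ {true} _ = ≡.refl
  ∧-elimʳ : ∀ {c d} → c ∧ d ≡ true → d ≡ true
  ∧-elimʳ {true} d = d
  to : disjoint (⁅ u ⁆ ∪ ⁅ v ⁆) D ≡ true → disjoint ⁅ u ⁆ D ∧ disjoint ⁅ v ⁆ D ≡ true
  to d = ∧-intro (disjoint⁺ ⁅ u ⁆ D λ x∈ → disjoint⁻ (⁅ u ⁆ ∪ ⁅ v ⁆) D d (x∈p∪q⁺ (inj₁ x∈)))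
                 (disjoint⁺ ⁅ v ⁆ D λ x∈ → disjoint⁻ (⁅ u ⁆ ∪ ⁅ v ⁆) D d (x∈p∪q⁺ (inj₂ x∈)))
  from : disjoint ⁅ u ⁆ D ∧ disjoint ⁅ v ⁆ D ≡ true → disjoint (⁅ u ⁆ ∪ ⁅ v ⁆) D ≡ true
  from d = disjoint⁺ (⁅ u ⁆ ∪ ⁅ v ⁆) D λ x∈ → avoids (x∈p∪q⁻ ⁅ u ⁆ ⁅ v ⁆ x∈)
    where
    avoids : ∀ {x} → x ∈ ⁅ u ⁆ ⊎ x ∈ ⁅ v ⁆ → x ∉ D
    avoids (inj₁ x∈) = disjoint⁻ ⁅ u ⁆ D (∧-elimˡ d) x∈
    avoids (inj₂ x∈) = disjoint⁻ ⁅ v ⁆ D (∧-elimʳ {disjoint ⁅ u ⁆ D} d) x∈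

∣pair∣ : ∀ {n} {u v : Fin n} → u ≢ v → ∣ ⁅ u ⁆ ∪ ⁅ v ⁆ ∣ ≡ 2
∣pair∣ {u = u} {v} u≢v = ≡.trans
  (disjoint⇒∣p∪q∣ ⁅ u ⁆ ⁅ v ⁆ (disjoint⁺ ⁅ u ⁆ ⁅ v ⁆ λ x∈u x∈v → u≢v (≡.trans (≡.sym (x∈⁅y⁆⇒x≡y u x∈u)) (x∈⁅y⁆⇒x≡y v x∈v))))
  (≡.cong₂ ℕ._+_ (∣⁅x⁆∣≡1 u) (∣⁅x⁆∣≡1 v))

does-true⁻ : {A : Set} (a? : Dec A) → does a? ≡ true → A
does-true⁻ (yes a) _ = a

does-false⁻ : {A : Set} (a? : Dec A) → does a? ≡ false → ¬ A
does-false⁻ (no ¬a) _ = ¬a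

private
  variable
    n : ℕ

-- In the lower bound only the number of seeds matters, so the first `m` vertices serve.
initial : ∀ n → ℕ → Subset n
initial zero    m       = []
initial (suc n) zero    = outside ∷ initial n zero
initial (suc n) (suc m) = inside ∷ initial n m

∣initial∣ : ∀ n {m} → m ℕ.≤ n → ∣ initial n m ∣ ≡ m
∣initial∣ zero    ℕ.z≤n       = ≡.refl
∣initial∣ (suc n) ℕ.z≤n       = ∣initial∣ n ℕ.z≤n
∣initial∣ (suc n) (ℕ.s≤s m≤n) = ≡.cong suc (∣initial∣ n m≤n)

elements : Subset n → List (Fin n)
elements {n} S = filter (_∈? S) (allFin n)

-- A seed list may repeat vertices, so its set can be smaller than its length; the upper tail asks
-- only for an upper bound on the size.
seedSet : List (Fin n) → Subset n
seedSet []       = ⊥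
seedSet (w ∷ ws) = ⁅ w ⁆ ∪ seedSet ws

∈-seedSet : ∀ (ws : List (Fin n)) {w} → w ∈ˡ ws → w ∈ seedSet ws
∈-seedSet (w ∷ ws) (here ≡.refl) = p⊆p∪q (seedSet ws) (x∈⁅x⁆ w)
∈-seedSet (w ∷ ws) (there w∈)    = q⊆p∪q ⁅ w ⁆ (seedSet ws) (∈-seedSet ws w∈)

∣seedSet∣≤length : ∀ (ws : List (Fin n)) → ∣ seedSet ws ∣ ℕ.≤ List.length ws
∣seedSet∣≤length {n} [] = ℕ.≤-reflexive (∣⊥∣≡0 n)
∣seedSet∣≤length (w ∷ ws) = ℕ.≤-trans (∣p∪q∣≤∣p∣+∣q∣ ⁅ w ⁆ (seedSet ws))
  (ℕ.+-mono-≤ (ℕ.≤-reflexive (∣⁅x⁆∣≡1 w)) (∣seedSet∣≤length ws))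

misses : Subset n → List (Fin n) → Bool
misses A []       = true
misses A (w ∷ ws) = not (Vec.lookup A w) ∧ misses A ws

misses-false : ∀ (A : Subset n) ws → misses A ws ≡ false → ∃[ w ] w ∈ˡ ws × w ∈ A
misses-false A (w ∷ ws) eq with Vec.lookup A w in w∈A
... | true  = w , here ≡.refl , lookup⇒[]= w A w∈A
... | false = let v , v∈ws , v∈A = misses-false A ws eq in v , there v∈ws , v∈A

connected-sym : (G : Graph n) → ∀ {v w} → Connected G v w → Connected G w v
connected-sym G = Star.reverse λ (e , e∈G , ends) → e , e∈G , ⊎-swap ends

exhaustive-explore : (G : Graph n) (ws : List (Fin n)) → ∀ {v w} → w ∈ˡ ws → w ∈ component G v →
                     component G v ⊆ explore (λ _ → false) G ws ⊥
exhaustive-explore G ws {v} {w} w∈ws w∈C {x} x∈C with explore-outcome (λ _ → false) G ws ⊥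
... | inj₂ covers = covers w∈ws (∈-component⁺ G (connected-sym G (∈-component⁻ G w∈C) ◅◅ ∈-component⁻ G x∈C))

module RandomGraph (R : CompleteOrderedField) where

  open OrderedField R
  open SetoidReasoning setoid

  open SemiringSum semiring public
    using (sum; sum-cong-≋; ∑-distrib-+; ∑-comm; *-distribˡ-sum; *-distribʳ-sum; sum-replicate-zero)

  𝟙 : Bool → Carrier
  𝟙 c = if c then 1# else 0#

  𝟙-∧ : ∀ c d → 𝟙 (c ∧ d) ≈ 𝟙 c * 𝟙 d
  𝟙-∧ true  d = sym (*-identityˡ _)
  𝟙-∧ false d = sym (zeroˡ _)

  𝟙-nonneg : ∀ c → 0# ≤ 𝟙 c
  𝟙-nonneg true  = <⇒≤ 0<1
  𝟙-nonneg false = ≤-refl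

  sum-mono : ∀ {k} {f g : Fin k → Carrier} → (∀ i → f i ≤ g i) → sum f ≤ sum g
  sum-mono {zero}  f≤g = ≤-refl
  sum-mono {suc k} f≤g = +-mono-≤ (f≤g zero) (sum-mono (f≤g ∘ suc))

  sum-𝟙 : ∀ {k} (S : Subset k) → sum (λ i → 𝟙 (Vec.lookup S i)) ≈ fromℕ ∣ S ∣
  sum-𝟙 []            = refl
  sum-𝟙 (inside  ∷ S) = +-congˡ (sum-𝟙 S)
  sum-𝟙 (outside ∷ S) = trans (+-identityˡ _) (sum-𝟙 S)

  -- The profile `f(k) = (n - k) b^k`

  module Profile (n : ℕ)
    (ε p b : Carrier)
    (0<ε : 0# < ε) (100ε≤1 : fromℕ 100 * ε ≤ 1#)
    (0<p : 0# < p) (p≤ε² : p ≤ ε * ε) (np≈1+ε : fromℕ n * p ≈ 1# + ε)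
    (b[1-p]≈1 : b * (1# - p) ≈ 1#)
    where

    private
      ν : Carrier
      ν = fromℕ n
      0≤ε = <⇒≤ 0<ε
      0≤p = <⇒≤ 0<p
      0≤1 = <⇒≤ 0<1
      0≤1-100ε = x≤y⇒0≤y-x 100ε≤1
      0≤ε²-p = x≤y⇒0≤y-x p≤ε²

      0≤ν : 0# ≤ ν
      0≤ν = fromℕ-nonneg n

      -- Lets a known equation enter a certificate with a multiplier of either sign, the product
      -- being zero.
      ≈⇒0≤ : ∀ c {x y} → x ≈ y → 0# ≤ c * (x - y)
      ≈⇒0≤ c {x} {y} x≈y =
        ≤-reflexive (trans (sym (zeroʳ c)) (*-congˡ (trans (sym (-‿inverseʳ y)) (+-congʳ (sym x≈y)))))

      0≤1-ε : 0# ≤ 1# - ε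
      0≤1-ε = ≤-trans (0≤1-100ε ⊕ fromℕ-nonneg 99 ⊗ 0≤ε)
        (≤-reflexive
          (solve 1 (λ ε →
              con (+ 1) :- con (+ 100) :* ε :+ con (+ 99) :* ε :=
              con (+ 1) :- ε)
            refl ε))

      0≤1-8ε : 0# ≤ 1# - fromℕ 8 * ε
      0≤1-8ε = ≤-trans (0≤1-100ε ⊕ fromℕ-nonneg 92 ⊗ 0≤ε)
        (≤-reflexive
          (solve 1 (λ ε →
              con (+ 1) :- con (+ 100) :* ε :+ con (+ 92) :* ε :=
              con (+ 1) :- con (+ 8) :* ε)
            refl ε))

      0≤2-9ε : 0# ≤ fromℕ 2 - fromℕ 9 * ε
      0≤2-9ε = ≤-trans (0≤1-100ε ⊕ 0≤1 ⊕ fromℕ-nonneg 91 ⊗ 0≤ε)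
        (≤-reflexive
          (solve 1 (λ ε →
              con (+ 1) :- con (+ 100) :* ε :+ con (+ 1) :+ con (+ 91) :* ε :=
              con (+ 2) :- con (+ 9) :* ε)
            refl ε))

      p≤ε : p ≤ ε
      p≤ε = y-x≈c⇒x≤y (0≤ε²-p ⊕ 0≤ε ⊗ 0≤1-ε)
        (solve 2 (λ ε p → ε :- p := ε :* ε :- p :+ ε :* (con (+ 1) :- ε)) refl ε p)

      0<1-p : 0# < 1# - p
      0<1-p = x<y⇒0<y-x (y-x≈c⇒x<y {c = 1# - fromℕ 100 * ε + (ε - p) + fromℕ 98 * ε + ε}
        (<-≤-trans 0<ε (y-x≈c⇒x≤y (0≤1-100ε ⊕ x≤y⇒0≤y-x p≤ε ⊕ fromℕ-nonneg 98 ⊗ 0≤ε)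
          (solve 2 (λ ε p →
              con (+ 1) :- con (+ 100) :* ε :+ (ε :- p) :+ con (+ 98) :* ε :+ ε :- ε :=
              con (+ 1) :- con (+ 100) :* ε :+ (ε :- p) :+ con (+ 98) :* ε)
            refl ε p)))
        (solve 2 (λ p ε →
            con (+ 1) :- p :=
            con (+ 1) :- con (+ 100) :* ε :+ (ε :- p) :+ con (+ 98) :* ε :+ ε)
          refl p ε))

    p≤1 : p ≤ 1#
    p≤1 = y-x≈c⇒x≤y (<⇒≤ 0<1-p) refl

    0<b : 0# < b
    0<b = *-cancelˡ-pos (<⇒≤ 0<1-p)
      (<-≤-trans 0<1 (≤-reflexive (trans (sym b[1-p]≈1) (*-comm b (1# - p)))))

    1≤b : 1# ≤ b
    1≤b = y-x≈c⇒x≤y (≈⇒0≤ 1# b[1-p]≈1 ⊕ <⇒≤ 0<b ⊗ 0≤p)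
      (solve 2 (λ b p →
          b :- con (+ 1) :=
          con (+ 1) :* (b :* (con (+ 1) :- p) :- con (+ 1)) :+ b :* p)
        refl b p)

    1<n : 1 ℕ.< n
    1<n = fromℕ-cancel-< (≤-<-trans (≤-reflexive fromℕ-1) (y-x≈c⇒x<y
      (+-pos-nonneg 0<ε (≈⇒0≤ 1# np≈1+ε ⊕ 0≤ν ⊗ 0≤ε²-p ⊕ 0≤ν ⊗ (0≤1-ε ⊗ (0≤1 ⊕ 0≤ε))))
      (solve 3 (λ ν ε p →
          ν :- con (+ 1) :=
          ε :+ (con (+ 1) :* (ν :* p :- (con (+ 1) :+ ε)) :+ ν :* (ε :* ε :- p)
            :+ ν :* ((con (+ 1) :- ε) :* (con (+ 1) :+ ε))))
        refl ν ε p)))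

    -- Bernoulli's inequality for `(1 - p)^k`, multiplied through by `b ^ k` so that no power of
    -- `1 - p` appears.
    bernoulli : ∀ k → b ^ k * (1# - fromℕ k * p) ≤ 1#
    bernoulli zero    = ≤-reflexive
      (solve 1 (λ p → con (+ 1) :* (con (+ 1) :- con (+ 0) :* p) := con (+ 1)) refl p)
    bernoulli (suc k) = y-x≈c⇒x≤y
      (x≤y⇒0≤y-x (bernoulli k)
        ⊕ ^-nonneg k (<⇒≤ 0<b) ⊗ (fromℕ-nonneg k ⊗ 0≤p ⊗ x≤y⇒0≤y-x 1≤b)
        ⊕ ≈⇒0≤ (b ^ k) (sym b[1-p]≈1))
      (solve 4 (λ b B κ p →
          con (+ 1) :- b :* B :* (con (+ 1) :- (con (+ 1) :+ κ) :* p) :=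
          con (+ 1) :- B :* (con (+ 1) :- κ :* p) :+ B :* (κ :* p :* (b :- con (+ 1)))
            :+ B :* (con (+ 1) :- b :* (con (+ 1) :- p)))
        refl b (b ^ k) (fromℕ k) p)

    -- By `bernoulli`, `b ^ k` is at most `1 / (1 - x)`, and this is at most `1 + 2 x` as long as
    -- `x ≤ 1/2`.
    pow-upper : ∀ k {x} → 0# ≤ x → 0# ≤ 1# - fromℕ 2 * x → fromℕ k * p ≤ x → b ^ k ≤ 1# + fromℕ 2 * x
    pow-upper k {x} 0≤x 0≤1-2x kp≤x = *-cancelˡ-≤ 0<1-x (y-x≈c⇒x≤y
      (x≤y⇒0≤y-x (bernoulli k) ⊕ ^-nonneg k (<⇒≤ 0<b) ⊗ x≤y⇒0≤y-x kp≤x ⊕ 0≤x ⊗ 0≤1-2x)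
      (solve 4 (λ x B κ p →
          (con (+ 1) :- x) :* (con (+ 1) :+ con (+ 2) :* x) :- (con (+ 1) :- x) :* B :=
          con (+ 1) :- B :* (con (+ 1) :- κ :* p) :+ B :* (x :- κ :* p)
            :+ x :* (con (+ 1) :- con (+ 2) :* x))
        refl x (b ^ k) (fromℕ k) p))
      where
      0<1-x : 0# < 1# - x
      0<1-x = *-cancelˡ-pos (fromℕ-nonneg 2) (<-≤-trans (+-pos-nonneg 0<1 0≤1-2x)
        (≤-reflexive
          (solve 1 (λ x →
              con (+ 1) :+ (con (+ 1) :- con (+ 2) :* x) :=
              con (+ 2) :* (con (+ 1) :- x))
            refl x)))

    profile : ℕ → Carrier
    profile k = (ν - fromℕ k) * b ^ k

    -- The increment changes sign at `k p = ε`, that is near `k = ε n`. The profile rises up to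
    -- there and, the increment being nearly linear, is back at `n` near `2 ε n`: this is the origin
    -- of the constant 2 in the theorem.
    profile-step : ∀ k → profile (suc k) ≈ profile k + b ^ suc k * (ε - fromℕ k * p)
    profile-step k = begin
      (ν - (1# + fromℕ k)) * (b * b ^ k)
        ≈⟨
          (solve 5 (λ ν κ b B p →
              (ν :- (con (+ 1) :+ κ)) :* (b :* B) :=
              (ν :- κ) :* B :* (b :* (con (+ 1) :- p)) :+ b :* B :* (ν :* p
                :- con (+ 1) :- κ :* p))
            refl ν (fromℕ k) b (b ^ k) p) ⟩
      (ν - fromℕ k) * b ^ k * (b * (1# - p)) + b * b ^ k * (ν * p - 1# - fromℕ k * p)
        ≈⟨ +-cong (*-congˡ b[1-p]≈1) (*-congˡ (+-congʳ (+-congʳ np≈1+ε))) ⟩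
      (ν - fromℕ k) * b ^ k * 1# + b * b ^ k * (1# + ε - 1# - fromℕ k * p)
        ≈⟨
          (solve 6 (λ ν κ B b ε p →
              (ν :- κ) :* B :* con (+ 1) :+ b :* B :* (con (+ 1) :+ ε :- con (+ 1) :- κ :* p) :=
              (ν :- κ) :* B :+ b :* B :* (ε :- κ :* p))
            refl ν (fromℕ k) (b ^ k) b ε p) ⟩
      profile k + b ^ suc k * (ε - fromℕ k * p) ∎

    -- The factor b ^ suc k is at least 1 throughout and is 1 + O(ε) as long as
    -- k p = O(ε); past k p = ε the increment is negative, so no upper bound on the
    -- factor is needed for increment-≤.
    private
      increment-≤ : ∀ k → b ^ suc k * (ε - fromℕ k * p) ≤ ε + fromℕ 4 * (ε * ε) - fromℕ k * p
      increment-≤ k with ≤-total (fromℕ k * p) ε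
      ... | inj₁ kp≤ε = y-x≈c⇒x≤y
        (x≤y⇒0≤y-x b^≤ ⊗ x≤y⇒0≤y-x kp≤ε ⊕ fromℕ-nonneg 4 ⊗ 0≤ε ⊗ (fromℕ-nonneg k ⊗ 0≤p))
        (solve 4 (λ ε κ p D →
            ε :+ con (+ 4) :* (ε :* ε) :- κ :* p :- D :* (ε :- κ :* p) :=
            (con (+ 1) :+ con (+ 2) :* (con (+ 2) :* ε) :- D) :* (ε
              :- κ :* p) :+ con (+ 4) :* ε :* (κ :* p))
          refl ε (fromℕ k) p (b ^ suc k))
        where
        b^≤ : b ^ suc k ≤ 1# + fromℕ 2 * (fromℕ 2 * ε)
        b^≤ = pow-upper (suc k) (fromℕ-nonneg 2 ⊗ 0≤ε)
          (≤-trans (0≤1-8ε ⊕ fromℕ-nonneg 4 ⊗ 0≤ε) (≤-reflexive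
            (solve 1 (λ ε →
                con (+ 1) :- con (+ 8) :* ε :+ con (+ 4) :* ε :=
                con (+ 1) :- con (+ 2) :* (con (+ 2) :* ε))
              refl ε)))
          (y-x≈c⇒x≤y (x≤y⇒0≤y-x kp≤ε ⊕ x≤y⇒0≤y-x p≤ε)
            (solve 3 (λ ε κ p →
                con (+ 2) :* ε :- (con (+ 1) :+ κ) :* p :=
                ε :- κ :* p :+ (ε :- p))
              refl ε (fromℕ k) p))
      ... | inj₂ ε≤kp = y-x≈c⇒x≤y
        (x≤y⇒0≤y-x (1≤^ (suc k) 1≤b) ⊗ x≤y⇒0≤y-x ε≤kp ⊕ fromℕ-nonneg 4 ⊗ (0≤ε ⊗ 0≤ε))
        (solve 4 (λ ε κ p D →
            ε :+ con (+ 4) :* (ε :* ε) :- κ :* p :- D :* (ε :- κ :* p) :=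
            (D :- con (+ 1)) :* (κ :* p :- ε) :+ con (+ 4) :* (ε :* ε))
          refl ε (fromℕ k) p (b ^ suc k))

      increment-≥ : ∀ k → fromℕ (suc k) * p ≤ fromℕ 4 * ε →
                    ε - fromℕ 24 * (ε * ε) - fromℕ k * p ≤ b ^ suc k * (ε - fromℕ k * p)
      increment-≥ k 1+kp≤4ε with ≤-total (fromℕ k * p) ε
      ... | inj₁ kp≤ε = y-x≈c⇒x≤y
        (x≤y⇒0≤y-x (1≤^ (suc k) 1≤b) ⊗ x≤y⇒0≤y-x kp≤ε ⊕ fromℕ-nonneg 24 ⊗ (0≤ε ⊗ 0≤ε))
        (solve 4 (λ D ε κ p →
            D :* (ε :- κ :* p) :- (ε :- con (+ 24) :* (ε :* ε) :- κ :* p) :=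
            (D :- con (+ 1)) :* (ε :- κ :* p) :+ con (+ 24) :* (ε :* ε))
          refl (b ^ suc k) ε (fromℕ k) p)
      -- Here the increment is not positive, so an upper bound on the factor is wanted. The factor
      -- is at most `1 + 8 ε` and `k p - ε` at most `3 ε`, whence the 24.
      ... | inj₂ ε≤kp = y-x≈c⇒x≤y
        (x≤y⇒0≤y-x b^≤ ⊗ x≤y⇒0≤y-x ε≤kp ⊕ fromℕ-nonneg 8 ⊗ 0≤ε ⊗ (x≤y⇒0≤y-x 1+kp≤4ε ⊕ 0≤p))
        (solve 4 (λ D ε κ p →
            D :* (ε :- κ :* p) :- (ε :- con (+ 24) :* (ε :* ε) :- κ :* p) :=
            (con (+ 1) :+ con (+ 2) :* (con (+ 4) :* ε) :- D) :* (κ :* p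
              :- ε) :+ con (+ 8) :* ε :* (con (+ 4) :* ε :- (con (+ 1) :+ κ) :* p
              :+ p))
          refl (b ^ suc k) ε (fromℕ k) p)
        where
        b^≤ : b ^ suc k ≤ 1# + fromℕ 2 * (fromℕ 4 * ε)
        b^≤ = pow-upper (suc k) (fromℕ-nonneg 4 ⊗ 0≤ε)
          (≤-trans 0≤1-8ε (≤-reflexive
            (solve 1 (λ ε →
                con (+ 1) :- con (+ 8) :* ε :=
                con (+ 1) :- con (+ 2) :* (con (+ 4) :* ε))
              refl ε))) 1+kp≤4ε

      -- The sum of `increment-≤` over all smaller indices, doubled so that the triangular number
      -- appears as `k (k - 1)` without division.
      sharp-≤ : ∀ k → fromℕ 2 * profile k ≤
                fromℕ 2 * ν + fromℕ 2 * (ε + fromℕ 4 * (ε * ε)) * fromℕ k - p * (fromℕ k * (fromℕ k - 1#))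
      sharp-≤ zero = ≤-reflexive
        (solve 3 (λ ν ε p →
            con (+ 2) :* ((ν :- con (+ 0)) :* con (+ 1)) :=
            con (+ 2) :* ν :+ con (+ 2) :* (ε :+ con (+ 4) :* (ε :* ε)) :* con (+ 0)
              :- p :* (con (+ 0) :* (con (+ 0) :- con (+ 1))))
          refl ν ε p)
      sharp-≤ (suc k) = ≤-trans (≤-reflexive (*-congˡ (profile-step k))) (y-x≈c⇒x≤y
        (x≤y⇒0≤y-x (sharp-≤ k) ⊕ fromℕ-nonneg 2 ⊗ x≤y⇒0≤y-x (increment-≤ k))
        (solve 6 (λ ν ε κ p f D →
            con (+ 2) :* ν :+ con (+ 2) :* (ε :+ con (+ 4) :* (ε :* ε)) :* (con (+ 1)
              :+ κ) :- p :* ((con (+ 1) :+ κ) :* (con (+ 1) :+ κ :- con (+ 1)))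
              :- con (+ 2) :* (f :+ D :* (ε :- κ :* p)) :=
            con (+ 2) :* ν :+ con (+ 2) :* (ε :+ con (+ 4) :* (ε :* ε)) :* κ
              :- p :* (κ :* (κ :- con (+ 1))) :- con (+ 2) :* f
              :+ con (+ 2) :* (ε :+ con (+ 4) :* (ε :* ε) :- κ :* p
              :- D :* (ε :- κ :* p)))
          refl ν ε (fromℕ k) p (profile k) (b ^ suc k)))

      sharp-≥ : ∀ k → fromℕ k * p ≤ fromℕ 4 * ε →
                fromℕ 2 * ν + fromℕ 2 * (ε - fromℕ 24 * (ε * ε)) * fromℕ k - p * (fromℕ k * (fromℕ k - 1#))
                  ≤ fromℕ 2 * profile k
      sharp-≥ zero _ = ≤-reflexive
        (solve 3 (λ ν ε p →
            con (+ 2) :* ν :+ con (+ 2) :* (ε :- con (+ 24) :* (ε :* ε)) :* con (+ 0)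
              :- p :* (con (+ 0) :* (con (+ 0) :- con (+ 1))) :=
            con (+ 2) :* ((ν :- con (+ 0)) :* con (+ 1)))
          refl ν ε p)
      sharp-≥ (suc k) 1+kp≤4ε = ≤-trans (y-x≈c⇒x≤y
        (x≤y⇒0≤y-x (sharp-≥ k kp≤4ε) ⊕ fromℕ-nonneg 2 ⊗ x≤y⇒0≤y-x (increment-≥ k 1+kp≤4ε))
        (solve 6 (λ f D ε κ p ν →
            con (+ 2) :* (f :+ D :* (ε :- κ :* p)) :- (con (+ 2) :* ν
              :+ con (+ 2) :* (ε :- con (+ 24) :* (ε :* ε)) :* (con (+ 1) :+ κ)
              :- p :* ((con (+ 1) :+ κ) :* (con (+ 1) :+ κ :- con (+ 1)))) :=
            con (+ 2) :* f :- (con (+ 2) :* ν :+ con (+ 2) :* (ε :- con (+ 24) :* (ε :* ε)) :* κ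
              :- p :* (κ :* (κ :- con (+ 1)))) :+ con (+ 2) :* (D :* (ε :- κ :* p)
              :- (ε :- con (+ 24) :* (ε :* ε) :- κ :* p)))
          refl (profile k) (b ^ suc k) ε (fromℕ k) p ν))
        (≤-reflexive (*-congˡ (sym (profile-step k))))
        where
        kp≤4ε : fromℕ k * p ≤ fromℕ 4 * ε
        kp≤4ε = ≤-trans (y-x≈c⇒x≤y 0≤p
          (solve 2 (λ κ p → (con (+ 1) :+ κ) :* p :- κ :* p := p) refl (fromℕ k) p)) 1+kp≤4ε

    -- Replacing `k (k - 1)` by `k²` costs `p k ≤ ε² k`, which turns 8 into 9.
    profile-≤ : ∀ k → fromℕ 2 * profile k ≤
                fromℕ 2 * ν + (fromℕ 2 * ε + fromℕ 9 * (ε * ε)) * fromℕ k - p * (fromℕ k * fromℕ k)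
    profile-≤ k = ≤-trans (sharp-≤ k) (y-x≈c⇒x≤y (0≤ε²-p ⊗ fromℕ-nonneg k)
      (solve 4 (λ ν ε κ p →
          con (+ 2) :* ν :+ (con (+ 2) :* ε :+ con (+ 9) :* (ε :* ε)) :* κ
            :- p :* (κ :* κ) :- (con (+ 2) :* ν :+ con (+ 2) :* (ε :+ con (+ 4) :* (ε :* ε)) :* κ
            :- p :* (κ :* (κ :- con (+ 1)))) :=
          (ε :* ε :- p) :* κ)
        refl ν ε (fromℕ k) p))

    profile-≥ : ∀ k → fromℕ k * p ≤ fromℕ 4 * ε →
                fromℕ 2 * ν + (fromℕ 2 * ε - fromℕ 48 * (ε * ε)) * fromℕ k - p * (fromℕ k * fromℕ k)
                  ≤ fromℕ 2 * profile k
    profile-≥ k kp≤4ε = ≤-trans (y-x≈c⇒x≤y (0≤p ⊗ fromℕ-nonneg k)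
      (solve 4 (λ ν ε κ p →
          con (+ 2) :* ν :+ con (+ 2) :* (ε :- con (+ 24) :* (ε :* ε)) :* κ
            :- p :* (κ :* (κ :- con (+ 1))) :- (con (+ 2) :* ν :+ (con (+ 2) :* ε :- con (+ 48) :* (ε :* ε)) :* κ
            :- p :* (κ :* κ)) :=
          p :* κ)
        refl ν ε (fromℕ k) p)) (sharp-≥ k kp≤4ε)

    -- After multiplication by `p`, the bound of `profile-≤` is a quadratic in `p k`, because
    -- `n p = 1 + ε`; completing the square bounds it for all `k` at once.
    profile≤2n : ∀ k → profile k ≤ fromℕ 2 * ν
    profile≤2n k = *-cancelˡ-≤ (fromℕ-pos 1) (≤-trans (profile-≤ k) (*-cancelˡ-≤ 0<p (y-x≈c⇒x≤y
      (square-nonneg (p * fromℕ k - fromℕ 2 * ε) ⊕ p≥0 ⊕ fromℕ-nonneg 2 ⊗ (0≤1-ε ⊕ fromℕ-nonneg 2 ⊗ 0≤ε ⊗ 0≤1-ε)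
       ⊕ fromℕ-nonneg 2 ⊗ (≈⇒0≤ 1# np≈1+ε))
      (solve 4 (λ p ν ε κ →
          p :* (con (+ 2) :* (con (+ 2) :* ν)) :- p :* (con (+ 2) :* ν
            :+ (con (+ 2) :* ε :+ con (+ 9) :* (ε :* ε)) :* κ :- p :* (κ :* κ)) :=
          (p :* κ :- con (+ 2) :* ε) :* (p :* κ :- con (+ 2) :* ε)
            :+ ε :* (con (+ 2) :- con (+ 9) :* ε) :* (κ :* p) :+ con (+ 2) :* (con (+ 1)
            :- ε :+ con (+ 2) :* ε :* (con (+ 1) :- ε)) :+ con (+ 2) :* (con (+ 1) :* (ν :* p :- (con (+ 1) :+ ε))))
        refl p ν ε (fromℕ k)))))
      where p≥0 = 0≤ε ⊗ 0≤2-9ε ⊗ (fromℕ-nonneg k ⊗ 0≤p)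

    private
      -- The witness is `m / 2` rounded up. The second bound keeps `m - h` at least `m / 4`, which
      -- no witness achieves at `m = 1`.
      half : ∀ m → 1 ℕ.< m → ∃[ h ] m ℕ.≤ h ℕ.+ h × 4 ℕ.* h ℕ.≤ 3 ℕ.* m
      half 0 ()
      half 1 (ℕ.s≤s ())
      half 2 _ = 1 , ℕ.≤-refl , ℕ.m≤m+n 4 2
      half 3 _ = 2 , ℕ.m≤m+n 3 1 , ℕ.m≤m+n 8 1
      half (suc (suc m@(suc (suc _)))) _ with half m (ℕ.s≤s (ℕ.s≤s ℕ.z≤n))
      ... | h , m≤2h , 4h≤3m = suc h
        , ℕ.≤-trans (ℕ.s≤s (ℕ.s≤s m≤2h)) (ℕ.≤-reflexive (≡.cong suc (≡.sym (ℕ.+-suc h h))))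
        , ℕ.≤-trans (ℕ.≤-reflexive (ℕ.*-suc 4 h))
            (ℕ.≤-trans (ℕ.+-mono-≤ (ℕ.m≤m+n 4 2) 4h≤3m)
              (ℕ.≤-reflexive (≡.sym (≡.trans (ℕ.*-distribˡ-+ 3 2 m) ≡.refl))))

    b^-mono : ∀ {j k} → j ℕ.≤ k → b ^ j ≤ b ^ k
    b^-mono {j} {k} j≤k = ≤-trans
      (≤-trans (≤-reflexive (sym (*-identityʳ (b ^ j))))
               (*-monoˡ-≤ (^-nonneg j (<⇒≤ 0<b)) (1≤^ (k ℕ.∸ j) 1≤b)))
      (≤-reflexive (trans (sym (^-homo-* b j (k ℕ.∸ j))) (reflexive (≡.cong (b ^_) (ℕ.m+[n∸m]≡n j≤k)))))

    -- Read off from profile≤2n at h ≈ n / 2.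
    b^-bounded : ∀ {k} → k ℕ.≤ n → b ^ k ≤ fromℕ 64
    b^-bounded {k} k≤n = bound (half n 1<n)
      where
      0<ν : 0# < ν
      0<ν = <-≤-trans (fromℕ-pos 1) (fromℕ-mono-≤ 1<n)
      bound : ∃[ h ] n ℕ.≤ h ℕ.+ h × 4 ℕ.* h ℕ.≤ 3 ℕ.* n → b ^ k ≤ fromℕ 64
      bound (h , n≤2h , 4h≤3n) = ≤-trans (b^-mono (ℕ.≤-trans k≤n n≤2h))
        (≤-trans (≤-reflexive (^-homo-* b h h))
          (≤-trans (*-mono-≤ (fromℕ-nonneg 8) (^-nonneg h (<⇒≤ 0<b)) b^h≤8 b^h≤8)
                   (≤-reflexive (sym (fromℕ-homo-* 8 8)))))
        where
        4h≤3n′ : fromℕ 4 * fromℕ h ≤ fromℕ 3 * ν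
        4h≤3n′ = ≤-trans (≤-reflexive (sym (fromℕ-homo-* 4 h)))
          (≤-trans (fromℕ-mono-≤ 4h≤3n) (≤-reflexive (fromℕ-homo-* 3 n)))
        -- As `n - h ≥ n / 4`, the bound `(n - h) b^h ≤ 2 n` leaves `b^h ≤ 8`; squaring gives 64 at
        -- the exponent `2 h ≥ n`.
        b^h≤8 : b ^ h ≤ fromℕ 8
        b^h≤8 = *-cancelˡ-≤ 0<ν (y-x≈c⇒x≤y
          (fromℕ-nonneg 4 ⊗ x≤y⇒0≤y-x (profile≤2n h) ⊕ x≤y⇒0≤y-x 4h≤3n′ ⊗ ^-nonneg h (<⇒≤ 0<b))
          (solve 3 (λ ν B κ →
              ν :* con (+ 8) :- ν :* B :=
              con (+ 4) :* (con (+ 2) :* ν :- (ν :- κ) :* B) :+ (con (+ 3) :* ν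
                :- con (+ 4) :* κ) :* B)
            refl ν (b ^ h) (fromℕ h)))

    -- The profile is at most `2 n`, and `bernoulli` gives `b^k - 1 ≤ b^k k p ≤ 64 k p`. With
    -- `n p ≤ 2` the constant is `2 · 64 · 2`.
    profile-variance : ∀ {k} → k ℕ.≤ n → profile k * (b ^ k - 1#) ≤ fromℕ 256 * fromℕ k
    profile-variance {k} k≤n = y-x≈c⇒x≤y
      (0≤b^-1 ⊗ x≤y⇒0≤y-x (profile≤2n k) ⊕ fromℕ-nonneg 2 ⊗ 0≤ν ⊗ x≤y⇒0≤y-x (bernoulli k)
        ⊕ fromℕ-nonneg 2 ⊗ 0≤ν ⊗ (fromℕ-nonneg k ⊗ 0≤p) ⊗ x≤y⇒0≤y-x (b^-bounded k≤n)
        ⊕ fromℕ-nonneg 128 ⊗ fromℕ-nonneg k ⊗ (≈⇒0≤ 1# (sym np≈1+ε))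
        ⊕ fromℕ-nonneg 128 ⊗ fromℕ-nonneg k ⊗ 0≤1-ε)
      (solve 6 (λ κ f B ν p ε →
          con (+ 256) :* κ :- f :* (B :- con (+ 1)) :=
          (B :- con (+ 1)) :* (con (+ 2) :* ν :- f) :+ con (+ 2) :* ν :* (con (+ 1)
            :- B :* (con (+ 1) :- κ :* p)) :+ con (+ 2) :* ν :* (κ :* p) :* (con (+ 64)
            :- B) :+ con (+ 128) :* κ :* (con (+ 1) :* (con (+ 1) :+ ε :- ν :* p))
            :+ con (+ 128) :* κ :* (con (+ 1) :- ε))
        refl (fromℕ k) (profile k) (b ^ k) ν p ε)
      where
      0≤b^-1 : 0# ≤ b ^ k - 1#
      0≤b^-1 = x≤y⇒0≤y-x (1≤^ k 1≤b)

    -- The upper bound for the profile is a concave quadratic, so a linear term of order `ε k` still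
    -- leaves it within `O(ε² n)` of `n`. Its expectation will convert the known mean of `Y` into a
    -- bound on the mean size of the explored set.
    profile-drift : ∀ k → fromℕ 2 * ε * fromℕ k + profile k ≤ ν + fromℕ 16 * (ε * ε) * ν
    profile-drift k = *-cancelˡ-≤ (fromℕ-pos 1) (*-cancelˡ-≤ 0<p (y-x≈c⇒x≤y
      (0≤p ⊗ x≤y⇒0≤y-x (profile-≤ k) ⊕ square-nonneg (p * fromℕ k - fromℕ 4 * ε)
        ⊕ 0≤p ⊗ (fromℕ-nonneg k ⊗ 0≤ε ⊗ 0≤2-9ε)
        ⊕ fromℕ-nonneg 16 ⊗ (0≤ε ⊗ 0≤ε) ⊕ fromℕ-nonneg 32 ⊗ 0≤ε ⊗ (0≤ε ⊗ 0≤ε)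
        ⊕ ≈⇒0≤ (fromℕ 32 * (ε * ε)) np≈1+ε)
      (solve 5 (λ p ν ε κ f →
          p :* (con (+ 2) :* (ν :+ con (+ 16) :* (ε :* ε) :* ν))
            :- p :* (con (+ 2) :* (con (+ 2) :* ε :* κ :+ f)) :=
          p :* (con (+ 2) :* ν :+ (con (+ 2) :* ε :+ con (+ 9) :* (ε :* ε)) :* κ
            :- p :* (κ :* κ) :- con (+ 2) :* f) :+ (p :* κ :- con (+ 4) :* ε) :* (p :* κ
            :- con (+ 4) :* ε) :+ p :* (κ :* ε :* (con (+ 2) :- con (+ 9) :* ε))
            :+ con (+ 16) :* (ε :* ε) :+ con (+ 32) :* ε :* (ε :* ε)
            :+ con (+ 32) :* (ε :* ε) :* (ν :* p :- (con (+ 1) :+ ε)))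
        refl p ν ε (fromℕ k) (profile k))))

    module _ {δ : Carrier} (100ε≤δ : fromℕ 100 * ε ≤ δ) (δ≤1 : δ ≤ 1#) where

      private
        0≤δ : 0# ≤ δ
        0≤δ = ≤-trans (fromℕ-nonneg 100 ⊗ 0≤ε) 100ε≤δ

      -- Here `p k ≥ (2 + δ) ε`, so `2 ε k - p k²` is at most `- δ ε k`; since `100 ε ≤ δ`, the
      -- error `9 ε² k` uses up less than half of this, and `k ≥ 2 ε n` turns the rest into order
      -- `ε² n`.
      profile-beyond : ∀ k → (fromℕ 2 + δ) * ε * ν ≤ fromℕ k →
                       fromℕ 2 * profile k ≤ fromℕ 2 * ν - δ * (ε * ε) * ν
      profile-beyond k k≥ = *-cancelˡ-≤ (fromℕ-pos 1) (y-x≈c⇒x≤y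
        (fromℕ-nonneg 2 ⊗ x≤y⇒0≤y-x (profile-≤ k)
          ⊕ fromℕ-nonneg 2 ⊗ fromℕ-nonneg k ⊗ 0≤p ⊗ x≤y⇒0≤y-x k≥
          ⊕ ≈⇒0≤ (fromℕ 2 * fromℕ k * ε * (fromℕ 2 + δ)) np≈1+ε
          ⊕ fromℕ-nonneg k ⊗ 0≤ε ⊗ (x≤y⇒0≤y-x 100ε≤δ ⊕ fromℕ-nonneg 86 ⊗ 0≤ε ⊕ fromℕ-nonneg 2 ⊗ 0≤δ ⊗ 0≤ε)
          ⊕ δε ⊗ x≤y⇒0≤y-x k≥ ⊕ δε ⊗ (0≤δ ⊗ 0≤ε ⊗ 0≤ν))
        (solve 6 (λ ν δ ε f κ p →
            con (+ 2) :* (con (+ 2) :* ν :- δ :* (ε :* ε) :* ν) :- con (+ 2) :* (con (+ 2) :* f) :=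
            con (+ 2) :* (con (+ 2) :* ν :+ (con (+ 2) :* ε :+ con (+ 9) :* (ε :* ε)) :* κ
              :- p :* (κ :* κ) :- con (+ 2) :* f) :+ con (+ 2) :* κ :* p :* (κ
              :- (con (+ 2) :+ δ) :* ε :* ν) :+ con (+ 2) :* κ :* ε :* (con (+ 2)
              :+ δ) :* (ν :* p :- (con (+ 1) :+ ε)) :+ κ :* ε :* (δ
              :- con (+ 100) :* ε :+ con (+ 86) :* ε :+ con (+ 2) :* δ :* ε)
              :+ δ :* ε :* (κ :- (con (+ 2) :+ δ) :* ε :* ν) :+ δ :* ε :* (δ :* ε :* ν))
          refl ν δ ε (profile k) (fromℕ k) p))
        where δε = 0≤δ ⊗ 0≤ε

      private
        kp≤4ε : ∀ k → fromℕ k ≤ (fromℕ 2 - δ) * ε * ν → fromℕ k * p ≤ fromℕ 4 * ε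
        kp≤4ε k k≤ = y-x≈c⇒x≤y
          (x≤y⇒0≤y-x k≤ ⊗ 0≤p ⊕ ≈⇒0≤ ((fromℕ 2 - δ) * ε) (sym np≈1+ε)
            ⊕ fromℕ-nonneg 2 ⊗ 0≤ε ⊗ 0≤1-ε ⊕ 0≤δ ⊗ 0≤ε ⊗ (0≤1 ⊕ 0≤ε))
          (solve 5 (λ ε κ p δ ν →
              con (+ 4) :* ε :- κ :* p :=
              ((con (+ 2) :- δ) :* ε :* ν :- κ) :* p :+ (con (+ 2)
                :- δ) :* ε :* (con (+ 1) :+ ε :- ν :* p) :+ con (+ 2) :* ε :* (con (+ 1)
                :- ε) :+ δ :* ε :* (con (+ 1) :+ ε))
            refl ε (fromℕ k) p δ ν)

      b^-before : ∀ k → fromℕ k ≤ (fromℕ 2 - δ) * ε * ν → b ^ k ≤ fromℕ 2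
      b^-before k k≤ = ≤-trans
        (pow-upper k (fromℕ-nonneg 4 ⊗ 0≤ε) (≤-trans 0≤1-8ε (≤-reflexive
          (solve 1 (λ ε →
              con (+ 1) :- con (+ 8) :* ε :=
              con (+ 1) :- con (+ 2) :* (con (+ 4) :* ε))
            refl ε))) (kp≤4ε k k≤))
        (y-x≈c⇒x≤y 0≤1-8ε
          (solve 1 (λ ε →
              con (+ 2) :- (con (+ 1) :+ con (+ 2) :* (con (+ 4) :* ε)) :=
              con (+ 1) :- con (+ 8) :* ε)
            refl ε))

      -- Here `p k ≤ (2 - δ) ε (1 + ε)`, which leaves a surplus `δ ε k` in the doubled profile,
      -- against errors of `48 ε² k` from `profile-≥` and `2 ε² k` from `n p = 1 + ε`. Half of the
      -- surplus absorbs these 50, which is where `100 ε ≤ δ` comes from.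
      profile-before : ∀ k → fromℕ k ≤ (fromℕ 2 - δ) * ε * ν →
                       fromℕ 4 * ν + δ * ε * fromℕ k ≤ fromℕ 4 * profile k
      profile-before k k≤ = y-x≈c⇒x≤y
        (fromℕ-nonneg 2 ⊗ x≤y⇒0≤y-x (profile-≥ k (kp≤4ε k k≤))
          ⊕ fromℕ-nonneg 2 ⊗ fromℕ-nonneg k ⊗ 0≤p ⊗ x≤y⇒0≤y-x k≤
          ⊕ ≈⇒0≤ (fromℕ 2 * fromℕ k * ε * (fromℕ 2 - δ)) (sym np≈1+ε)
          ⊕ fromℕ-nonneg k ⊗ 0≤ε ⊗ (x≤y⇒0≤y-x 100ε≤δ ⊕ fromℕ-nonneg 2 ⊗ 0≤δ ⊗ 0≤ε))
        (solve 6 (λ f ν δ ε κ p →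
            con (+ 4) :* f :- (con (+ 4) :* ν :+ δ :* ε :* κ) :=
            con (+ 2) :* (con (+ 2) :* f :- (con (+ 2) :* ν :+ (con (+ 2) :* ε :- con (+ 48) :* (ε :* ε)) :* κ :- p :* (κ :* κ)))
              :+ con (+ 2) :* κ :* p :* ((con (+ 2) :- δ) :* ε :* ν
              :- κ) :+ con (+ 2) :* κ :* ε :* (con (+ 2) :- δ) :* (con (+ 1)
              :+ ε :- ν :* p) :+ κ :* ε :* (δ :- con (+ 100) :* ε
              :+ con (+ 2) :* δ :* ε))
          refl (profile k) ν δ ε (fromℕ k) p)

  -- Expectation over a random edge set

  module Expectation (p : Carrier) where

    -- One coordinate is averaged at a time, which makes independence a matter of induction; `ℙ≈E`
    -- ties this to the weighted sum defining `ℙ`.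
    E : ∀ {m} → (Subset m → Carrier) → Carrier
    E {zero}  X = X []
    E {suc m} X = (1# - p) * E (λ S → X (outside ∷ S)) + p * E (λ S → X (inside ∷ S))

    E-cong : ∀ {m} {X Y : Subset m → Carrier} → (∀ S → X S ≈ Y S) → E X ≈ E Y
    E-cong {zero}  X≈Y = X≈Y []
    E-cong {suc m} X≈Y = +-cong (*-congˡ (E-cong λ S → X≈Y (outside ∷ S)))
                                (*-congˡ (E-cong λ S → X≈Y (inside ∷ S)))

    E-+ : ∀ {m} (X Y : Subset m → Carrier) → E (λ S → X S + Y S) ≈ E X + E Y
    E-+ {zero}  X Y = refl
    E-+ {suc m} X Y = begin
      (1# - p) * E (λ S → X (outside ∷ S) + Y (outside ∷ S)) + p * E (λ S → X (inside ∷ S) + Y (inside ∷ S))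
        ≈⟨ +-cong (*-congˡ (E-+ (X ∘ (outside ∷_)) _)) (*-congˡ (E-+ (X ∘ (inside ∷_)) _)) ⟩
      (1# - p) * (E (X ∘ (outside ∷_)) + E (Y ∘ (outside ∷_))) + p * (E (X ∘ (inside ∷_)) + E (Y ∘ (inside ∷_)))
        ≈⟨
          (solve 5 (λ p x y z w →
              (con (+ 1) :- p) :* (x :+ y) :+ p :* (z :+ w) :=
              (con (+ 1) :- p) :* x :+ p :* z :+ ((con (+ 1) :- p) :* y :+ p :* w))
            refl p (E (X ∘ (outside ∷_))) (E (Y ∘ (outside ∷_))) (E (X ∘ (inside ∷_))) (E (Y ∘ (inside ∷_)))) ⟩
      E X + E Y ∎

    E-*ˡ : ∀ {m} c (X : Subset m → Carrier) → E (λ S → c * X S) ≈ c * E X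
    E-*ˡ {zero}  c X = refl
    E-*ˡ {suc m} c X = begin
      (1# - p) * E (λ S → c * X (outside ∷ S)) + p * E (λ S → c * X (inside ∷ S))
        ≈⟨ +-cong (*-congˡ (E-*ˡ c (X ∘ (outside ∷_)))) (*-congˡ (E-*ˡ c (X ∘ (inside ∷_)))) ⟩
      (1# - p) * (c * E (X ∘ (outside ∷_))) + p * (c * E (X ∘ (inside ∷_)))
        ≈⟨
          (solve 4 (λ p c x z →
              (con (+ 1) :- p) :* (c :* x) :+ p :* (c :* z) :=
              c :* ((con (+ 1) :- p) :* x :+ p :* z))
            refl p c (E (X ∘ (outside ∷_))) (E (X ∘ (inside ∷_)))) ⟩
      c * E X ∎

    E-const : ∀ {m} c → E {m} (λ _ → c) ≈ c
    E-const {zero}  c = refl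
    E-const {suc m} c = begin
      (1# - p) * E {m} (λ _ → c) + p * E {m} (λ _ → c)  ≈⟨ +-cong (*-congˡ (E-const {m} c)) (*-congˡ (E-const {m} c)) ⟩
      (1# - p) * c + p * c                              ≈⟨
        (solve 2 (λ p c → (con (+ 1) :- p) :* c :+ p :* c := c) refl p c) ⟩
      c                                                 ∎

    E-sum : ∀ {m k} (X : Fin k → Subset m → Carrier) → E (λ S → sum (λ i → X i S)) ≈ sum (λ i → E (X i))
    E-sum {m} {zero}  X = E-const {m} 0#
    E-sum {m} {suc k} X = trans (E-+ (X zero) _) (+-congˡ (E-sum (X ∘ suc)))

    E-mono : 0# ≤ p → p ≤ 1# → ∀ {m} {X Y : Subset m → Carrier} → (∀ S → X S ≤ Y S) → E X ≤ E Y
    E-mono 0≤p p≤1 {zero}  X≤Y = X≤Y []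
    E-mono 0≤p p≤1 {suc m} X≤Y =
      +-mono-≤ (*-monoˡ-≤ (x≤y⇒0≤y-x p≤1) (E-mono 0≤p p≤1 λ S → X≤Y (outside ∷ S)))
               (*-monoˡ-≤ 0≤p (E-mono 0≤p p≤1 λ S → X≤Y (inside ∷ S)))

    -- Coordinates in I are independent of the rest, and J only looks at the rest.
    E-avoid : ∀ {m} (I : Subset m) (J : Subset m → Subset m) (X : Subset m → Carrier) →
              (∀ S → J S ⊆ I) →
              E (λ S → 𝟙 (disjoint S (J (S ─ I))) * X (S ─ I)) ≈
              E (λ S → (1# - p) ^ ∣ J (S ─ I) ∣ * X (S ─ I))
    E-avoid [] J X J⊆I with J []
    ... | [] = refl
    E-avoid (outside ∷ I) J X J⊆I = +-cong (*-congˡ (half outside)) (*-congˡ (half inside))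
      where
      half : ∀ x → E (λ S → 𝟙 (disjoint (x ∷ S) (J (x ∷ (S ─ I)))) * X (x ∷ (S ─ I))) ≈
                   E (λ S → (1# - p) ^ ∣ J (x ∷ (S ─ I)) ∣ * X (x ∷ (S ─ I)))
      half x = begin
        E (λ S → 𝟙 (disjoint (x ∷ S) (J (x ∷ (S ─ I)))) * X (x ∷ (S ─ I)))
          ≈⟨ E-cong (λ S → *-congʳ (reflexive (≡.cong 𝟙 (drop-head x S (J (x ∷ (S ─ I))) (J⊆I _))))) ⟩
        E (λ S → 𝟙 (disjoint S (Vec.tail (J (x ∷ (S ─ I))))) * X (x ∷ (S ─ I)))
          ≈⟨ E-avoid I (λ S → Vec.tail (J (x ∷ S))) (λ S → X (x ∷ S)) (λ S → tail-⊆ (J (x ∷ S)) (J⊆I _)) ⟩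
        E (λ S → (1# - p) ^ ∣ Vec.tail (J (x ∷ (S ─ I))) ∣ * X (x ∷ (S ─ I)))
          ≈⟨ E-cong (λ S → *-congʳ (reflexive (≡.cong ((1# - p) ^_) (size (J (x ∷ (S ─ I))) (J⊆I _))))) ⟩
        E (λ S → (1# - p) ^ ∣ J (x ∷ (S ─ I)) ∣ * X (x ∷ (S ─ I))) ∎
        where
        tail-⊆ : ∀ T → T ⊆ outside ∷ I → Vec.tail T ⊆ I
        tail-⊆ (y ∷ T) T⊆ = drop-∷-⊆ T⊆
        drop-head : ∀ y S T → T ⊆ outside ∷ I → disjoint (y ∷ S) T ≡ disjoint S (Vec.tail T)
        drop-head y       S (inside  ∷ T) T⊆ with () ← T⊆ here
        drop-head inside  S (outside ∷ T) T⊆ = ≡.refl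
        drop-head outside S (outside ∷ T) T⊆ = ≡.refl
        size : ∀ T → T ⊆ outside ∷ I → ∣ Vec.tail T ∣ ≡ ∣ T ∣
        size (inside  ∷ T) T⊆ with () ← T⊆ here
        size (outside ∷ T) T⊆ = ≡.refl
    -- This coordinate is invisible to `J` and `X`, so it can be averaged out: the factor is `1 - p`
    -- if `J` contains it and 1 otherwise. The factor depends on the remaining coordinates only
    -- through `S ─ I`, so it joins `X` for the induction.
    E-avoid (inside ∷ I) J X J⊆I = begin
      (1# - p) * E (λ S → 𝟙 (disjoint (outside ∷ S) (K S)) * Z S) + p * E (λ S → 𝟙 (disjoint (inside ∷ S) (K S)) * Z S)
        ≈⟨ combine (λ S → 𝟙 (disjoint (outside ∷ S) (K S)) * Z S) (λ S → 𝟙 (disjoint (inside ∷ S) (K S)) * Z S) ⟩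
      E (λ S → (1# - p) * (𝟙 (disjoint (outside ∷ S) (K S)) * Z S) + p * (𝟙 (disjoint (inside ∷ S) (K S)) * Z S))
        ≈⟨ E-cong (λ S → split S (K S) (Z S)) ⟩
      E (λ S → 𝟙 (disjoint S (Vec.tail (K S))) * (factor (K S) * Z S))
        ≈⟨ E-avoid I (λ S → Vec.tail (J (outside ∷ S))) (λ S → factor (J (outside ∷ S)) * X (outside ∷ S))
                   (λ S → tail-⊆ (J (outside ∷ S)) (J⊆I _)) ⟩
      E (λ S → (1# - p) ^ ∣ Vec.tail (K S) ∣ * (factor (K S) * Z S))
        ≈⟨ E-cong (λ S → merge (K S) (Z S)) ⟩
      E (λ S → (1# - p) * ((1# - p) ^ ∣ K S ∣ * Z S) + p * ((1# - p) ^ ∣ K S ∣ * Z S))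
        ≈⟨ combine (λ S → (1# - p) ^ ∣ K S ∣ * Z S) (λ S → (1# - p) ^ ∣ K S ∣ * Z S) ⟨
      (1# - p) * E (λ S → (1# - p) ^ ∣ K S ∣ * Z S) + p * E (λ S → (1# - p) ^ ∣ K S ∣ * Z S) ∎
      where
      K : Subset _ → Subset _
      K S = J (outside ∷ (S ─ I))
      Z : Subset _ → Carrier
      Z S = X (outside ∷ (S ─ I))
      factor : ∀ {k} → Subset (suc k) → Carrier
      factor (inside  ∷ T) = 1# - p
      factor (outside ∷ T) = 1#
      combine : ∀ {k} (X Y : Subset k → Carrier) → (1# - p) * E X + p * E Y ≈ E (λ S → (1# - p) * X S + p * Y S)
      combine X Y = sym (trans (E-+ (λ S → (1# - p) * X S) _) (+-cong (E-*ˡ _ X) (E-*ˡ _ Y)))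
      tail-⊆ : ∀ T → T ⊆ inside ∷ I → Vec.tail T ⊆ I
      tail-⊆ (y ∷ T) T⊆ = drop-∷-⊆ T⊆
      split : ∀ {k} (S : Subset k) T z →
              (1# - p) * (𝟙 (disjoint (outside ∷ S) T) * z) + p * (𝟙 (disjoint (inside ∷ S) T) * z) ≈
              𝟙 (disjoint S (Vec.tail T)) * (factor T * z)
      split S (inside  ∷ T) z =
        (solve 3 (λ p d z →
            (con (+ 1) :- p) :* (d :* z) :+ p :* (con (+ 0) :* z) :=
            d :* ((con (+ 1) :- p) :* z))
          refl p (𝟙 (disjoint S T)) z)
      split S (outside ∷ T) z =
        (solve 3 (λ p d z →
            (con (+ 1) :- p) :* (d :* z) :+ p :* (d :* z) :=
            d :* (con (+ 1) :* z))
          refl p (𝟙 (disjoint S T)) z)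
      merge : ∀ {k} (T : Subset (suc k)) z →
              (1# - p) ^ ∣ Vec.tail T ∣ * (factor T * z) ≈
              (1# - p) * ((1# - p) ^ ∣ T ∣ * z) + p * ((1# - p) ^ ∣ T ∣ * z)
      merge (inside  ∷ T) z =
        (solve 3 (λ r p z →
            r :* ((con (+ 1) :- p) :* z) :=
            (con (+ 1) :- p) :* ((con (+ 1) :- p) :* r :* z) :+ p :* ((con (+ 1) :- p) :* r :* z))
          refl ((1# - p) ^ ∣ T ∣) p z)
      merge (outside ∷ T) z =
        (solve 3 (λ r z p →
            r :* (con (+ 1) :* z) :=
            (con (+ 1) :- p) :* (r :* z) :+ p :* (r :* z))
          refl ((1# - p) ^ ∣ T ∣) z p)

    private
      sumOver : {A : Set} → (A → Carrier) → List A → Carrier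
      sumOver f xs = List.foldr _+_ 0# (List.map f xs)

      sumOver-++ : ∀ {A : Set} (f : A → Carrier) xs ys → sumOver f (xs ++ ys) ≈ sumOver f xs + sumOver f ys
      sumOver-++ f []       ys = sym (+-identityˡ _)
      sumOver-++ f (x ∷ xs) ys = trans (+-congˡ (sumOver-++ f xs ys)) (sym (+-assoc _ _ _))

      sumOver-map : ∀ {A B : Set} (f : B → Carrier) (g : A → B) xs → sumOver f (List.map g xs) ≈ sumOver (f ∘ g) xs
      sumOver-map f g []       = refl
      sumOver-map f g (x ∷ xs) = +-congˡ (sumOver-map f g xs)

      sumOver-cong : ∀ {A : Set} {f g : A → Carrier} → (∀ x → f x ≈ g x) → ∀ xs → sumOver f xs ≈ sumOver g xs
      sumOver-cong f≈g []       = refl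
      sumOver-cong f≈g (x ∷ xs) = +-cong (f≈g x) (sumOver-cong f≈g xs)

      sumOver-*ˡ : ∀ {A : Set} c (f : A → Carrier) xs → sumOver (λ x → c * f x) xs ≈ c * sumOver f xs
      sumOver-*ˡ c f []       = sym (zeroʳ c)
      sumOver-*ˡ c f (x ∷ xs) = trans (+-congˡ (sumOver-*ˡ c f xs)) (sym (distribˡ c _ _))

      sumOver-filter : ∀ {A : Set} {P : Pred A 0ℓ} (P? : Decidable P) (f : A → Carrier) xs →
                       sumOver f (filter P? xs) ≈ sumOver (λ x → f x * 𝟙 (does (P? x))) xs
      sumOver-filter P? f []       = refl
      sumOver-filter P? f (x ∷ xs) with P? x
      ... | yes _ = +-cong (sym (*-identityʳ _)) (sumOver-filter P? f xs)
      ... | no  _ = trans (sumOver-filter P? f xs) (trans (sym (+-identityˡ _)) (+-congʳ (sym (zeroʳ _))))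

    open Probability R

    private
      sumOver-allSubsets : ∀ m (X : Subset m → Carrier) →
                           sumOver (λ S → bernoulliWeight p S * X S) (allSubsets m) ≈ E X
      sumOver-allSubsets zero    X = trans (+-identityʳ _) (*-identityˡ _)
      sumOver-allSubsets (suc m) X = trans (sumOver-++ _ (List.map (outside ∷_) (allSubsets m)) _)
        (+-cong (half outside) (half inside))
        where
        half : ∀ x → sumOver (λ S → bernoulliWeight p S * X S) (List.map (x ∷_) (allSubsets m)) ≈
                     (if x then p else 1# - p) * E (λ S → X (x ∷ S))
        half x = begin
          sumOver (λ S → bernoulliWeight p S * X S) (List.map (x ∷_) (allSubsets m))
            ≈⟨ sumOver-map _ (x ∷_) (allSubsets m) ⟩
          sumOver (λ S → (if x then p else 1# - p) * bernoulliWeight p S * X (x ∷ S)) (allSubsets m)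
            ≈⟨ sumOver-cong (λ S → *-assoc _ _ _) (allSubsets m) ⟩
          sumOver (λ S → (if x then p else 1# - p) * (bernoulliWeight p S * X (x ∷ S))) (allSubsets m)
            ≈⟨ sumOver-*ˡ _ _ (allSubsets m) ⟩
          (if x then p else 1# - p) * sumOver (λ S → bernoulliWeight p S * X (x ∷ S)) (allSubsets m)
            ≈⟨ *-congˡ (sumOver-allSubsets m (λ S → X (x ∷ S))) ⟩
          (if x then p else 1# - p) * E (λ S → X (x ∷ S)) ∎

    ℙ≈E : ∀ n {A : Pred (Graph n) 0ℓ} (A? : Decidable A) → ℙ n p A? ≈ E (λ S → 𝟙 (does (A? (graph S))))
    ℙ≈E n A? = begin
      sumOver (bernoulliWeight p ∘ edgeSet) (filter A? (allGraphs n))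
        ≈⟨ sumOver-filter A? (bernoulliWeight p ∘ edgeSet) (allGraphs n) ⟩
      sumOver weighted (allGraphs n)
        ≈⟨ sumOver-map weighted (graph {n}) (allSubsets edges) ⟩
      sumOver (λ S → bernoulliWeight p S * 𝟙 (does (A? (graph S)))) (allSubsets edges)
        ≈⟨ sumOver-allSubsets edges (λ S → 𝟙 (does (A? (graph S)))) ⟩
      E (λ S → 𝟙 (does (A? (graph S)))) ∎
      where
      edges : ℕ
      edges = List.length (potentialEdges n)
      weighted : Graph n → Carrier
      weighted G = bernoulliWeight p (edgeSet G) * 𝟙 (does (A? G))

  -- First and second moments of `Y`

  module Moments
    (p b : Carrier) (b[1-p]≈1 : b * (1# - p) ≈ 1#)
    {n : ℕ} (halt : ℕ → Bool) (ws : List (Fin n)) (W : Subset n) (ws⊆W : ∀ {w} → w ∈ˡ ws → w ∈ W)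
    where

    open Expectation p

    private
      Edges : Set
      Edges = Subset (List.length (potentialEdges n))

    explored : Edges → Subset n
    explored S = explore halt (graph S) ws ⊥

    size : Edges → ℕ
    size S = ∣ explored S ∣

    private
      [1-p]^b^ : ∀ k → (1# - p) ^ k * b ^ k ≈ 1#
      [1-p]^b^ zero    = *-identityˡ 1#
      [1-p]^b^ (suc k) = begin
        (1# - p) * (1# - p) ^ k * (b * b ^ k)    ≈⟨
          (solve 4 (λ p r b s →
              (con (+ 1) :- p) :* r :* (b :* s) :=
              b :* (con (+ 1) :- p) :* (r :* s))
            refl p ((1# - p) ^ k) b (b ^ k)) ⟩
        b * (1# - p) * ((1# - p) ^ k * b ^ k)    ≈⟨ *-cong b[1-p]≈1 ([1-p]^b^ k) ⟩
        1# * 1#                                  ≈⟨ *-identityˡ 1# ⟩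
        1#                                       ∎

    -- Deleting the edges at V first, V is avoided exactly when no edge joins V
    -- to what is then explored, which costs a factor 1 - p per potential edge.
    avoid-moment : (V : Subset n) → (∀ {v} → v ∈ V → v ∉ W) →
                   E (λ S → 𝟙 (disjoint V (explored S)) * b ^ (∣ V ∣ ℕ.* size S)) ≈ 1#
    avoid-moment V V∩W = begin
      E (λ S → 𝟙 (disjoint V (explored S)) * X S)
        ≈⟨ E-cong reveal ⟩
      E (λ S → 𝟙 (disjoint S (J (S ─ touching V))) * X (S ─ touching V))
        ≈⟨ E-avoid (touching V) J X (λ S → between⊆touching V (explored S)) ⟩
      E (λ S → (1# - p) ^ ∣ J (S ─ touching V) ∣ * X (S ─ touching V))
        ≈⟨ E-cong cancel ⟩
      E {List.length (potentialEdges n)} (λ _ → 1#)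
        ≈⟨ E-const {List.length (potentialEdges n)} 1# ⟩
      1# ∎
      where
      J : Edges → Edges
      J S = between V (explored S)
      X : Edges → Carrier
      X S = b ^ (∣ V ∣ ℕ.* size S)
      ws∉V : ∀ {w} → w ∈ˡ ws → w ∉ V
      ws∉V w∈ws w∈V = V∩W w∈V (ws⊆W w∈ws)
      reveal : ∀ S → 𝟙 (disjoint V (explored S)) * X S ≈ 𝟙 (disjoint S (J (S ─ touching V))) * X (S ─ touching V)
      reveal S = trans (split (disjoint V (explored S)) ≡.refl)
        (*-congʳ (reflexive (≡.cong 𝟙 (disjoint-explored V (graph S) halt ws ws∉V))))
        where
        -- `X` may be evaluated on the isolated graph, because it counts only when `V` is avoided,
        -- and then both explorations agree.
        split : ∀ c → disjoint V (explored S) ≡ c → 𝟙 c * X S ≈ 𝟙 c * X (S ─ touching V)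
        split true  d = *-congˡ (reflexive (≡.cong (λ D → b ^ (∣ V ∣ ℕ.* ∣ D ∣)) (explored≡isolated V (graph S) halt ws ws∉V d)))
        split false _ = trans (zeroˡ _) (sym (zeroˡ _))
      cancel : ∀ S → (1# - p) ^ ∣ J (S ─ touching V) ∣ * X (S ─ touching V) ≈ 1#
      cancel S = trans (*-congʳ (reflexive (≡.cong ((1# - p) ^_)
        (∣between∣ V (explored (S ─ touching V)) (isolated-disjoint V (graph S) halt ws ws∉V)))))
        ([1-p]^b^ (∣ V ∣ ℕ.* size (S ─ touching V)))

    weight : Edges → Carrier
    weight S = b ^ size S

    -- Seeds are excluded explicitly: an early stop may leave some of them unexplored, and
    -- `avoid-moment` speaks only about sets disjoint from `W`.
    y : Fin n → Edges → Carrier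
    y v S = 𝟙 (not (Vec.lookup (W ∪ explored S) v)) * weight S

    unseeded : Fin n → Carrier
    unseeded v = 𝟙 (not (Vec.lookup W v))

    Y : Edges → Carrier
    Y S = sum (λ v → y v S)

    private
      lookup-∪ : ∀ v S → Vec.lookup (W ∪ explored S) v ≡ Vec.lookup W v ∨ Vec.lookup (explored S) v
      lookup-∪ v S = lookup-zipWith _∨_ v W (explored S)

      y-seed : ∀ v S → Vec.lookup W v ≡ true → y v S ≈ 0#
      y-seed v S v∈W rewrite lookup-∪ v S | v∈W = zeroˡ _

      y-unseeded : ∀ v S → Vec.lookup W v ≡ false → y v S ≈ 𝟙 (not (Vec.lookup (explored S) v)) * weight S
      y-unseeded v S v∉W rewrite lookup-∪ v S | v∉W = refl

      E-zero : {X : Edges → Carrier} → (∀ S → X S ≈ 0#) → E X ≈ 0#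
      E-zero X≈0 = trans (E-cong X≈0) (E-const {List.length (potentialEdges n)} 0#)

    E-y : ∀ v → E (y v) ≈ unseeded v
    E-y v = case (Vec.lookup W v) ≡.refl
      where
      case : ∀ c → Vec.lookup W v ≡ c → E (y v) ≈ 𝟙 (not c)
      case true  v∈W = E-zero (λ S → y-seed v S v∈W)
      case false v∉W = trans (E-cong λ S → trans (y-unseeded v S v∉W)
          (*-cong (reflexive (≡.cong 𝟙 (≡.sym (disjoint-singleton v (explored S)))))
                  (reflexive (≡.cong (b ^_) (≡.sym (≡.trans (≡.cong (ℕ._* size S) (∣⁅x⁆∣≡1 v)) (ℕ.*-identityˡ _)))))))
        (avoid-moment ⁅ v ⁆ λ x∈ x∈W → not-lookup⇒∉ W v v∉W (≡.subst (_∈ W) (x∈⁅y⁆⇒x≡y v x∈) x∈W))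

    -- The pair has `2 |D|` potential edges to the explored set, and the two weights multiply to the
    -- matching power of `b`. The potential edge between `u` and `v` touches the pair but leads to
    -- nothing explored, so distinct vertices are exactly uncorrelated.
    E-y-pair : ∀ {u v} → u ≢ v → E (λ S → y u S * y v S) ≈ unseeded u * unseeded v
    E-y-pair {u} {v} u≢v = case (Vec.lookup W u) (Vec.lookup W v) ≡.refl ≡.refl
      where
      case : ∀ c d → Vec.lookup W u ≡ c → Vec.lookup W v ≡ d → E (λ S → y u S * y v S) ≈ 𝟙 (not c) * 𝟙 (not d)
      case true  d     u∈W _   = trans (E-zero λ S → trans (*-congʳ (y-seed u S u∈W)) (zeroˡ _)) (sym (zeroˡ _))
      case false true  _   v∈W = trans (E-zero λ S → trans (*-congˡ (y-seed v S v∈W)) (zeroʳ _)) (sym (zeroʳ _))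
      case false false u∉W v∉W = trans (trans (E-cong rewritten) (avoid-moment (⁅ u ⁆ ∪ ⁅ v ⁆) outside-W)) (sym (*-identityˡ 1#))
        where
        outside-W : ∀ {x} → x ∈ ⁅ u ⁆ ∪ ⁅ v ⁆ → x ∉ W
        outside-W x∈ x∈W with x∈p∪q⁻ ⁅ u ⁆ ⁅ v ⁆ x∈
        ... | inj₁ x∈u = not-lookup⇒∉ W u u∉W (≡.subst (_∈ W) (x∈⁅y⁆⇒x≡y u x∈u) x∈W)
        ... | inj₂ x∈v = not-lookup⇒∉ W v v∉W (≡.subst (_∈ W) (x∈⁅y⁆⇒x≡y v x∈v) x∈W)
        rewritten : ∀ S → y u S * y v S ≈
                    𝟙 (disjoint (⁅ u ⁆ ∪ ⁅ v ⁆) (explored S)) * b ^ (∣ ⁅ u ⁆ ∪ ⁅ v ⁆ ∣ ℕ.* size S)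
        rewritten S = begin
          y u S * y v S
            ≈⟨ *-cong (y-unseeded u S u∉W) (y-unseeded v S v∉W) ⟩
          𝟙 (out u) * weight S * (𝟙 (out v) * weight S)
            ≈⟨
              (solve 3 (λ i B j →
                  i :* B :* (j :* B) :=
                  i :* j :* (B :* B))
                refl (𝟙 (out u)) (weight S) (𝟙 (out v))) ⟩
          𝟙 (out u) * 𝟙 (out v) * (weight S * weight S)
            ≈⟨ *-cong (sym (𝟙-∧ (out u) (out v))) (sym (^-homo-* b (size S) (size S))) ⟩
          𝟙 (out u ∧ out v) * b ^ (size S ℕ.+ size S)
            ≈⟨ *-cong (reflexive (≡.cong 𝟙 (≡.sym (disjoint-pair u v (explored S)))))
                      (reflexive (≡.cong (b ^_) (≡.trans (≡.cong (size S ℕ.+_) (≡.sym (ℕ.+-identityʳ _)))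
                                               (≡.cong (ℕ._* size S) (≡.sym (∣pair∣ u≢v)))))) ⟩
          𝟙 (disjoint (⁅ u ⁆ ∪ ⁅ v ⁆) (explored S)) * b ^ (∣ ⁅ u ⁆ ∪ ⁅ v ⁆ ∣ ℕ.* size S) ∎
          where
          out : Fin n → Bool
          out x = not (Vec.lookup (explored S) x)

    E-Y : E Y ≈ sum unseeded
    E-Y = trans (E-sum y) (sum-cong-≋ E-y)

    -- The variance contribution of one vertex: an indicator is idempotent, so the square of `y v`
    -- is `y v` times one more weight.
    excess : Fin n → Carrier
    excess v = E (λ S → y v S * (weight S - 1#))

    private
      𝟙-idem : ∀ c → 𝟙 c * 𝟙 c ≈ 𝟙 c
      𝟙-idem true  = *-identityˡ 1#
      𝟙-idem false = zeroˡ 0#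

      E-y-square : ∀ v → E (λ S → y v S * y v S) ≈ unseeded v * unseeded v + excess v
      E-y-square v = begin
        E (λ S → y v S * y v S)                               ≈⟨ E-cong (λ S → expand (not (Vec.lookup (W ∪ explored S) v)) (weight S)) ⟩
        E (λ S → y v S + y v S * (weight S - 1#))             ≈⟨ E-+ (y v) _ ⟩
        E (y v) + excess v                                    ≈⟨ +-congʳ (trans (E-y v) (sym (𝟙-idem (not (Vec.lookup W v))))) ⟩
        unseeded v * unseeded v + excess v                    ∎
        where
        expand : ∀ c B → 𝟙 c * B * (𝟙 c * B) ≈ 𝟙 c * B + 𝟙 c * B * (B - 1#)
        expand c B = begin
          𝟙 c * B * (𝟙 c * B)               ≈⟨
            (solve 2 (λ i B → i :* B :* (i :* B) := i :* i :* (B :* B)) refl (𝟙 c) B) ⟩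
          𝟙 c * 𝟙 c * (B * B)               ≈⟨ *-congʳ (𝟙-idem c) ⟩
          𝟙 c * (B * B)                     ≈⟨
            (solve 2 (λ i B → i :* (B :* B) := i :* B :+ i :* B :* (B :- con (+ 1))) refl (𝟙 c) B) ⟩
          𝟙 c * B + 𝟙 c * B * (B - 1#)      ∎

      sum-diagonal : ∀ {k} (u : Fin k) c → sum (λ v → 𝟙 (does (u Fin.≟ v)) * c) ≈ c
      sum-diagonal {suc k} zero c = begin
        1# * c + sum (λ (v : Fin k) → 0# * c)   ≈⟨ +-cong (*-identityˡ c) (trans (sum-cong-≋ {k} (λ v → zeroˡ c)) (sum-replicate-zero k)) ⟩
        c + 0#                                  ≈⟨ +-identityʳ c ⟩
        c                                       ∎
      sum-diagonal {suc k} (suc u) c = trans (+-cong (zeroˡ c) (sum-diagonal u c)) (+-identityˡ c)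

      E-y-product : ∀ u v → E (λ S → y u S * y v S) ≈ unseeded u * unseeded v + 𝟙 (does (u Fin.≟ v)) * excess u
      E-y-product u v with u Fin.≟ v
      ... | yes ≡.refl = trans (E-y-square u) (+-congˡ (sym (*-identityˡ _)))
      ... | no  u≢v    = trans (E-y-pair u≢v) (trans (sym (+-identityʳ _)) (+-congˡ (sym (zeroˡ _))))

      sum-*-sum : ∀ {k} (f g : Fin k → Carrier) → sum f * sum g ≈ sum (λ u → sum (λ v → f u * g v))
      sum-*-sum f g = trans (*-distribʳ-sum (sum g) f) (sum-cong-≋ λ u → *-distribˡ-sum (f u) g)

    -- By `E-y-pair` the off-diagonal terms are exactly those of the squared mean, so only the
    -- diagonal excess remains.
    E-Y² : E (λ S → Y S * Y S) ≈ sum unseeded * sum unseeded + E (λ S → Y S * (weight S - 1#))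
    E-Y² = begin
      E (λ S → Y S * Y S)
        ≈⟨ E-cong (λ S → sum-*-sum (λ u → y u S) (λ v → y v S)) ⟩
      E (λ S → sum (λ u → sum (λ v → y u S * y v S)))
        ≈⟨ trans (E-sum (λ u S → sum (λ v → y u S * y v S))) (sum-cong-≋ λ u → E-sum (λ v S → y u S * y v S)) ⟩
      sum (λ u → sum (λ v → E (λ S → y u S * y v S)))
        ≈⟨ sum-cong-≋ (λ u → sum-cong-≋ (E-y-product u)) ⟩
      sum (λ u → sum (λ v → unseeded u * unseeded v + 𝟙 (does (u Fin.≟ v)) * excess u))
        ≈⟨ sum-cong-≋ (λ u → trans (∑-distrib-+ (λ v → unseeded u * unseeded v) _) (+-congˡ (sum-diagonal u (excess u)))) ⟩
      sum (λ u → sum (λ v → unseeded u * unseeded v) + excess u)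
        ≈⟨ ∑-distrib-+ (λ u → sum (λ v → unseeded u * unseeded v)) excess ⟩
      sum (λ u → sum (λ v → unseeded u * unseeded v)) + sum excess
        ≈⟨ +-cong (sym (sum-*-sum unseeded unseeded)) collect ⟩
      sum unseeded * sum unseeded + E (λ S → Y S * (weight S - 1#)) ∎
      where
      collect : sum excess ≈ E (λ S → Y S * (weight S - 1#))
      collect = trans (sym (E-sum (λ v S → y v S * (weight S - 1#)))) (E-cong λ S → sym (*-distribʳ-sum (weight S - 1#) (λ v → y v S)))

    variance : E (λ S → (Y S - sum unseeded) * (Y S - sum unseeded)) ≈ E (λ S → Y S * (weight S - 1#))
    variance = begin
      E (λ S → (Y S - N) * (Y S - N))
        ≈⟨ E-cong (λ S →
          (solve 2 (λ x N →
              (x :- N) :* (x :- N) :=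
              x :* x :+ ((:- (con (+ 2) :* N)) :* x :+ N :* N))
            refl (Y S) N)) ⟩
      E (λ S → Y S * Y S + (- (fromℕ 2 * N) * Y S + N * N))
        ≈⟨ trans (E-+ (λ S → Y S * Y S) _) (+-congˡ (trans (E-+ (λ S → - (fromℕ 2 * N) * Y S) (λ _ → N * N))
             (+-cong (E-*ˡ (- (fromℕ 2 * N)) Y) (E-const {List.length (potentialEdges n)} (N * N))))) ⟩
      E (λ S → Y S * Y S) + (- (fromℕ 2 * N) * E Y + N * N)
        ≈⟨ +-cong E-Y² (+-congʳ (*-congˡ E-Y)) ⟩
      N * N + V + (- (fromℕ 2 * N) * N + N * N)
        ≈⟨ (solve 2 (λ N V → N :* N :+ V :+ ((:- (con (+ 2) :* N)) :* N :+ N :* N) := V) refl N V) ⟩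
      V ∎
      where
      N V : Carrier
      N = sum unseeded
      V = E (λ S → Y S * (weight S - 1#))

    Y≈ : ∀ S → Y S ≈ fromℕ ∣ ∁ (W ∪ explored S) ∣ * weight S
    Y≈ S = trans (sym (*-distribʳ-sum (weight S) (λ v → 𝟙 (not (Vec.lookup (W ∪ explored S) v)))))
      (*-congʳ (trans (sum-cong-≋ λ v → reflexive (≡.cong 𝟙 (≡.sym (lookup-map v not (W ∪ explored S)))))
                      (sum-𝟙 (∁ (W ∪ explored S)))))

    sum-unseeded : sum unseeded ≈ fromℕ n - fromℕ ∣ W ∣
    sum-unseeded = begin
      sum unseeded            ≈⟨ sum-cong-≋ (λ v → reflexive (≡.cong 𝟙 (≡.sym (lookup-map v not W)))) ⟩
      sum (λ v → 𝟙 (Vec.lookup (∁ W) v))   ≈⟨ sum-𝟙 (∁ W) ⟩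
      fromℕ ∣ ∁ W ∣           ≡⟨ ≡.cong fromℕ (∣∁p∣≡n∸∣p∣ W) ⟩
      fromℕ (n ℕ.∸ ∣ W ∣)     ≈⟨ fromℕ-∸ (∣p∣≤n W) ⟩
      fromℕ n - fromℕ ∣ W ∣   ∎

  -- Chebyshev's inequality for `Y`, and the two tails

  module Deviation (n : ℕ)
    (ε p b : Carrier)
    (0<ε : 0# < ε) (100ε≤1 : fromℕ 100 * ε ≤ 1#)
    (0<p : 0# < p) (p≤ε² : p ≤ ε * ε) (np≈1+ε : fromℕ n * p ≈ 1# + ε)
    (b[1-p]≈1 : b * (1# - p) ≈ 1#)
    (halt : ℕ → Bool) (ws : List (Fin n)) (W : Subset n) (ws⊆W : ∀ {w} → w ∈ˡ ws → w ∈ W)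
    where

    open Profile n ε p b 0<ε 100ε≤1 0<p p≤ε² np≈1+ε b[1-p]≈1
    open Moments p b b[1-p]≈1 halt ws W ws⊆W
    open Expectation p

    private
      Edges : Set
      Edges = Subset (List.length (potentialEdges n))

      ν N : Carrier
      ν = fromℕ n
      N = sum unseeded

      0≤ε = <⇒≤ 0<ε
      0≤ν = fromℕ-nonneg n

      0≤weight : ∀ S → 0# ≤ weight S
      0≤weight S = ^-nonneg (size S) (<⇒≤ 0<b)

      size≤n : ∀ S → size S ℕ.≤ n
      size≤n S = ∣p∣≤n (explored S)

      unexplored : ∀ S → fromℕ ∣ ∁ (W ∪ explored S) ∣ ≈ ν - fromℕ ∣ W ∪ explored S ∣
      unexplored S = trans (reflexive (≡.cong fromℕ (∣∁p∣≡n∸∣p∣ (W ∪ explored S)))) (fromℕ-∸ (∣p∣≤n (W ∪ explored S)))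

      Y-≤ : ∀ S {x} → fromℕ ∣ ∁ (W ∪ explored S) ∣ ≤ x → Y S ≤ x * weight S
      Y-≤ S c≤x = ≤-trans (≤-reflexive (Y≈ S)) (y-x≈c⇒x≤y (x≤y⇒0≤y-x c≤x ⊗ 0≤weight S)
        (solve 3 (λ x B c →
            x :* B :- c :* B :=
            (x :- c) :* B)
          refl (_) (weight S) (fromℕ ∣ ∁ (W ∪ explored S) ∣)))

      Y-≥ : ∀ S {x} → x ≤ fromℕ ∣ ∁ (W ∪ explored S) ∣ → x * weight S ≤ Y S
      Y-≥ S x≤c = ≤-trans (y-x≈c⇒x≤y (x≤y⇒0≤y-x x≤c ⊗ 0≤weight S)
        (solve 3 (λ c B x →
            c :* B :- x :* B :=
            (c :- x) :* B)
          refl (fromℕ ∣ ∁ (W ∪ explored S) ∣) (weight S) (_))) (≤-reflexive (sym (Y≈ S)))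

    Y≤profile : ∀ S → Y S ≤ profile (size S)
    Y≤profile S = Y-≤ S (≤-trans (≤-reflexive (unexplored S))
      (y-x≈c⇒x≤y (x≤y⇒0≤y-x (fromℕ-mono-≤ (∣q∣≤∣p∪q∣ W (explored S))))
        (solve 3 (λ ν k c →
            ν :- k :- (ν :- c) :=
            c :- k)
          refl ν (fromℕ (size S)) (fromℕ ∣ W ∪ explored S ∣))))

    profile-W≤Y : ∀ S → profile (size S) - fromℕ ∣ W ∣ * weight S ≤ Y S
    profile-W≤Y S = ≤-trans
      (≤-reflexive
        (solve 4 (λ ν k B w →
            (ν :- k) :* B :- w :* B :=
            (ν :- (w :+ k)) :* B)
          refl ν (fromℕ (size S)) (weight S) (fromℕ ∣ W ∣)))
      (Y-≥ S (≤-trans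
        (y-x≈c⇒x≤y (x≤y⇒0≤y-x (≤-trans (fromℕ-mono-≤ (∣p∪q∣≤∣p∣+∣q∣ W (explored S))) (≤-reflexive (fromℕ-homo-+ ∣ W ∣ (size S)))))
          (solve 4 (λ ν c w k →
              ν :- c :- (ν :- (w :+ k)) :=
              w :+ k :- c)
            refl ν (fromℕ ∣ W ∪ explored S ∣) (fromℕ ∣ W ∣) (fromℕ (size S))))
        (≤-reflexive (sym (unexplored S)))))

    W⊆explored⇒profile≤Y : ∀ S → W ⊆ explored S → profile (size S) ≤ Y S
    W⊆explored⇒profile≤Y S W⊆D = Y-≥ S (≤-trans
      (y-x≈c⇒x≤y (x≤y⇒0≤y-x (fromℕ-mono-≤ (p⊆q⇒∣p∣≤∣q∣ W∪D⊆D)))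
        (solve 3 (λ ν c k →
            ν :- c :- (ν :- k) :=
            k :- c)
          refl ν (fromℕ ∣ W ∪ explored S ∣) (fromℕ (size S))))
      (≤-reflexive (sym (unexplored S))))
      where
      W∪D⊆D : W ∪ explored S ⊆ explored S
      W∪D⊆D x∈ = [ W⊆D , id ] (x∈p∪q⁻ W (explored S) x∈)

    module _ (∣W∣≤ε²n : fromℕ ∣ W ∣ ≤ ε * ε * ν) where

      -- Taking expectations in `profile-drift` and inserting the exact mean `n - |W|` of `Y`
      -- cancels `n` and leaves `2 ε E|D| ≤ |W| + 16 ε² n`, at most `17 ε² n`.
      mean-size : E (λ S → fromℕ (size S)) ≤ fromℕ 9 * (ε * ν)
      mean-size = *-cancelˡ-≤ 0<2ε
        (y-x≈c⇒x≤y (x≤y⇒0≤y-x drift ⊕ x≤y⇒0≤y-x ∣W∣≤ε²n ⊕ 0≤ε ⊗ 0≤ε ⊗ 0≤ν)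
          (solve 4 (λ ε ν K w →
              con (+ 2) :* ε :* (con (+ 9) :* (ε :* ν)) :- con (+ 2) :* ε :* K :=
              ν :+ con (+ 16) :* (ε :* ε) :* ν :- (con (+ 2) :* ε :* K
                :+ (ν :- w)) :+ (ε :* ε :* ν :- w) :+ ε :* ε :* ν)
            refl ε ν (E (λ S → fromℕ (size S))) (fromℕ ∣ W ∣)))
        where
        0<2ε : 0# < fromℕ 2 * ε
        0<2ε = *-pos (fromℕ-pos 1) 0<ε
        drift : fromℕ 2 * ε * E (λ S → fromℕ (size S)) + (ν - fromℕ ∣ W ∣) ≤ ν + fromℕ 16 * (ε * ε) * ν
        drift = ≤-trans (≤-reflexive (sym (trans (E-+ (λ S → fromℕ 2 * ε * fromℕ (size S)) Y)
            (+-cong (E-*ˡ _ (λ S → fromℕ (size S))) (trans E-Y sum-unseeded)))))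
          (≤-trans (E-mono (<⇒≤ 0<p) p≤1 λ S → ≤-trans (+-mono-≤ ≤-refl (Y≤profile S)) (profile-drift (size S)))
                   (≤-reflexive (E-const {List.length (potentialEdges n)} _)))

      variance-≤ : E (λ S → (Y S - N) * (Y S - N)) ≤ fromℕ 2304 * (ε * ν)
      variance-≤ = ≤-trans (≤-reflexive variance) (≤-trans (E-mono (<⇒≤ 0<p) p≤1 bound)
        (≤-trans (≤-reflexive (E-*ˡ (fromℕ 256) (λ S → fromℕ (size S))))
          (≤-trans (*-monoˡ-≤ (fromℕ-nonneg 256) mean-size) (≤-reflexive
            (solve 1 (λ x → con (+ 256) :* (con (+ 9) :* x) := con (+ 2304) :* x) refl (ε * ν))))))
        where
        bound : ∀ S → Y S * (weight S - 1#) ≤ fromℕ 256 * fromℕ (size S)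
        bound S = ≤-trans
          (*-mono-≤ (≤-trans (0≤Y S) (Y≤profile S)) (x≤y⇒0≤y-x (1≤^ (size S) 1≤b)) (Y≤profile S) ≤-refl)
          (profile-variance (size≤n S))
          where
          0≤Y : ∀ S → 0# ≤ Y S
          0≤Y S = ≤-trans (fromℕ-nonneg ∣ ∁ (W ∪ explored S) ∣ ⊗ 0≤weight S) (≤-reflexive (sym (Y≈ S)))

      -- Chebyshev's inequality at the threshold `τ ε² n`, whose square is `τ² ε³ n` times `ε n`.
      -- The factor `ε n` cancels against the variance bound, where `2304 = 256 · 9`.
      deviation : ∀ (τ : Carrier) (B : Edges → Bool) →
                  (∀ S → B S ≡ true → τ * (ε * ε * ν) ≤ N - Y S ⊎ τ * (ε * ε * ν) ≤ Y S - N) → 0# ≤ τ →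
                  τ * τ * (ε * ε * ε * ν) * E (λ S → 𝟙 (B S)) ≤ fromℕ 2304
      deviation τ B far 0≤τ = *-cancelˡ-≤ 0<εν (≤-trans
        (≤-reflexive
          (solve 4 (λ ε ν τ P →
              ε :* ν :* (τ :* τ :* (ε :* ε :* ε :* ν) :* P) :=
              τ :* (ε :* ε :* ν) :* (τ :* (ε :* ε :* ν)) :* P)
            refl ε ν τ (E (λ S → 𝟙 (B S)))))
        (≤-trans (≤-reflexive (sym (E-*ˡ _ (λ S → 𝟙 (B S)))))
          (≤-trans (E-mono (<⇒≤ 0<p) p≤1 λ S → pointwise S (B S) ≡.refl)
            (≤-trans variance-≤ (≤-reflexive (*-comm _ _))))))
        where
        0<εν : 0# < ε * ν
        0<εν = *-pos 0<ε (<-≤-trans (fromℕ-pos 0) (fromℕ-mono-≤ (ℕ.<⇒≤ 1<n)))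
        t : Carrier
        t = τ * (ε * ε * ν)
        0≤t : 0# ≤ t
        0≤t = 0≤τ ⊗ (0≤ε ⊗ 0≤ε ⊗ 0≤ν)
        square : ∀ {x} → t ≤ x → t * t ≤ x * x
        square t≤x = *-mono-≤ (≤-trans 0≤t t≤x) 0≤t t≤x t≤x
        pointwise : ∀ S c → B S ≡ c → t * t * 𝟙 c ≤ (Y S - N) * (Y S - N)
        pointwise S false _  = ≤-trans (≤-reflexive (zeroʳ _)) (square-nonneg (Y S - N))
        pointwise S true  BS with far S BS
        ... | inj₁ t≤ = ≤-trans (≤-reflexive (*-identityʳ _)) (≤-trans (square t≤)
                          (≤-reflexive
                            (solve 2 (λ N x →
                                (N :- x) :* (N :- x) :=
                                (x :- N) :* (x :- N))
                              refl N (Y S))))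
        ... | inj₂ t≤ = ≤-trans (≤-reflexive (*-identityʳ _)) (square t≤)

    module Tails {δ τ : Carrier} (100ε≤δ : fromℕ 100 * ε ≤ δ) (δ≤1 : δ ≤ 1#)
      (0≤τ : 0# ≤ τ) (32τ≤δ² : fromℕ 32 * τ ≤ δ * δ)
      (∣W∣≤ : fromℕ ∣ W ∣ ≤ fromℕ 2 * τ * (ε * ε * ν))
      where

      private
        0≤δ : 0# ≤ δ
        0≤δ = ≤-trans (fromℕ-nonneg 100 ⊗ 0≤ε) 100ε≤δ
        0≤1-δ = x≤y⇒0≤y-x δ≤1
        0≤ε²ν = 0≤ε ⊗ 0≤ε ⊗ 0≤ν

        ∣W∣≤ε²n : fromℕ ∣ W ∣ ≤ ε * ε * ν
        ∣W∣≤ε²n = ≤-trans ∣W∣≤ (y-x≈c⇒x≤y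
          ((x≤y⇒0≤y-x 32τ≤δ² ⊕ fromℕ-nonneg 30 ⊗ 0≤τ ⊕ 0≤1-δ ⊗ (<⇒≤ 0<1 ⊕ 0≤δ)) ⊗ 0≤ε²ν)
          (solve 4 (λ ε ν τ δ →
              ε :* ε :* ν :- con (+ 2) :* τ :* (ε :* ε :* ν) :=
              (δ :* δ :- con (+ 32) :* τ :+ con (+ 30) :* τ :+ (con (+ 1) :- δ) :* (con (+ 1) :+ δ)) :* (ε :* ε :* ν))
            refl ε ν τ δ))

      -- A large explored set puts `Y` at least `δ ε² n / 2` below `n`. Of this, `2 τ ε² n` may go
      -- into the mean being only `n - |W|`, and `τ ε² n` must remain; `32 τ ≤ δ² ≤ δ` provides for
      -- both.
      upper-tail : τ * τ * (ε * ε * ε * ν) * E (λ S → 𝟙 (does ((fromℕ 2 + δ) * ε * ν ≤? fromℕ (size S)))) ≤ fromℕ 2304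
      upper-tail = deviation ∣W∣≤ε²n τ _ (λ S large → inj₁ (far S (does-true⁻ (_ ≤? fromℕ (size S)) large))) 0≤τ
        where
        far : ∀ S → (fromℕ 2 + δ) * ε * ν ≤ fromℕ (size S) → τ * (ε * ε * ν) ≤ N - Y S
        far S large = *-cancelˡ-≤ (fromℕ-pos 1) (≤-trans
          (y-x≈c⇒x≤y (fromℕ-nonneg 2 ⊗ x≤y⇒0≤y-x (Y≤profile S)
              ⊕ x≤y⇒0≤y-x (profile-beyond 100ε≤δ δ≤1 (size S) large)
              ⊕ fromℕ-nonneg 2 ⊗ x≤y⇒0≤y-x ∣W∣≤
              ⊕ (x≤y⇒0≤y-x 32τ≤δ² ⊕ fromℕ-nonneg 26 ⊗ 0≤τ ⊕ δ≥0 ⊗ 0≤1-δ) ⊗ 0≤ε²ν)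
            (solve 7 (λ ν w y τ ε f δ →
                con (+ 2) :* (ν :- w :- y) :- con (+ 2) :* (τ :* (ε :* ε :* ν)) :=
                con (+ 2) :* (f :- y) :+ (con (+ 2) :* ν :- δ :* (ε :* ε) :* ν
                  :- con (+ 2) :* f) :+ con (+ 2) :* (con (+ 2) :* τ :* (ε :* ε :* ν)
                  :- w) :+ (δ :* δ :- con (+ 32) :* τ :+ con (+ 26) :* τ
                  :+ δ :* (con (+ 1) :- δ)) :* (ε :* ε :* ν))
              refl ν (fromℕ ∣ W ∣) (Y S) τ ε (profile (size S)) δ))
          (*-monoˡ-≤ (fromℕ-nonneg 2) (≤-reflexive (+-congʳ (sym sum-unseeded)))))
          where δ≥0 = 0≤δ

      -- A set of at most `(2 - δ) ε n` vertices lies where the profile is at least `n`, yet the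
      -- surplus vanishes as the set gets small. Hence `outcome`: a set too small to have a surplus
      -- must have used up all seeds.
      lower-tail : τ * (ε * ε * ν) ≤ fromℕ ∣ W ∣ →
                   (∀ S → δ * ε * ν ≤ fromℕ (size S) ⊎ W ⊆ explored S) →
                   τ * τ * (ε * ε * ε * ν) * E (λ S → 𝟙 (does (fromℕ (size S) ≤? (fromℕ 2 - δ) * ε * ν))) ≤ fromℕ 2304
      lower-tail ≤∣W∣ outcome =
        deviation ∣W∣≤ε²n τ _ (λ S small → inj₂ (far S (does-true⁻ (fromℕ (size S) ≤? _) small) (outcome S))) 0≤τ
        where
        far : ∀ S → fromℕ (size S) ≤ (fromℕ 2 - δ) * ε * ν → δ * ε * ν ≤ fromℕ (size S) ⊎ W ⊆ explored S →
              τ * (ε * ε * ν) ≤ Y S - N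
        -- The surplus of the profile is at least `δ ε |D| / 4 ≥ δ² ε² n / 4`. Leaving out
        -- unexplored seeds costs `|W| b^|D|`, at most `2 |W|`, of which one `|W|` is returned by
        -- the mean; this and the required `τ ε² n` make at most `3 τ ε² n`.
        far S small (inj₁ stopped) = *-cancelˡ-≤ (fromℕ-pos 3) (≤-trans
          (y-x≈c⇒x≤y (fromℕ-nonneg 4 ⊗ x≤y⇒0≤y-x (profile-W≤Y S)
              ⊕ x≤y⇒0≤y-x (profile-before 100ε≤δ δ≤1 (size S) small)
              ⊕ fromℕ-nonneg 4 ⊗ fromℕ-nonneg ∣ W ∣ ⊗ x≤y⇒0≤y-x (b^-before 100ε≤δ δ≤1 (size S) small)
              ⊕ fromℕ-nonneg 4 ⊗ x≤y⇒0≤y-x ∣W∣≤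
              ⊕ 0≤δ ⊗ 0≤ε ⊗ x≤y⇒0≤y-x stopped
              ⊕ (x≤y⇒0≤y-x 32τ≤δ² ⊕ fromℕ-nonneg 20 ⊗ 0≤τ) ⊗ 0≤ε²ν)
            (solve 9 (λ y ν w τ ε f B δ k →
                con (+ 4) :* (y :- (ν :- w)) :- con (+ 4) :* (τ :* (ε :* ε :* ν)) :=
                con (+ 4) :* (y :- (f :- w :* B)) :+ (con (+ 4) :* f
                  :- (con (+ 4) :* ν :+ δ :* ε :* k)) :+ con (+ 4) :* w :* (con (+ 2)
                  :- B) :+ con (+ 4) :* (con (+ 2) :* τ :* (ε :* ε :* ν)
                  :- w) :+ δ :* ε :* (k :- δ :* ε :* ν) :+ (δ :* δ
                  :- con (+ 32) :* τ :+ con (+ 20) :* τ) :* (ε :* ε :* ν))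
              refl (Y S) ν (fromℕ ∣ W ∣) τ ε (profile (size S)) (weight S) δ (fromℕ (size S))))
          (*-monoˡ-≤ (fromℕ-nonneg 4) (≤-reflexive (+-congˡ (-‿cong (sym sum-unseeded))))))
        -- With every seed explored, `Y` is at least `n` while its mean is `n - |W|`, so `|W|`
        -- itself is the deviation.
        far S small (inj₂ W⊆D) = *-cancelˡ-≤ (fromℕ-pos 3) (≤-trans
          (y-x≈c⇒x≤y (fromℕ-nonneg 4 ⊗ x≤y⇒0≤y-x (W⊆explored⇒profile≤Y S W⊆D)
              ⊕ x≤y⇒0≤y-x (profile-before 100ε≤δ δ≤1 (size S) small)
              ⊕ fromℕ-nonneg 4 ⊗ x≤y⇒0≤y-x ≤∣W∣
              ⊕ 0≤δ ⊗ 0≤ε ⊗ fromℕ-nonneg (size S))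
            (solve 8 (λ y ν w τ ε f δ k →
                con (+ 4) :* (y :- (ν :- w)) :- con (+ 4) :* (τ :* (ε :* ε :* ν)) :=
                con (+ 4) :* (y :- f) :+ (con (+ 4) :* f :- (con (+ 4) :* ν :+ δ :* ε :* k))
                  :+ con (+ 4) :* (w :- τ :* (ε :* ε :* ν)) :+ δ :* ε :* k)
              refl (Y S) ν (fromℕ ∣ W ∣) τ ε (profile (size S)) δ (fromℕ (size S))))
          (*-monoˡ-≤ (fromℕ-nonneg 4) (≤-reflexive (+-congˡ (-‿cong (sym sum-unseeded))))))

  -- Sums over all seed lists of a given length

  sumSeeds : ℕ → (List (Fin n) → Carrier) → Carrier
  sumSeeds zero    F = F []
  sumSeeds (suc m) F = sum (λ w → sumSeeds m (λ ws → F (w ∷ ws)))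

  sumSeeds-mono : ∀ m {F G : List (Fin n) → Carrier} →
                  (∀ ws → List.length ws ≡ m → F ws ≤ G ws) → sumSeeds m F ≤ sumSeeds m G
  sumSeeds-mono zero    F≤G = F≤G [] ≡.refl
  sumSeeds-mono (suc m) F≤G = sum-mono λ w → sumSeeds-mono m λ ws len → F≤G (w ∷ ws) (≡.cong suc len)

  sumSeeds-cong : ∀ m {F G : List (Fin n) → Carrier} → (∀ ws → F ws ≈ G ws) → sumSeeds m F ≈ sumSeeds m G
  sumSeeds-cong zero    F≈G = F≈G []
  sumSeeds-cong (suc m) F≈G = sum-cong-≋ λ w → sumSeeds-cong m λ ws → F≈G (w ∷ ws)

  sumSeeds-*ˡ : ∀ m c (F : List (Fin n) → Carrier) → sumSeeds m (λ ws → c * F ws) ≈ c * sumSeeds m F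
  sumSeeds-*ˡ zero    c F = refl
  sumSeeds-*ˡ (suc m) c F = trans (sum-cong-≋ λ w → sumSeeds-*ˡ m c (λ ws → F (w ∷ ws)))
    (sym (*-distribˡ-sum c (λ w → sumSeeds m (λ ws → F (w ∷ ws)))))

  sumSeeds-+ : ∀ m (F G : List (Fin n) → Carrier) → sumSeeds m (λ ws → F ws + G ws) ≈ sumSeeds m F + sumSeeds m G
  sumSeeds-+ zero    F G = refl
  sumSeeds-+ (suc m) F G = trans (sum-cong-≋ λ w → sumSeeds-+ m (λ ws → F (w ∷ ws)) _)
    (∑-distrib-+ (λ w → sumSeeds m (λ ws → F (w ∷ ws))) _)

  sumSeeds-const : ∀ m c → sumSeeds {n} m (λ _ → c) ≈ fromℕ n ^ m * c
  sumSeeds-const     zero    c = sym (*-identityˡ c)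
  sumSeeds-const {n} (suc m) c = begin
    sum (λ (w : Fin n) → sumSeeds {n} m (λ _ → c))  ≈⟨ sum-cong-≋ {n} (λ w → sumSeeds-const m c) ⟩
    sum (λ (w : Fin n) → fromℕ n ^ m * c)           ≈⟨ sum-constant n (fromℕ n ^ m * c) ⟩
    fromℕ n * (fromℕ n ^ m * c)                     ≈⟨ *-assoc _ _ _ ⟨
    fromℕ n * fromℕ n ^ m * c                       ∎
    where
    sum-constant : ∀ k x → sum (λ (i : Fin k) → x) ≈ fromℕ k * x
    sum-constant zero    x = sym (zeroˡ x)
    sum-constant (suc k) x = trans (+-cong (sym (*-identityˡ x)) (sum-constant k x)) (sym (distribʳ x 1# (fromℕ k)))

  -- Because repetitions are allowed, the entries of a list are chosen independently, and the count
  -- is an exact power.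
  sumSeeds-misses : ∀ m (A : Subset n) → sumSeeds m (λ ws → 𝟙 (misses A ws)) ≈ (fromℕ n - fromℕ ∣ A ∣) ^ m
  sumSeeds-misses     zero    A = refl
  sumSeeds-misses {n} (suc m) A = begin
    sum (λ w → sumSeeds m (λ ws → 𝟙 (not (Vec.lookup A w) ∧ misses A ws)))
      ≈⟨ sum-cong-≋ (λ w → trans (sumSeeds-cong m (λ ws → 𝟙-∧ (not (Vec.lookup A w)) (misses A ws)))
                                 (sumSeeds-*ˡ m _ (λ ws → 𝟙 (misses A ws)))) ⟩
    sum (λ w → 𝟙 (not (Vec.lookup A w)) * sumSeeds m (λ ws → 𝟙 (misses A ws)))
      ≈⟨ *-distribʳ-sum (sumSeeds m (λ ws → 𝟙 (misses A ws))) (λ w → 𝟙 (not (Vec.lookup A w))) ⟨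
    sum (λ w → 𝟙 (not (Vec.lookup A w))) * sumSeeds m (λ ws → 𝟙 (misses A ws))
      ≈⟨ *-cong (trans (sum-cong-≋ λ w → reflexive (≡.cong 𝟙 (≡.sym (lookup-map w not A)))) (sum-𝟙 (∁ A)))
                (sumSeeds-misses m A) ⟩
    fromℕ ∣ ∁ A ∣ * (fromℕ n - fromℕ ∣ A ∣) ^ m
      ≈⟨ *-congʳ (trans (reflexive (≡.cong fromℕ (∣∁p∣≡n∸∣p∣ A))) (fromℕ-∸ (∣p∣≤n A))) ⟩
    (fromℕ n - fromℕ ∣ A ∣) * (fromℕ n - fromℕ ∣ A ∣) ^ m ∎

  -- The inequality `(1 - x)^m (1 + m x) ≤ 1` for `x = a / (c + a)`, with the denominators cleared.
  bernoulli-sum : ∀ m {c a} → 0# ≤ c → 0# ≤ a → c ^ m * (c + a + fromℕ m * a) ≤ (c + a) ^ m * (c + a)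
  bernoulli-sum zero    {c} {a} 0≤c 0≤a = ≤-reflexive
    (solve 2 (λ c a → con (+ 1) :* (c :+ a :+ con (+ 0) :* a) := con (+ 1) :* (c :+ a)) refl c a)
  bernoulli-sum (suc m) {c} {a} 0≤c 0≤a = y-x≈c⇒x≤y
    ((0≤c ⊕ 0≤a) ⊗ x≤y⇒0≤y-x (bernoulli-sum m 0≤c 0≤a) ⊕ ^-nonneg m 0≤c ⊗ 0≤a ⊗ (0≤a ⊕ fromℕ-nonneg m ⊗ 0≤a))
    (solve 5 (λ c a s r k →
        (c :+ a) :* s :* (c :+ a) :- c :* r :* (c :+ a :+ (con (+ 1) :+ k) :* a) :=
        (c :+ a) :* (s :* (c :+ a) :- r :* (c :+ a :+ k :* a)) :+ r :* a :* (a :+ k :* a))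
      refl c a ((c + a) ^ m) (c ^ m) (fromℕ m))

  -- For `x = a / ν` the factor `1 + m x` of `bernoulli-sum` is at least 2.
  missing-≤-half : ∀ m {ν a} → 0# < ν → 0# ≤ a → a ≤ ν → ν ≤ fromℕ m * a → fromℕ 2 * (ν - a) ^ m ≤ ν ^ m
  missing-≤-half m {ν} {a} 0<ν 0≤a a≤ν ν≤ma = *-cancelˡ-≤ 0<ν (≤-trans
    (y-x≈c⇒x≤y (x≤y⇒0≤y-x (bernoulli-sum m 0≤c 0≤a) ⊕ ^-nonneg m 0≤c ⊗ x≤y⇒0≤y-x ν≤ma)
      (solve 5 (λ s ν a r k →
          s :* (ν :- a :+ a) :- ν :* (con (+ 2) :* r) :=
          s :* (ν :- a :+ a) :- r :* (ν :- a :+ a :+ k :* a) :+ r :* (k :* a :- ν))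
        refl ((ν - a + a) ^ m) ν a ((ν - a) ^ m) (fromℕ m)))
    (≤-reflexive (trans (*-cong (^-congˡ m c+a≈ν) c+a≈ν) (*-comm _ _))))
    where
    0≤c : 0# ≤ ν - a
    0≤c = x≤y⇒0≤y-x a≤ν
    c+a≈ν : ν - a + a ≈ ν
    c+a≈ν = (solve 2 (λ ν a → ν :- a :+ a := ν) refl ν a)

  -- From explored sets to the largest component

  module Concentration (n : ℕ)
    (ϵ p b : Carrier)
    (0<ϵ : 0# < ϵ) (100ϵ≤1 : fromℕ 100 * ϵ ≤ 1#)
    (0<p : 0# < p) (p≤ϵ² : p ≤ ϵ * ϵ) (np≈1+ϵ : fromℕ n * p ≈ 1# + ϵ)
    (b[1-p]≈1 : b * (1# - p) ≈ 1#)
    {δ τ : Carrier} (100ϵ≤δ : fromℕ 100 * ϵ ≤ δ) (δ≤1 : δ ≤ 1#)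
    (0≤τ : 0# ≤ τ) (32τ≤δ² : fromℕ 32 * τ ≤ δ * δ)
    (m : ℕ) (m≤ : fromℕ m ≤ fromℕ 2 * τ * (ϵ * ϵ * fromℕ n)) (≤m : τ * (ϵ * ϵ * fromℕ n) ≤ fromℕ m)
    (1≤τω : 1# ≤ τ * (ϵ * ϵ * ϵ * fromℕ n))
    where

    open Profile n ϵ p b 0<ϵ 100ϵ≤1 0<p p≤ϵ² np≈1+ϵ b[1-p]≈1 using (p≤1; 1<n)
    open Expectation p

    private
      Edges : Set
      Edges = Subset (List.length (potentialEdges n))

      ν scale : Carrier
      ν = fromℕ n
      scale = τ * τ * (ϵ * ϵ * ϵ * ν)

      0≤ϵ = <⇒≤ 0<ϵ
      0≤ν = fromℕ-nonneg n
      0≤δ : 0# ≤ δ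
      0≤δ = ≤-trans (fromℕ-nonneg 100 ⊗ 0≤ϵ) 100ϵ≤δ
      0<ν : 0# < ν
      0<ν = <-≤-trans (fromℕ-pos 0) (fromℕ-mono-≤ (ℕ.<⇒≤ 1<n))

    tooLarge : Edges → Bool
    tooLarge S = does ((fromℕ 2 + δ) * ϵ * ν ≤? fromℕ (L₁ {n} (graph S)))

    private
      reached : List (Fin n) → Edges → Bool
      reached ws S = does ((fromℕ 2 + δ) * ϵ * ν ≤? fromℕ ∣ explore (λ _ → false) (graph S) ws ⊥ ∣)

      reached-bound : ∀ ws → List.length ws ≡ m → scale * E (λ S → 𝟙 (reached ws S)) ≤ fromℕ 2304
      reached-bound ws len =
        Deviation.Tails.upper-tail n ϵ p b 0<ϵ 100ϵ≤1 0<p p≤ϵ² np≈1+ϵ b[1-p]≈1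
          (λ _ → false) ws (seedSet ws) (∈-seedSet ws) 100ϵ≤δ δ≤1 0≤τ 32τ≤δ²
          (≤-trans (fromℕ-mono-≤ (≡.subst (∣ seedSet ws ∣ ℕ.≤_) len (∣seedSet∣≤length ws))) m≤)

      E-sumSeeds : ∀ k (F : List (Fin n) → Edges → Carrier) →
                   E (λ S → sumSeeds k (λ ws → F ws S)) ≈ sumSeeds k (λ ws → E (F ws))
      E-sumSeeds zero    F = refl
      E-sumSeeds (suc k) F = trans (E-sum (λ w S → sumSeeds k (λ ws → F (w ∷ ws) S)))
        (sum-cong-≋ λ w → E-sumSeeds k (λ ws → F (w ∷ ws)))

      -- Since m · 2εn ≥ n, at most half of the seed lists miss a component this large.
      mostly-reached : ∀ S → ν ^ m * 𝟙 (tooLarge S) ≤ fromℕ 2 * sumSeeds m (λ ws → 𝟙 (reached ws S))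
      mostly-reached S = case ((fromℕ 2 + δ) * ϵ * ν ≤? fromℕ (L₁ {n} (graph S)))
        where
        G : Graph n
        G = graph S
        0≤reached : 0# ≤ sumSeeds m (λ ws → 𝟙 (reached ws S))
        0≤reached = ≤-trans (≤-reflexive (sym (trans (sumSeeds-const {n} m 0#) (zeroʳ _))))
          (sumSeeds-mono m λ ws _ → 𝟙-nonneg (reached ws S))
        case : (large? : Dec ((fromℕ 2 + δ) * ϵ * ν ≤ fromℕ (L₁ G))) →
               ν ^ m * 𝟙 (does large?) ≤ fromℕ 2 * sumSeeds m (λ ws → 𝟙 (reached ws S))
        case (no _) = ≤-trans (≤-reflexive (zeroʳ _)) (fromℕ-nonneg 2 ⊗ 0≤reached)
        case (yes large) = witness (largest G)
          where
          0<L₁ : 0# < fromℕ (L₁ G)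
          0<L₁ = <-≤-trans (*-pos (*-pos (+-pos-nonneg (fromℕ-pos 1) 0≤δ) 0<ϵ) 0<ν) large
          witness : L₁ G ≡ 0 ⊎ ∃[ v ] ∣ component G v ∣ ≡ L₁ G →
                    ν ^ m * 1# ≤ fromℕ 2 * sumSeeds m (λ ws → 𝟙 (reached ws S))
          witness (inj₁ L₁≡0) = contradiction (≤-reflexive (reflexive (≡.cong fromℕ L₁≡0))) (<⇒≱ 0<L₁)
          witness (inj₂ (v , ∣A∣≡L₁)) = y-x≈c⇒x≤y
            (x≤y⇒0≤y-x half ⊕ fromℕ-nonneg 2 ⊗ x≤y⇒0≤y-x split)
            (solve 3 (λ r s t →
                con (+ 2) :* r :- s :* con (+ 1) :=
                s :- con (+ 2) :* t :+ con (+ 2) :* (t :+ r :- s :* con (+ 1)))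
              refl (sumSeeds m (λ ws → 𝟙 (reached ws S))) (ν ^ m) ((ν - fromℕ ∣ component G v ∣) ^ m))
            where
            A : Subset n
            A = component G v
            large′ : (fromℕ 2 + δ) * ϵ * ν ≤ fromℕ ∣ A ∣
            large′ = ≤-trans large (≤-reflexive (reflexive (≡.cong fromℕ (≡.sym ∣A∣≡L₁))))
            hit : ∀ ws → misses A ws ≡ false → reached ws S ≡ true
            hit ws hits with misses-false A ws hits
            ... | w , w∈ws , w∈A = dec-true (_ ≤? _)
              (≤-trans large′ (fromℕ-mono-≤ (p⊆q⇒∣p∣≤∣q∣ (exhaustive-explore G ws w∈ws w∈A))))
            cover : ∀ ws c → misses A ws ≡ c → 1# ≤ 𝟙 c + 𝟙 (reached ws S)
            cover ws true  _    = y-x≈c⇒x≤y (𝟙-nonneg (reached ws S))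
              (solve 1 (λ i → con (+ 1) :+ i :- con (+ 1) := i) refl (𝟙 (reached ws S)))
            cover ws false hits = ≤-reflexive (sym (trans (+-identityˡ _) (reflexive (≡.cong 𝟙 (hit ws hits)))))
            split : ν ^ m * 1# ≤ (ν - fromℕ ∣ A ∣) ^ m + sumSeeds m (λ ws → 𝟙 (reached ws S))
            split = ≤-trans (≤-reflexive (sym (sumSeeds-const {n} m 1#)))
              (≤-trans (sumSeeds-mono m λ ws _ → cover ws (misses A ws) ≡.refl)
                (≤-reflexive (trans (sumSeeds-+ m (λ ws → 𝟙 (misses A ws)) _) (+-congʳ (sumSeeds-misses m A)))))
            -- From `m ≥ τ ϵ² n` and `|A| ≥ 2 ϵ n` the product is at least `2 τ (ϵ³ n) n`, and
            -- `1≤τω` applies.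
            ν≤m∣A∣ : ν ≤ fromℕ m * fromℕ ∣ A ∣
            ν≤m∣A∣ = y-x≈c⇒x≤y
              (x≤y⇒0≤y-x ≤m ⊗ fromℕ-nonneg ∣ A ∣ ⊕ 0≤τ ⊗ (0≤ϵ ⊗ 0≤ϵ ⊗ 0≤ν) ⊗ x≤y⇒0≤y-x large′
                ⊕ (<⇒≤ 0<1 ⊕ 0≤δ) ⊗ (0≤τ ⊗ (0≤ϵ ⊗ 0≤ϵ ⊗ 0≤ϵ ⊗ 0≤ν)) ⊗ 0≤ν ⊕ x≤y⇒0≤y-x 1≤τω ⊗ 0≤ν)
              (solve 6 (λ k a ν τ ϵ δ →
                  k :* a :- ν :=
                  (k :- τ :* (ϵ :* ϵ :* ν)) :* a :+ τ :* (ϵ :* ϵ :* ν) :* (a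
                    :- (con (+ 2) :+ δ) :* ϵ :* ν) :+ (con (+ 1)
                    :+ δ) :* (τ :* (ϵ :* ϵ :* ϵ :* ν)) :* ν :+ (τ :* (ϵ :* ϵ :* ϵ :* ν)
                    :- con (+ 1)) :* ν)
                refl (fromℕ m) (fromℕ ∣ A ∣) ν τ ϵ δ)
            half : fromℕ 2 * (ν - fromℕ ∣ A ∣) ^ m ≤ ν ^ m
            half = missing-≤-half m 0<ν (fromℕ-nonneg ∣ A ∣) (fromℕ-mono-≤ (∣p∣≤n A)) ν≤m∣A∣

    -- `upper-tail` holds for each seed list separately, so it survives summation over all `n^m` of
    -- them, once sum and expectation are exchanged. The factor 2 pays for the lists that miss the
    -- large component.
    tooLarge-bound : scale * E (λ S → 𝟙 (tooLarge S)) ≤ fromℕ 2 * fromℕ 2304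
    tooLarge-bound = *-cancelˡ-≤ (^-pos m 0<ν) (≤-trans
      (≤-reflexive
        (solve 3 (λ q c x →
            q :* (c :* x) :=
            c :* (q :* x))
          refl (ν ^ m) (scale) (E (λ S → 𝟙 (tooLarge S)))))
      (≤-trans (*-monoˡ-≤ 0≤scale (≤-trans (≤-reflexive (sym (E-*ˡ _ (λ S → 𝟙 (tooLarge S)))))
          (≤-trans (E-mono (<⇒≤ 0<p) p≤1 mostly-reached)
            (≤-reflexive (trans (E-*ˡ _ (λ S → sumSeeds m (λ ws → 𝟙 (reached ws S))))
                                (*-congˡ (E-sumSeeds m (λ ws S → 𝟙 (reached ws S)))))))))
        (≤-trans (≤-reflexive (trans
          (solve 2 (λ c x →
              c :* (con (+ 2) :* x) :=
              con (+ 2) :* (c :* x))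
            refl (scale) (sumSeeds m (λ ws → E (λ S → 𝟙 (reached ws S)))))
                                    (*-congˡ (sym (sumSeeds-*ˡ m scale (λ ws → E (λ S → 𝟙 (reached ws S))))))))
          (≤-trans (*-monoˡ-≤ (fromℕ-nonneg 2) (sumSeeds-mono m reached-bound))
            (≤-reflexive (trans (*-congˡ (sumSeeds-const {n} m (fromℕ 2304)))
              (solve 2 (λ q k →
                  con (+ 2) :* (q :* k) :=
                  q :* (con (+ 2) :* k))
                refl (ν ^ m) (fromℕ 2304))))))))
      where
      0≤scale : 0# ≤ scale
      0≤scale = 0≤τ ⊗ 0≤τ ⊗ (0≤ϵ ⊗ 0≤ϵ ⊗ 0≤ϵ ⊗ 0≤ν)

    private
      halt : ℕ → Bool
      halt k = does (δ * ϵ * ν ≤? fromℕ k)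

      W : Subset n
      W = initial n m

    tooSmall : Edges → Bool
    tooSmall S = does (fromℕ ∣ explore halt (graph S) (elements W) ⊥ ∣ ≤? (fromℕ 2 - δ) * ϵ * ν)

    tooSmall-bound : scale * E (λ S → 𝟙 (tooSmall S)) ≤ fromℕ 2304
    tooSmall-bound =
      Deviation.Tails.lower-tail n ϵ p b 0<ϵ 100ϵ≤1 0<p p≤ϵ² np≈1+ϵ b[1-p]≈1
        halt (elements W) W (λ w∈ → proj₂ (∈-filter⁻ (_∈? W) {xs = allFin n} w∈))
        100ϵ≤δ δ≤1 0≤τ 32τ≤δ² (≤-trans (≤-reflexive ∣W∣≈m) m≤)
        (≤-trans ≤m (≤-reflexive (sym ∣W∣≈m))) outcome
      where
      m≤n : m ℕ.≤ n
      m≤n = ℕ.<⇒≤pred (ℕ.s≤s (fromℕ-cancel-≤ m≤ν))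
        where
        fromℕ-cancel-≤ : ∀ {i j} → fromℕ i ≤ fromℕ j → i ℕ.≤ j
        fromℕ-cancel-≤ {i} {j} i≤j = ℕ.≮⇒≥ λ j<i → <⇒≱ (<-≤-trans (y-x≈c⇒x<y 0<1
          (solve 1 (λ j → con (+ 1) :+ j :- j := con (+ 1)) refl (fromℕ j))) (fromℕ-mono-≤ j<i)) i≤j
        m≤ν : fromℕ m ≤ ν
        m≤ν = ≤-trans m≤ (y-x≈c⇒x≤y
          ((x≤y⇒0≤y-x 32τ≤δ² ⊕ fromℕ-nonneg 30 ⊗ 0≤τ ⊕ x≤y⇒0≤y-x δ≤1 ⊗ (<⇒≤ 0<1 ⊕ 0≤δ)) ⊗ (0≤ϵ ⊗ 0≤ϵ ⊗ 0≤ν)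
            ⊕ (x≤y⇒0≤y-x 100ϵ≤1 ⊕ fromℕ-nonneg 99 ⊗ 0≤ϵ) ⊗ (<⇒≤ 0<1 ⊕ 0≤ϵ) ⊗ 0≤ν)
          (solve 4 (λ ν τ ϵ δ →
              ν :- con (+ 2) :* τ :* (ϵ :* ϵ :* ν) :=
              (δ :* δ :- con (+ 32) :* τ :+ con (+ 30) :* τ :+ (con (+ 1) :- δ) :* (con (+ 1) :+ δ)) :* (ϵ :* ϵ :* ν)
                :+ (con (+ 1) :- con (+ 100) :* ϵ :+ con (+ 99) :* ϵ) :* (con (+ 1)
                :+ ϵ) :* ν)
            refl ν τ ϵ δ))
      ∣W∣≈m : fromℕ ∣ W ∣ ≈ fromℕ m
      ∣W∣≈m = reflexive (≡.cong fromℕ (∣initial∣ n m≤n))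
      outcome : ∀ S → δ * ϵ * ν ≤ fromℕ ∣ explore halt (graph S) (elements W) ⊥ ∣ ⊎ W ⊆ explore halt (graph S) (elements W) ⊥
      outcome S with explore-outcome halt (graph S) (elements W) ⊥
      ... | inj₁ halted = inj₁ (does-true⁻ (δ * ϵ * ν ≤? _) halted)
      ... | inj₂ covers = inj₂ λ {w} w∈W → covers (∈-filter⁺ (_∈? W) (∈-allFin w) w∈W) (∈-component⁺ (graph S) Star.ε)

    -- Before its last component the explored set had fewer than `δ ϵ n` vertices, and afterwards
    -- more than `(2 - δ) ϵ n`; the difference fits into one component. The two losses of `δ` add
    -- up.
    tooSmall-false : ∀ S → tooSmall S ≡ false → (fromℕ 2 - fromℕ 2 * δ) * ϵ * ν ≤ fromℕ (L₁ {n} (graph S))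
    tooSmall-false S small≡false = bound (explore-overshoot halt (graph S) (elements W) ⊥
      -- The empty set counts as a stage before halting, because `δ ϵ n > 0`.
      (0 , dec-false (δ * ϵ * ν ≤? 0#) (<⇒≱ 0<δϵν) , ℕ.≤-trans (ℕ.≤-reflexive (∣⊥∣≡0 n)) ℕ.z≤n))
      where
      0<δϵν : 0# < δ * ϵ * ν
      0<δϵν = *-pos (*-pos (<-≤-trans (*-pos (fromℕ-pos 99) 0<ϵ) 100ϵ≤δ) 0<ϵ) 0<ν
      size : ℕ
      size = ∣ explore halt (graph S) (elements W) ⊥ ∣
      L : ℕ
      L = L₁ {n} (graph S)
      bound : ∃[ k ] halt k ≡ false × size ℕ.≤ k ℕ.+ L →
              (fromℕ 2 - fromℕ 2 * δ) * ϵ * ν ≤ fromℕ L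
      bound (k , going , size≤) = y-x≈c⇒x≤y
        (x≤y⇒0≤y-x (≤-trans (fromℕ-mono-≤ size≤) (≤-reflexive (fromℕ-homo-+ k L)))
          ⊕ x≤y⇒0≤y-x (<⇒≤ (≰⇒> (does-false⁻ (fromℕ size ≤? (fromℕ 2 - δ) * ϵ * ν) small≡false)))
          ⊕ x≤y⇒0≤y-x (<⇒≤ (≰⇒> (does-false⁻ (δ * ϵ * ν ≤? fromℕ k) going))))
        (solve 6 (λ l δ ϵ ν k s →
            l :- (con (+ 2) :- con (+ 2) :* δ) :* ϵ :* ν :=
            k :+ l :- s :+ (s :- (con (+ 2) :- δ) :* ϵ :* ν) :+ (δ :* ϵ :* ν :- k))
          refl (fromℕ L) δ ϵ ν (fromℕ k) (fromℕ size))

  -- Both tails combined, for one `n`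

  open Probability R

  private
    C : Carrier
    C = fromℕ 2 * fromℕ 2304 + fromℕ 2304

    0≤C : 0# ≤ C
    0≤C = fromℕ-nonneg 2 ⊗ fromℕ-nonneg 2304 ⊕ fromℕ-nonneg 2304

  x*[y*x⁻¹]≈y : ∀ {x} y → 0# < x → x * (y * x ⁻¹) ≈ y
  x*[y*x⁻¹]≈y {x} y 0<x = trans
    (solve 3 (λ x y i → x :* (y :* i) := y :* (x :* i)) refl x y (x ⁻¹))
    (trans (*-congˡ (⁻¹-inverseʳ (pos⇒≉0 0<x))) (*-identityʳ y))

  near? : ∀ n (δ ϵ : Carrier) →
          Decidable (λ (G : Graph n) → (fromℕ 2 - δ) * ϵ * fromℕ n ≤ fromℕ (L₁ G) ×
                                       fromℕ (L₁ G) ≤ (fromℕ 2 + δ) * ϵ * fromℕ n)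
  near? n δ ϵ G = ((fromℕ 2 - δ) * ϵ * fromℕ n ≤? fromℕ (L₁ G)) ×-dec (fromℕ (L₁ G) ≤? (fromℕ 2 + δ) * ϵ * fromℕ n)

  module _ (n : ℕ) {ϵ δ δ₀ τ η M : Carrier}
    (0<δ₀ : 0# < δ₀) (δ₀≤1 : δ₀ ≤ 1#) (2δ₀≤δ : fromℕ 2 * δ₀ ≤ δ)
    (0<τ : 0# < τ) (32τ≤δ₀² : fromℕ 32 * τ ≤ δ₀ * δ₀) (0<η : 0# < η)
    (2≤M : fromℕ 2 ≤ M) (1≤τM : 1# ≤ τ * M) (C≤τ²ηM : C ≤ τ * τ * η * M)
    (100ϵ≤δ₀ : fromℕ 100 * ϵ ≤ δ₀) (M<ϵ³n : M < ϵ ^ 3 * fromℕ n)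
    where

    private
      ν ω p b : Carrier
      ν = fromℕ n
      ω = ϵ * ϵ * ϵ * ν
      p = (1# + ϵ) * ν ⁻¹
      b = (1# - p) ⁻¹

      M<ω : M < ω
      M<ω = <-≤-trans M<ϵ³n (≤-reflexive
        (solve 2 (λ ϵ ν → ϵ :^ 3 :* ν := ϵ :* ϵ :* ϵ :* ν) refl ϵ ν))

      0<M : 0# < M
      0<M = <-≤-trans (fromℕ-pos 1) 2≤M

      0<ω : 0# < ω
      0<ω = <-trans 0<M M<ω

      0≤ν = fromℕ-nonneg n

      -- The sign of `ϵ` is read off from `ϵ³ n > 0`, as `ϵ² n` is nonnegative.
      0<ϵ : 0# < ϵ
      0<ϵ = *-cancelˡ-pos (square-nonneg ϵ ⊗ 0≤ν) (<-≤-trans 0<ω (≤-reflexive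
        (solve 2 (λ ϵ ν → ϵ :* ϵ :* ϵ :* ν := ϵ :* ϵ :* ν :* ϵ) refl ϵ ν)))

      0≤ϵ = <⇒≤ 0<ϵ
      0≤τ = <⇒≤ 0<τ

      0<ν : 0# < ν
      0<ν = *-cancelˡ-pos (0≤ϵ ⊗ 0≤ϵ ⊗ 0≤ϵ) 0<ω

      100ϵ≤1 : fromℕ 100 * ϵ ≤ 1#
      100ϵ≤1 = ≤-trans 100ϵ≤δ₀ δ₀≤1

      0≤1-ϵ : 0# ≤ 1# - ϵ
      0≤1-ϵ = ≤-trans (x≤y⇒0≤y-x 100ϵ≤1 ⊕ fromℕ-nonneg 99 ⊗ 0≤ϵ) (≤-reflexive
        (solve 1 (λ ϵ →
            con (+ 1) :- con (+ 100) :* ϵ :+ con (+ 99) :* ϵ :=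
            con (+ 1) :- ϵ)
          refl ϵ))

      np≈1+ϵ : ν * p ≈ 1# + ϵ
      np≈1+ϵ = x*[y*x⁻¹]≈y (1# + ϵ) 0<ν

      0<p : 0# < p
      0<p = *-pos (+-pos-nonneg 0<1 0≤ϵ) (⁻¹-pos 0<ν)

      -- Since `ϵ ≤ 1`, one has `ϵ² n ≥ ϵ³ n > M ≥ 2 ≥ 1 + ϵ = n p`.
      p≤ϵ² : p ≤ ϵ * ϵ
      p≤ϵ² = *-cancelˡ-≤ 0<ν (≤-trans (≤-reflexive np≈1+ϵ) (y-x≈c⇒x≤y
        (0≤ϵ ⊗ 0≤ϵ ⊗ 0≤ν ⊗ 0≤1-ϵ ⊕ x≤y⇒0≤y-x (<⇒≤ M<ω) ⊕ x≤y⇒0≤y-x 2≤M ⊕ 0≤1-ϵ)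
        (solve 3 (λ ν ϵ M →
            ν :* (ϵ :* ϵ) :- (con (+ 1) :+ ϵ) :=
            ϵ :* ϵ :* ν :* (con (+ 1) :- ϵ) :+ (ϵ :* ϵ :* ϵ :* ν
              :- M) :+ (M :- con (+ 2)) :+ (con (+ 1) :- ϵ))
          refl ν ϵ M)))

      0<1-p : 0# < 1# - p
      0<1-p = <-≤-trans (+-pos-nonneg (*-pos (fromℕ-pos 98) 0<ϵ) (x≤y⇒0≤y-x p≤ϵ² ⊕ x≤y⇒0≤y-x 100ϵ≤1 ⊕ 0≤ϵ ⊗ 0≤1-ϵ))
        (≤-reflexive
          (solve 2 (λ ϵ q →
              con (+ 99) :* ϵ :+ (ϵ :* ϵ :- q :+ (con (+ 1) :- con (+ 100) :* ϵ)
                :+ ϵ :* (con (+ 1) :- ϵ)) :=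
              con (+ 1) :- q)
            refl ϵ (p)))

      b[1-p]≈1 : b * (1# - p) ≈ 1#
      b[1-p]≈1 = trans (*-comm b (1# - p)) (⁻¹-inverseʳ (pos⇒≉0 0<1-p))

      seeds : ∃[ m ] fromℕ m ≤ fromℕ 2 * τ * (ϵ * ϵ * ν) × fromℕ 2 * τ * (ϵ * ϵ * ν) < fromℕ (suc m)
      seeds = floor (fromℕ 2 * τ * (ϵ * ϵ * ν)) (fromℕ-nonneg 2 ⊗ 0≤τ ⊗ (0≤ϵ ⊗ 0≤ϵ ⊗ 0≤ν))

      m : ℕ
      m = proj₁ seeds

      -- Rounding `2 τ ϵ² n` down loses less than 1, and `1 ≤ τ ϵ³ n ≤ τ ϵ² n`; this is why the
      -- target carries the factor 2.
      ≤m : τ * (ϵ * ϵ * ν) ≤ fromℕ m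
      ≤m = y-x≈c⇒x≤y
        (x≤y⇒0≤y-x (<⇒≤ (proj₂ (proj₂ seeds))) ⊕ 0≤τ ⊗ (0≤ϵ ⊗ 0≤ϵ ⊗ 0≤ν) ⊗ 0≤1-ϵ
          ⊕ 0≤τ ⊗ x≤y⇒0≤y-x (<⇒≤ M<ω) ⊕ x≤y⇒0≤y-x 1≤τM)
        (solve 5 (λ k τ ϵ ν M →
            k :- τ :* (ϵ :* ϵ :* ν) :=
            con (+ 1) :+ k :- con (+ 2) :* τ :* (ϵ :* ϵ :* ν)
              :+ τ :* (ϵ :* ϵ :* ν) :* (con (+ 1) :- ϵ) :+ τ :* (ϵ :* ϵ :* ϵ :* ν
              :- M) :+ (τ :* M :- con (+ 1)))
          refl (fromℕ m) τ ϵ ν M)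

      1≤τω : 1# ≤ τ * ω
      1≤τω = ≤-trans 1≤τM (*-monoˡ-≤ 0≤τ (<⇒≤ M<ω))

      open Concentration n ϵ p b 0<ϵ 100ϵ≤1 0<p p≤ϵ² np≈1+ϵ b[1-p]≈1
        100ϵ≤δ₀ δ₀≤1 0≤τ 32τ≤δ₀² m (proj₁ (proj₂ seeds)) ≤m 1≤τω
      open Expectation p

      Edges : Set
      Edges = Subset (List.length (potentialEdges n))

      good large small : Edges → Carrier
      good  S = 𝟙 (does (near? n δ ϵ (graph S)))
      large S = 𝟙 (tooLarge S)
      small S = 𝟙 (tooSmall S)

      cover : ∀ S → 1# ≤ good S + (large S + small S)
      cover S = go (tooLarge S) (tooSmall S) ≡.refl ≡.refl
        where
        go : ∀ l s → tooLarge S ≡ l → tooSmall S ≡ s → 1# ≤ good S + (𝟙 l + 𝟙 s)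
        go true  s     _ _ = y-x≈c⇒x≤y (𝟙-nonneg (does (near? n δ ϵ (graph S))) ⊕ 𝟙-nonneg s)
          (solve 2 (λ g s → g :+ (con (+ 1) :+ s) :- con (+ 1) := g :+ s) refl (good S) (𝟙 s))
        go false true  _ _ = y-x≈c⇒x≤y (𝟙-nonneg (does (near? n δ ϵ (graph S))))
          (solve 1 (λ g → g :+ (con (+ 0) :+ con (+ 1)) :- con (+ 1) := g) refl (good S))
        go false false notLarge notSmall = ≤-reflexive (sym (trans
          (+-cong (reflexive (≡.cong 𝟙 (dec-true (near? n δ ϵ (graph S)) (lower , upper)))) (+-identityˡ 0#)) (+-identityʳ 1#)))
          where
          L : ℕ
          L = L₁ {n} (graph S)
          0≤ϵν = 0≤ϵ ⊗ 0≤ν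
          lower : (fromℕ 2 - δ) * ϵ * ν ≤ fromℕ L
          lower = ≤-trans (y-x≈c⇒x≤y (x≤y⇒0≤y-x 2δ₀≤δ ⊗ 0≤ϵν)
            (solve 4 (λ d ϵ ν δ →
                (con (+ 2) :- con (+ 2) :* d) :* ϵ :* ν :- (con (+ 2) :- δ) :* ϵ :* ν :=
                (δ :- con (+ 2) :* d) :* (ϵ :* ν))
              refl (δ₀) ϵ ν δ)) (tooSmall-false S notSmall)
          upper : fromℕ L ≤ (fromℕ 2 + δ) * ϵ * ν
          upper = ≤-trans (<⇒≤ (≰⇒> (does-false⁻ ((fromℕ 2 + δ₀) * ϵ * ν ≤? fromℕ L) notLarge)))
            (y-x≈c⇒x≤y ((x≤y⇒0≤y-x 2δ₀≤δ ⊕ <⇒≤ 0<δ₀) ⊗ 0≤ϵν)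
              (solve 4 (λ δ ϵ ν d →
                  (con (+ 2) :+ δ) :* ϵ :* ν :- (con (+ 2) :+ d) :* ϵ :* ν :=
                  (δ :- con (+ 2) :* d :+ d) :* (ϵ :* ν))
                refl δ ϵ ν (δ₀)))

      0≤p = <⇒≤ 0<p
      p≤1 : p ≤ 1#
      p≤1 = y-x≈c⇒x≤y (<⇒≤ 0<1-p) refl

      1≤E : 1# ≤ E good + (E large + E small)
      1≤E = ≤-trans (≤-reflexive (sym (E-const {List.length (potentialEdges n)} 1#)))
        (≤-trans (E-mono 0≤p p≤1 cover)
          (≤-reflexive (trans (E-+ good (λ S → large S + small S)) (+-congˡ (E-+ large small)))))

      -- Multiplied by `τ² ϵ³ n`, the bad probability is at most `C`, whereas `η` becomes larger
      -- than `C` by the choice of `M`.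
      bad<η : E large + E small < η
      bad<η = ≰⇒> λ η≤bad → <⇒≱ C<cη (≤-trans (*-monoˡ-≤ 0≤c η≤bad)
        (≤-trans (≤-reflexive (distribˡ _ _ _)) (+-mono-≤ tooLarge-bound tooSmall-bound)))
        where
        0≤c : 0# ≤ τ * τ * ω
        0≤c = 0≤τ ⊗ 0≤τ ⊗ <⇒≤ 0<ω
        C<cη : C < τ * τ * ω * η
        C<cη = ≤-<-trans C≤τ²ηM (y-x≈c⇒x<y (*-pos (*-pos (*-pos 0<τ 0<τ) 0<η) (x<y⇒0<y-x M<ω))
          (solve 4 (λ τ w η M →
              τ :* τ :* w :* η :- τ :* τ :* η :* M :=
              τ :* τ :* η :* (w :- M))
            refl τ (ω) η M))

      E-good≤1 : E good ≤ 1#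
      E-good≤1 = ≤-trans (E-mono 0≤p p≤1 λ S → 𝟙≤1 (does (near? n δ ϵ (graph S))))
        (≤-reflexive (E-const {List.length (potentialEdges n)} 1#))
        where
        𝟙≤1 : ∀ c → 𝟙 c ≤ 1#
        𝟙≤1 true  = ≤-refl
        𝟙≤1 false = <⇒≤ 0<1

    ℙ-close : abs (ℙ n ((1# + ϵ) * fromℕ n ⁻¹) (near? n δ ϵ) - 1#) < η
    ℙ-close = abs<⁺
      (≤-<-trans (≤-trans (≤-reflexive (+-congʳ (ℙ≈E n (near? n δ ϵ)))) (y-x≈c⇒x≤y (x≤y⇒0≤y-x E-good≤1)
        (solve 1 (λ x → con (+ 0) :- (x :- con (+ 1)) := con (+ 1) :- x) refl (E good)))) 0<η)
      (≤-<-trans (≤-trans (≤-reflexive (-‿cong (+-congʳ (ℙ≈E n (near? n δ ϵ)))))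
        (y-x≈c⇒x≤y (x≤y⇒0≤y-x 1≤E)
          (solve 2 (λ y x →
              y :- (:- (x :- con (+ 1))) :=
              x :+ y :- con (+ 1))
            refl (E large + E small) (E good)))) bad<η)

  -- Choice of parameters and passage to the limit

  private
    -- Half of `δ`, because `tooSmall-false` loses twice its parameter; capped because the estimates
    -- of the profile are made for parameters at most 1.
    halved : ∀ δ → 0# < δ → ∃[ δ₀ ] 0# < δ₀ × δ₀ ≤ 1# × fromℕ 2 * δ₀ ≤ δ
    halved δ 0<δ = go (≤-total δ 1#)
      where
      0<½ : 0# < fromℕ 2 ⁻¹
      0<½ = ⁻¹-pos (fromℕ-pos 1)
      2[x½]≤x : ∀ x → fromℕ 2 * (x * fromℕ 2 ⁻¹) ≤ x
      2[x½]≤x x = ≤-reflexive (x*[y*x⁻¹]≈y x (fromℕ-pos 1))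
      half≤1 : ∀ {x} → 0# ≤ x → fromℕ 2 * x ≤ 1# → x ≤ 1#
      half≤1 {x} 0≤x 2x≤1 = ≤-trans (y-x≈c⇒x≤y 0≤x
        (solve 1 (λ x → con (+ 2) :* x :- x := x) refl x)) 2x≤1
      go : δ ≤ 1# ⊎ 1# ≤ δ → ∃[ δ₀ ] 0# < δ₀ × δ₀ ≤ 1# × fromℕ 2 * δ₀ ≤ δ
      go (inj₁ δ≤1) = δ * fromℕ 2 ⁻¹ , *-pos 0<δ 0<½
        , half≤1 (<⇒≤ (*-pos 0<δ 0<½)) (≤-trans (2[x½]≤x δ) δ≤1) , 2[x½]≤x δ
      go (inj₂ 1≤δ) = 1# * fromℕ 2 ⁻¹ , *-pos 0<1 0<½
        , half≤1 (<⇒≤ (*-pos 0<1 0<½)) (2[x½]≤x 1#) , ≤-trans (2[x½]≤x 1#) 1≤δ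

  open Limits R

  ℙ-limit : (ε : ℕ → Carrier) → ε ⟶ 0# → (λ n → ε n ^ 3 * fromℕ n) ⟶∞ → (δ : Carrier) → 0# < δ →
    (λ n → ℙ n ((1# + ε n) * fromℕ n ⁻¹) (λ G → ((fromℕ 2 - δ) * ε n * fromℕ n ≤? fromℕ (L₁ G))
                            ×-dec (fromℕ (L₁ G) ≤? (fromℕ 2 + δ) * ε n * fromℕ n))) ⟶ 1#
  ℙ-limit ε ε→0 ω→∞ δ 0<δ η 0<η = go (halved δ 0<δ)
    where
    p : ℕ → Carrier
    p n = (1# + ε n) * fromℕ n ⁻¹
    go : (∃[ δ₀ ] 0# < δ₀ × δ₀ ≤ 1# × fromℕ 2 * δ₀ ≤ δ) →
         ∃[ N ] ∀ n → N ℕ.≤ n → abs (ℙ n (p n) (near? n δ (ε n)) - 1#) < η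
    go (δ₀ , 0<δ₀ , δ₀≤1 , 2δ₀≤δ) = N₁ ℕ.⊔ N₂ , λ n N≤n →
      ℙ-close n {ε n} {δ} {δ₀} {τ} {η} {M} 0<δ₀ δ₀≤1 2δ₀≤δ 0<τ (≤-reflexive 32τ≈δ₀²) 0<η 2≤M 1≤τM C≤τ²ηM
        (100ε≤δ₀ n (ℕ.≤-trans (ℕ.m≤m⊔n N₁ N₂) N≤n))
        (proj₂ (ω→∞ M) n (ℕ.≤-trans (ℕ.m≤n⊔m N₁ N₂) N≤n))
      where
      τ M e : Carrier
      τ = δ₀ * δ₀ * fromℕ 32 ⁻¹
      0<τ : 0# < τ
      0<τ = *-pos (*-pos 0<δ₀ 0<δ₀) (⁻¹-pos (fromℕ-pos 31))
      32τ≈δ₀² : fromℕ 32 * τ ≈ δ₀ * δ₀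
      32τ≈δ₀² = x*[y*x⁻¹]≈y (δ₀ * δ₀) (fromℕ-pos 31)
      0<τ²η : 0# < τ * τ * η
      0<τ²η = *-pos (*-pos 0<τ 0<τ) 0<η
      -- One summand for each of `1≤τM`, `2≤M` and `C≤τ²ηM`; all are nonnegative, so the sum serves
      -- as their maximum.
      M = 1# * τ ⁻¹ + fromℕ 2 + C * (τ * τ * η) ⁻¹
      0≤M₁ : 0# ≤ 1# * τ ⁻¹
      0≤M₁ = <⇒≤ 0<1 ⊗ <⇒≤ (⁻¹-pos 0<τ)
      0≤M₂ : 0# ≤ C * (τ * τ * η) ⁻¹
      0≤M₂ = 0≤C ⊗ <⇒≤ (⁻¹-pos 0<τ²η)
      2≤M : fromℕ 2 ≤ M
      2≤M = y-x≈c⇒x≤y (0≤M₁ ⊕ 0≤M₂)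
        (solve 2 (λ x y →
            x :+ con (+ 2) :+ y :- con (+ 2) :=
            x :+ y)
          refl (1# * τ ⁻¹) (C * (τ * τ * η) ⁻¹))
      1≤τM : 1# ≤ τ * M
      1≤τM = ≤-trans (≤-reflexive (sym (x*[y*x⁻¹]≈y 1# 0<τ)))
        (*-monoˡ-≤ (<⇒≤ 0<τ) (y-x≈c⇒x≤y (fromℕ-nonneg 2 ⊕ 0≤M₂)
          (solve 2 (λ x y →
              x :+ con (+ 2) :+ y :- x :=
              con (+ 2) :+ y)
            refl (1# * τ ⁻¹) (C * (τ * τ * η) ⁻¹))))
      C≤τ²ηM : C ≤ τ * τ * η * M
      C≤τ²ηM = ≤-trans (≤-reflexive (sym (x*[y*x⁻¹]≈y C 0<τ²η)))
        (*-monoˡ-≤ (<⇒≤ 0<τ²η) (y-x≈c⇒x≤y (0≤M₁ ⊕ fromℕ-nonneg 2)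
          (solve 2 (λ x y →
              x :+ con (+ 2) :+ y :- y :=
              x :+ con (+ 2))
            refl (1# * τ ⁻¹) (C * (τ * τ * η) ⁻¹))))
      e = δ₀ * fromℕ 100 ⁻¹
      N₁ N₂ : ℕ
      N₁ = proj₁ (ε→0 e (*-pos 0<δ₀ (⁻¹-pos (fromℕ-pos 99))))
      N₂ = proj₁ (ω→∞ M)
      100ε≤δ₀ : ∀ n → N₁ ℕ.≤ n → fromℕ 100 * ε n ≤ δ₀
      100ε≤δ₀ n N₁≤n = ≤-trans (*-monoˡ-≤ (fromℕ-nonneg 100) (≤-trans (≤-reflexive
        (solve 1 (λ x → x := x :- con (+ 0)) refl (ε n)))
          (≤-trans (x≤abs (ε n - 0#)) (<⇒≤ (proj₂ (ε→0 e (*-pos 0<δ₀ (⁻¹-pos (fromℕ-pos 99)))) n N₁≤n)))))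
        (≤-reflexive (x*[y*x⁻¹]≈y δ₀ (fromℕ-pos 99)))

theorem1 :
  (R : CompleteOrderedField) →
  let open CompleteOrderedField R
      open Probability R
      open Limits R
  in
  (ε : ℕ → Carrier) →
  ε ⟶ 0# →
  (λ n → ε n ^ 3 * fromℕ n) ⟶∞ →
  let p : ℕ → Carrier
      p n = (1# + ε n) * fromℕ n ⁻¹
  in
  (δ : Carrier) → 0# < δ →
  (λ n → ℙ n (p n) (λ G → ((fromℕ 2 - δ) * ε n * fromℕ n ≤? fromℕ (L₁ G))
                          ×-dec (fromℕ (L₁ G) ≤? (fromℕ 2 + δ) * ε n * fromℕ n))) ⟶ 1#
theorem1 R = RandomGraph.ℙ-limit R
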